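{- Let $G$ be the $xy$-sum of connected graphs $G_1,G_2\in\mathcal{G}^\circ_{xy}$. If $G_1\in\mathcal{C}^\circ_0(\widehat{g}^+)$ and $G_2\in\mathcal{C}^\circ_1(\widehat{g}^+)$, then $G\in\mathcal{C}^\circ_2(\widehat{g}^+)$. Conversely, for every $2$-connected graph $G\in\mathcal{C}^\circ_2(\widehat{g}^+)$ such that $\{x,y\}$ is a $2$-vertex-cut, there are connected graphs $G_1\in\mathcal{C}^\circ_0(\widehat{g}^+)$ and $G_2\in\mathcal{C}^\circ_1(\widehat{g}^+)$ in $\mathcal{G}^\circ_{xy}$ whose $xy$-sum is $G$.
   Context: All graphs are finite and simple. The Euler genus $\widehat{g}(G)$ is the minimum Euler genus of a surface in which $G$ embeds. $\mathcal{G}_{xy}$ is the class of graphs with two distinguished vertices $x,y$ (terminals). The set $\mathcal{M}(G)$ of minor-operations consists of deleting any edge, or contracting any edge other than $xy$ (a vertex obtained by contracting an edge incident with a terminal becomes a terminal; parallel edges are removed); $\mu G$ is the result of $\mu\in\mathcal{M}(G)$. $\mathcal{G}^\circ_{xy}$ is the subclass of graphs not containing the edge $xy$. $G^+$ is $G$ with the edge $xy$ added (if absent); $\widehat{g}^+(G)=\widehat{g}(G^+)$. For $G_1,G_2\in\mathcal{G}_{xy}$ with $V(G_1)\cap V(G_2)=\{x,y\}$, their $xy$-sum is $(V(G_1)\cup V(G_2),E(G_1)\cup E(G_2))$. $G$ is $\widehat{g}^+$-critical if $\widehat{g}^+(\mu G)<\widehat{g}^+(G)$ for every $\mu\in\mathcal{M}(G)$.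 $\mathcal{C}^\circ_k(\widehat{g}^+)$ is the class of $\widehat{g}^+$-critical graphs in $\mathcal{G}^\circ_{xy}$ with $\widehat{g}^+(G)=k+1$. -}

module Defs where

open import Data.Nat using (ℕ; zero; suc; _+_; _*_; _≤_; _<_; _<ᵇ_)
open import Data.Fin using (Fin; toℕ; _≟_)
import Data.Fin as F
open import Data.Bool using (Bool; true; false; T; not; _∧_; _∨_; if_then_else_)
open import Data.Bool.Properties using (∨-comm; ∧-comm)
open import Data.Product using (Σ; ∃; _×_; _,_; proj₁; proj₂)
open import Data.Sum using (_⊎_; inj₁; inj₂)
open import Data.Empty using (⊥; ⊥-elim)
open import Relation.Nullary using (¬_; yes; no)
open import Relation.Nullary.Decidable using (⌊_⌋)
open import Relation.Binary.PropositionalEquality using (_≡_; _≢_; refl; subst; cong₂)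
open import Relation.Binary.Construct.Closure.ReflexiveTransitive using (Star)

record Graph : Set where
  field
    n       : ℕ
    adj     : Fin n → Fin n → Bool
    adj-sym : ∀ u v → adj u v ≡ adj v u
    adj-irr : ∀ u → adj u u ≡ false
    x       : Fin n
    y       : Fin n
    x≢y     : x ≢ y

open Graph public

Edge : (G : Graph) → Fin (n G) → Fin (n G) → Set
Edge G u v = T (adj G u v)

NoXY : Graph → Set
NoXY G = adj G (x G) (y G) ≡ false

count : ∀ {m} → (Fin m → Bool) → ℕ
count {zero}  p = 0
count {suc m} p = (if p F.zero then 1 else 0) + count (λ i → p (F.suc i))

sumFin : ∀ {m} → (Fin m → ℕ) → ℕ
sumFin {zero}  f = 0
sumFin {suc m} f = f F.zero + sumFin (λ i → f (F.suc i))

numEdges : Graph → ℕ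
numEdges G = sumFin (λ u → count (λ v → (toℕ u <ᵇ toℕ v) ∧ adj G u v))

-- "R has exactly k classes": a surjection onto Fin k whose fibres are
-- exactly the R-related pairs (R is an equivalence relation in all uses).
NumClasses : {A : Set} → (A → A → Set) → ℕ → Set
NumClasses {A} R k =
  Σ (A → Fin k) λ r →
    (∀ i → ∃ λ a → r a ≡ i) ×
    (∀ a b → (r a ≡ r b → R a b) × (R a b → r a ≡ r b))

Connected : Graph → Set
Connected G = ∀ a b → Star (Edge G) a b

NumComponents : Graph → ℕ → Set
NumComponents G c = NumClasses (Star (Edge G)) c

-- Combinatorial embeddings (embedding schemes = generalised rotation
-- systems: a rotation at every vertex plus an edge signature), and the
-- faces they determine, traced via flags.

Dart : Graph → Set
Dart G = Σ (Fin (n G)) λ u → Σ (Fin (n G)) λ v → Edge G u v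

rev : (G : Graph) → Dart G → Dart G
rev G (u , v , e) = v , u , subst T (adj-sym G u v) e

iter : {A : Set} → (A → A) → ℕ → A → A
iter f zero    a = a
iter f (suc m) a = f (iter f m a)

record Scheme (G : Graph) : Set where
  field
    ρ        : Dart G → Dart G
    ρ⁻       : Dart G → Dart G
    ρ-tail   : ∀ d → proj₁ (ρ d) ≡ proj₁ d
    ρρ⁻      : ∀ d → ρ (ρ⁻ d) ≡ d
    ρ⁻ρ      : ∀ d → ρ⁻ (ρ d) ≡ d
    ρ-cyclic : ∀ d d' → proj₁ d ≡ proj₁ d' → ∃ λ m → iter ρ m d ≡ d'
    twisted     : Fin (n G) → Fin (n G) → Bool
    twisted-sym : ∀ u v → twisted u v ≡ twisted v u

open Scheme public

Flag : Graph → Set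
Flag G = Dart G × Bool

α₀ : {G : Graph} → Scheme G → Flag G → Flag G
α₀ {G} S ((u , v , e) , s) =
  rev G (u , v , e) , (if twisted S u v then s else not s)

-- change edge around the vertex (within the same corner)
α₁ : {G : Graph} → Scheme G → Flag G → Flag G
α₁ S (d , true)  = ρ S d , false
α₁ S (d , false) = ρ⁻ S d , true

FlagStep : {G : Graph} → Scheme G → Flag G → Flag G → Set
FlagStep S f f' = (f' ≡ α₀ S f) ⊎ (f' ≡ α₁ S f)

Isolated : (G : Graph) → Fin (n G) → Set
Isolated G v = ∀ w → adj G v w ≡ false

-- faces: orbits of ⟨α₀, α₁⟩ on flags, plus one face per isolated vertex
FaceCarrier : (G : Graph) → Set
FaceCarrier G = Flag G ⊎ Σ (Fin (n G)) (Isolated G)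

SameFace : {G : Graph} → Scheme G → FaceCarrier G → FaceCarrier G → Set
SameFace S (inj₁ f) (inj₁ f') = Star (FlagStep S) f f'
SameFace S (inj₁ f) (inj₂ w)  = ⊥
SameFace S (inj₂ v) (inj₁ f)  = ⊥
SameFace S (inj₂ v) (inj₂ w)  = proj₁ v ≡ proj₁ w

NumFaces : {G : Graph} → Scheme G → ℕ → Set
NumFaces S f = NumClasses (SameFace S) f

-- G embeds in a surface of Euler genus g  (eg = 2c - |V| + |E| - f ≤ g)
EmbedsIn : Graph → ℕ → Set
EmbedsIn G g =
  Σ (Scheme G) λ S → Σ ℕ λ c → Σ ℕ λ f →
    NumComponents G c × NumFaces S f ×
    (2 * c + numEdges G ≤ n G + f + g)

IsEulerGenus : Graph → ℕ → Set
IsEulerGenus G g = EmbedsIn G g × (∀ g' → EmbedsIn G g' → g ≤ g')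

isXYPair : (G : Graph) → Fin (n G) → Fin (n G) → Bool
isXYPair G u v =
  (⌊ u ≟ x G ⌋ ∧ ⌊ v ≟ y G ⌋) ∨ (⌊ u ≟ y G ⌋ ∧ ⌊ v ≟ x G ⌋)

private
  pair-sym : ∀ G u v → isXYPair G u v ≡ isXYPair G v u
  pair-sym G u v
    rewrite ∧-comm ⌊ u ≟ x G ⌋ ⌊ v ≟ y G ⌋
          | ∧-comm ⌊ u ≟ y G ⌋ ⌊ v ≟ x G ⌋
          = ∨-comm (⌊ v ≟ y G ⌋ ∧ ⌊ u ≟ x G ⌋) (⌊ v ≟ x G ⌋ ∧ ⌊ u ≟ y G ⌋)

  pair-irr : ∀ G u → isXYPair G u u ≡ false
  pair-irr G u with u ≟ x G | u ≟ y G
  ... | yes refl | yes q = ⊥-elim (x≢y G q)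
  ... | yes _    | no _  = refl
  ... | no _     | yes _ = refl
  ... | no _     | no _  = refl

  plus-sym : ∀ G u v →
    (adj G u v ∨ isXYPair G u v) ≡ (adj G v u ∨ isXYPair G v u)
  plus-sym G u v = cong₂ _∨_ (adj-sym G u v) (pair-sym G u v)

  plus-irr : ∀ G u → (adj G u u ∨ isXYPair G u u) ≡ false
  plus-irr G u rewrite adj-irr G u = pair-irr G u

plus : Graph → Graph
plus G = record
  { n = n G
  ; adj = λ u v → adj G u v ∨ isXYPair G u v
  ; adj-sym = plus-sym G
  ; adj-irr = plus-irr G
  ; x = x G
  ; y = y G
  ; x≢y = x≢y G
  }

IsEulerGenus⁺ : Graph → ℕ → Set
IsEulerGenus⁺ G g = IsEulerGenus (plus G) g

-- Minor operations (results described up to terminal-preserving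
-- isomorphism, via the vertex map π : V(G) → V(H)).

SamePair : {A : Set} → A → A → A → A → Set
SamePair a b u v = (a ≡ u × b ≡ v) ⊎ (a ≡ v × b ≡ u)

record DeleteEdge (G H : Graph) (u v : Fin (n G)) : Set where
  field
    isEdge : Edge G u v
    π      : Fin (n G) → Fin (n H)
    π-inj  : ∀ a b → π a ≡ π b → a ≡ b
    π-surj : ∀ p → ∃ λ a → π a ≡ p
    π-x    : π (x G) ≡ x H
    π-y    : π (y G) ≡ y H
    π-adj  : ∀ a b →
      (Edge H (π a) (π b) → Edge G a b × ¬ SamePair a b u v) ×
      (Edge G a b × ¬ SamePair a b u v → Edge H (π a) (π b))

-- H = G / uv  (contract edge uv, uv ≠ xy; merged vertex is a terminal if
-- u or v was; parallel edges / loops are not created)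
record ContractEdge (G H : Graph) (u v : Fin (n G)) : Set where
  field
    isEdge : Edge G u v
    notXY  : ¬ SamePair u v (x G) (y G)
    π      : Fin (n G) → Fin (n H)
    π-uv   : π u ≡ π v
    π-inj  : ∀ a b → π a ≡ π b → a ≡ b ⊎ SamePair a b u v
    π-surj : ∀ p → ∃ λ a → π a ≡ p
    π-x    : π (x G) ≡ x H
    π-y    : π (y G) ≡ y H
    π-adj  : ∀ p q →
      (Edge H p q → p ≢ q × ∃ λ a → ∃ λ b → π a ≡ p × π b ≡ q × Edge G a b) ×
      (p ≢ q × (∃ λ a → ∃ λ b → π a ≡ p × π b ≡ q × Edge G a b) → Edge H p q)

MinorOp : Graph → Graph → Set
MinorOp G H =
  Σ (Fin (n G)) λ u → Σ (Fin (n G)) λ v →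
    DeleteEdge G H u v ⊎ ContractEdge G H u v

Critical⁺ : Graph → Set
Critical⁺ G =
  ∀ H → MinorOp G H → ∀ g h → IsEulerGenus⁺ G g → IsEulerGenus⁺ H h → h < g

InC° : ℕ → Graph → Set
InC° k G = NoXY G × Critical⁺ G × IsEulerGenus⁺ G (suc k)

-- xy-sums (up to terminal-preserving isomorphism): G is the xy-sum of
-- G₁ and G₂, realised by injections φ₁, φ₂ into V(G).

record XYSum (G G₁ G₂ : Graph) : Set where
  field
    φ₁      : Fin (n G₁) → Fin (n G)
    φ₂      : Fin (n G₂) → Fin (n G)
    φ₁-inj  : ∀ a b → φ₁ a ≡ φ₁ b → a ≡ b
    φ₂-inj  : ∀ a b → φ₂ a ≡ φ₂ b → a ≡ b
    φ₁-x    : φ₁ (x G₁) ≡ x G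
    φ₁-y    : φ₁ (y G₁) ≡ y G
    φ₂-x    : φ₂ (x G₂) ≡ x G
    φ₂-y    : φ₂ (y G₂) ≡ y G
    cover   : ∀ w → (∃ λ a → φ₁ a ≡ w) ⊎ (∃ λ b → φ₂ b ≡ w)
    shared  : ∀ a b → φ₁ a ≡ φ₂ b → (φ₁ a ≡ x G) ⊎ (φ₁ a ≡ y G)
    edges   : ∀ p q →
      (Edge G p q →
        (∃ λ a → ∃ λ b → φ₁ a ≡ p × φ₁ b ≡ q × Edge G₁ a b) ⊎
        (∃ λ a → ∃ λ b → φ₂ a ≡ p × φ₂ b ≡ q × Edge G₂ a b)) ×
      ((∃ λ a → ∃ λ b → φ₁ a ≡ p × φ₁ b ≡ q × Edge G₁ a b) ⊎
        (∃ λ a → ∃ λ b → φ₂ a ≡ p × φ₂ b ≡ q × Edge G₂ a b) →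
        Edge G p q)

Avoid : (G : Graph) → (Fin (n G) → Set) → Fin (n G) → Fin (n G) → Set
Avoid G S a b = Edge G a b × ¬ S a × ¬ S b

TwoConnected : Graph → Set
TwoConnected G =
  3 ≤ n G × Connected G ×
  (∀ v a b → a ≢ v → b ≢ v → Star (Avoid G (λ w → w ≡ v)) a b)

XYCut : Graph → Set
XYCut G =
  Σ (Fin (n G)) λ a → Σ (Fin (n G)) λ b →
    a ≢ x G × a ≢ y G × b ≢ x G × b ≢ y G ×
    ¬ Star (Avoid G (λ w → (w ≡ x G) ⊎ (w ≡ y G))) a b

{-# OPTIONS --safe #-}
-- The Euler genus is additive over the amalgamation P of A and B along an edge xy, and the theorem
-- follows because a minor of an xy-sum is an xy-sum with a minor of one part.
--
-- For additivity, view an embedding as a perfect matching N of the flags (dart , side): the faces are the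
-- cycles of α ∪ N and the vertices those of β ∪ N, where α crosses an edge and β changes the side of a dart.
-- Doubling xy makes N a matching of the flags of A and of B, with mixed pairs at x and at y only.
-- If the flags u, w on one side of mixed pairs (u , u') and (w , w') at the same terminal are joined by
-- a path of α ∪ N that avoids mixed pairs, then (u , w) and (u' , w') give one more face and at most one
-- more vertex.  When no such move is left, all these paths run from x to y, and a greedy choice rematches
-- their ends within A and within B so that faces - vertices drops by at most 2.  Cycles at the same vertex
-- are then merged by switches, each of which costs at most one face.  Since x and y have been split, A and B
-- together have at least as many faces as the doubled embedding.
module Submission where

open import Defs
open import Data.Product using (Σ; _×_)
open import Data.Nat using (ℕ; zero; suc; _+_; _*_; _∸_; _≤_; _<_; _<ᵇ_; s≤s)
open import Data.Nat.Properties as ℕₚ using (≤-trans; ≤-refl; ≤-reflexive; ≤-antisym; +-comm; +-assoc; +-suc)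
open import Data.Fin as F using (Fin; toℕ; _↑ˡ_; _↑ʳ_; splitAt; join; punchOut; punchIn)
import Data.Fin.Properties as Fₚ
open import Data.Bool using (Bool; true; false; T; not; _∧_; _∨_; if_then_else_; _xor_)
open import Data.Bool.Properties as Boolₚ using (T-irrelevant; T?)
open import Data.Product using (∃; _,_; proj₁; proj₂)
open import Data.Product.Properties using (≡-dec)
open import Data.Sum using (_⊎_; inj₁; inj₂; [_,_]′)
open import Data.Sum.Properties using (inj₁-injective; inj₂-injective)
open import Data.Empty using (⊥; ⊥-elim)
open import Data.Unit using (⊤; tt)
open import Data.List using (List; []; _∷_; _++_; map; allFin; length)
open import Data.List.Membership.Propositional using (_∈_; _∉_; find; lose)
open import Data.List.Membership.Propositional.Properties using (∈-++⁺ˡ; ∈-++⁺ʳ; ∈-++⁻; ∈-map⁺; ∈-map⁻; ∈-allFin; ∈-∃++)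
open import Data.List.Relation.Unary.Any using (here; there; any?)
open import Function using (_∘_; id; case_of_; _∋_)
open import Relation.Nullary using (¬_; Dec; yes; no; contradiction)
open import Relation.Nullary.Decidable using (map′; _×-dec_; _⊎-dec_; ¬?; ⌊_⌋; toWitness; fromWitness; decidable-stable)
open import Relation.Binary.Definitions using (DecidableEquality)
open import Relation.Binary.PropositionalEquality using (_≡_; _≢_; refl; sym; trans; cong; cong₂; subst; subst₂; ≢-sym; setoid)
import Data.List.Properties as Listₚ
open import Data.List.Relation.Unary.All as All using (All; []; _∷_)
open import Data.List.Relation.Unary.All.Properties using (¬Any⇒All¬; All¬⇒¬Any) renaming (++⁺ to All-++; ++⁻ˡ to All-++ˡ; ++⁻ʳ to All-++ʳ)
open import Data.List.Relation.Unary.AllPairs using ([]; _∷_)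
open import Data.List.Relation.Unary.Unique.Propositional using (Unique)
open import Data.List.Relation.Binary.Permutation.Propositional as Perm using (_↭_; prep; swap; ↭-sym; ↭-trans; ↭-refl; ↭-reflexive; ↭⇒↭ₛ)
open import Data.List.Relation.Binary.Permutation.Propositional.Properties using (∈-resp-↭; All-resp-↭; shift; shifts; ↭-length) renaming (++⁺ to ↭-++; ++⁺ʳ to ↭-++ʳ; ++-comm to ↭-++-comm)
import Data.List.Relation.Binary.Permutation.Setoid.Properties as SetoidPerm
open import Data.Nat.Solver using (module +-*-Solver)
open import Data.List.Relation.Unary.Unique.Propositional.Properties using (allFin⁺) renaming (++⁺ to Unique-++)
open import Relation.Binary.Construct.Closure.ReflexiveTransitive using (Star; ε; _◅_; _◅◅_; gmap)

-- Counting the classes of a generated equivalence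

-- Additivity turns criticality into arithmetic: with the genus of one summand fixed, a strict drop
-- of the other summand is the same as a strict drop of the sum. A part of genus 0 is impossible in
-- a critical sum, because deleting one of its edges cannot lower the total, so the total 3 can only
-- be 1 + 2.
--
-- The hard direction of additivity leads from the amalgamation to its parts. At x and at y the
-- darts of A and B may interleave arbitrarily, and merely restricting the rotations can lose faces.
-- While this is repaired, a vertex may fall apart into several cycles, so the intermediate
-- matchings are not embeddings of any of the graphs. Faces and vertices are therefore counted for
-- arbitrary matchings, and only their difference is controlled.
--
-- Euler's inequality has to be proved as well: the genera of the parts are obtained by subtraction
-- of natural numbers. The least genus of a graph is not computed. Its existence is available under
-- a double negation, which suffices because it is used only for contradictions and for decidable
-- inequalities.

nc-≤ : ∀ {A B : Set} {R : A → A → Set} {S : B → B → Set} {k l} (h : A → B) →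
  (∀ a b → S (h a) (h b) → R a b) → NumClasses R k → NumClasses S l → k ≤ l
nc-≤ h reflects (r , sur , iff) (r' , sur' , iff') =
  Fₚ.injective⇒≤ {f = λ i → r' (h (proj₁ (sur i)))}
    λ {i} {j} eq → trans (sym (proj₂ (sur i)))
      (trans (proj₂ (iff _ _) (reflects _ _ (proj₁ (iff' _ _) eq))) (proj₂ (sur j)))

nc-anti : ∀ {A : Set} {R S : A → A → Set} {k l} →
  (∀ a b → R a b → S a b) → NumClasses R k → NumClasses S l → l ≤ k
nc-anti sub nR nS = nc-≤ id sub nS nR

nc-pull : ∀ {A B : Set} {R : A → A → Set} {S : B → B → Set} {k} (h : A → B) →
  (∀ b → ∃ λ a → S (h a) b) → (∀ a b → S (h a) (h b) → R a b) → (∀ a b → R a b → S (h a) (h b)) →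
  NumClasses S k → NumClasses R k
nc-pull h lift reflects preserves (r , sur , iff) = r ∘ h ,
  (λ i → let b , eq = sur i ; a , s = lift b in a , trans (proj₂ (iff _ _) s) eq) ,
  λ a b → (λ eq → reflects a b (proj₁ (iff _ _) eq)) , λ q → proj₂ (iff _ _) (preserves a b q)

-- The form in which counts are compared: `h` has to be onto only up to `S`, so it can be any
-- convenient map between the underlying sets.
nc-unique : ∀ {A B : Set} {R : A → A → Set} {S : B → B → Set} {k l} (h : A → B) →
  (∀ b → ∃ λ a → S (h a) b) → (∀ a b → S (h a) (h b) → R a b) → (∀ a b → R a b → S (h a) (h b)) →
  NumClasses R k → NumClasses S l → k ≡ l
nc-unique h lift reflects preserves nR nS =
  ≤-antisym (nc-≤ id (λ _ _ → id) nR pulled) (nc-≤ id (λ _ _ → id) pulled nR)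
  where pulled = nc-pull h lift reflects preserves nS

Sum : ∀ {A B : Set} → (A → A → Set) → (B → B → Set) → A ⊎ B → A ⊎ B → Set
Sum R S (inj₁ a) (inj₁ b) = R a b
Sum R S (inj₂ a) (inj₂ b) = S a b
Sum R S _        _        = ⊥

nc-sum : ∀ {A B : Set} {R : A → A → Set} {S : B → B → Set} {k l} →
  NumClasses R k → NumClasses S l → NumClasses (Sum R S) (k + l)
nc-sum {A} {B} {R} {S} {k} {l} (r , sur , iff) (r' , sur' , iff') = g , onto , both
  where
  g : A ⊎ B → Fin (k + l)
  g (inj₁ a) = r a ↑ˡ l
  g (inj₂ b) = k ↑ʳ r' b
  onto : ∀ i → ∃ λ c → g c ≡ i
  onto i with splitAt k i in eq
  ... | inj₁ j = inj₁ (proj₁ (sur j)) ,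
    trans (cong (_↑ˡ l) (proj₂ (sur j))) (trans (sym (cong (join k l) eq)) (Fₚ.join-splitAt k l i))
  ... | inj₂ j = inj₂ (proj₁ (sur' j)) ,
    trans (cong (k ↑ʳ_) (proj₂ (sur' j))) (trans (sym (cong (join k l) eq)) (Fₚ.join-splitAt k l i))
  apart : ∀ i j → i ↑ˡ l ≢ k ↑ʳ j
  apart i j eq with trans (sym (Fₚ.splitAt-↑ˡ k i l)) (trans (cong (splitAt k) eq) (Fₚ.splitAt-↑ʳ k l j))
  ... | ()
  both : ∀ a b → (g a ≡ g b → Sum R S a b) × (Sum R S a b → g a ≡ g b)
  both (inj₁ a) (inj₁ b) = (λ eq → proj₁ (iff a b) (Fₚ.↑ˡ-injective l _ _ eq)) , λ q → cong (_↑ˡ l) (proj₂ (iff a b) q)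
  both (inj₂ a) (inj₂ b) = (λ eq → proj₁ (iff' a b) (Fₚ.↑ʳ-injective k _ _ eq)) , λ q → cong (k ↑ʳ_) (proj₂ (iff' a b) q)
  both (inj₁ a) (inj₂ b) = (λ eq → apart _ _ eq) , λ ()
  both (inj₂ a) (inj₁ b) = (λ eq → apart _ _ (sym eq)) , λ ()

-- Cardinality is the number of classes of equality, so that the lemmas on quotients also count
-- plain sets.
Finite : Set → ℕ → Set
Finite A N = NumClasses {A} _≡_ N

fin-Fin : ∀ n → Finite (Fin n) n
fin-Fin n = id , (λ i → i , refl) , λ a b → id , id

fin-⊤ : Finite ⊤ 1
fin-⊤ = (λ _ → F.zero) , (λ { F.zero → tt , refl }) , λ a b → (λ _ → refl) , λ _ → refl

abstract
  fin-sum : ∀ {A B : Set} {k l} → Finite A k → Finite B l → Finite (A ⊎ B) (k + l)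
  fin-sum {A} {B} fA fB = nc-pull id (λ b → b , sum-refl b) from to (nc-sum fA fB)
    where
    sum-refl : ∀ b → Sum {A} {B} _≡_ _≡_ b b
    sum-refl (inj₁ a) = refl
    sum-refl (inj₂ b) = refl
    from : ∀ a b → Sum {A} {B} _≡_ _≡_ a b → a ≡ b
    from (inj₁ a) (inj₁ b) refl = refl
    from (inj₂ a) (inj₂ b) refl = refl
    to : ∀ a b → a ≡ b → Sum {A} {B} _≡_ _≡_ a b
    to a .a refl = sum-refl a

fin-T : ∀ b → Finite (T b) (if b then 1 else 0)
fin-T true  = fin-⊤
fin-T false = (λ ()) , (λ ()) , λ ()

abstract
  fin-transport : ∀ {A B : Set} {k} (h : A → B) → (∀ a b → h a ≡ h b → a ≡ b) → (∀ b → ∃ λ a → h a ≡ b) →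
    Finite B k → Finite A k
  fin-transport h inj sur = nc-pull h sur inj (λ a b → cong h)

  fin-Σ : ∀ {m} (B : Fin m → Set) (f : Fin m → ℕ) → (∀ i → Finite (B i) (f i)) →
    Finite (Σ (Fin m) B) (sumFin f)
  fin-Σ {zero}  B f fB = (λ ()) , (λ ()) , λ ()
  fin-Σ {suc m} B f fB = fin-transport to inj onto
      (fin-sum (fB F.zero) (fin-Σ (B ∘ F.suc) (f ∘ F.suc) (fB ∘ F.suc)))
    where
    to : Σ (Fin (suc m)) B → B F.zero ⊎ Σ (Fin m) (B ∘ F.suc)
    to (F.zero  , b) = inj₁ b
    to (F.suc i , b) = inj₂ (i , b)
    inj : ∀ a b → to a ≡ to b → a ≡ b
    inj (F.zero  , b) (F.zero  , c) eq with inj₁-injective eq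
    ... | refl = refl
    inj (F.suc i , b) (F.suc j , c) eq with inj₂-injective eq
    ... | refl = refl
    onto : ∀ b → ∃ λ a → to a ≡ b
    onto (inj₁ b) = (F.zero , b) , refl
    onto (inj₂ (i , b)) = (F.suc i , b) , refl

count≡sum : ∀ {m} (p : Fin m → Bool) → count p ≡ sumFin (λ i → if p i then 1 else 0)
count≡sum {zero}  p = refl
count≡sum {suc m} p = cong ((if p F.zero then 1 else 0) +_) (count≡sum (p ∘ F.suc))

abstract
  fin-count : ∀ {m} (p : Fin m → Bool) → Finite (Σ (Fin m) (T ∘ p)) (count p)
  fin-count p = subst (Finite _) (sym (count≡sum p)) (fin-Σ (T ∘ p) _ (λ i → fin-T (p i)))

fin-≟ : ∀ {A N} → Finite A N → DecidableEquality A
fin-≟ (r , sur , iff) a b = map′ (proj₁ (iff a b)) (proj₂ (iff a b)) (r a Fₚ.≟ r b)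

enum : ∀ {A N} → Finite A N → List A
enum {N = N} (r , sur , iff) = map (λ i → proj₁ (sur i)) (allFin N)

∈-enum : ∀ {A N} (fA : Finite A N) a → a ∈ enum fA
∈-enum (r , sur , iff) a =
  subst (_∈ _) (proj₁ (iff _ a) (proj₂ (sur (r a)))) (∈-map⁺ _ (∈-allFin (r a)))

-- Generated by closure rules and not by walks, so that `conn-fold` into any other equivalence is
-- immediate.
data Conn {A : Set} (L : List (A × A)) : A → A → Set where
  edge : ∀ {a b} → (a , b) ∈ L → Conn L a b
  crefl : ∀ {a} → Conn L a a
  csym : ∀ {a b} → Conn L a b → Conn L b a
  ctrans : ∀ {a b c} → Conn L a b → Conn L b c → Conn L a c

≡⇒conn : ∀ {A : Set} {L : List (A × A)} {a b} → a ≡ b → Conn L a b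
≡⇒conn refl = crefl

record IsEquiv {A : Set} (E : A → A → Set) : Set where
  field
    erefl : ∀ {a} → E a a
    esym : ∀ {a b} → E a b → E b a
    etrans : ∀ {a b c} → E a b → E b c → E a c
open IsEquiv public

conn-equiv : ∀ {A : Set} (L : List (A × A)) → IsEquiv (Conn L)
conn-equiv L = record { erefl = crefl ; esym = csym ; etrans = ctrans }

pull-equiv : ∀ {A B : Set} {E : B → B → Set} (h : A → B) → IsEquiv E → IsEquiv (λ a b → E (h a) (h b))
pull-equiv h q = record { erefl = erefl q ; esym = esym q ; etrans = etrans q }

≡-equiv : ∀ {A B : Set} (h : A → B) → IsEquiv (λ a b → h a ≡ h b)
≡-equiv h = record { erefl = refl ; esym = sym ; etrans = trans }

conn-fold : ∀ {A : Set} {L : List (A × A)} {E : A → A → Set} → IsEquiv E →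
  (∀ {a b} → (a , b) ∈ L → E a b) → ∀ {a b} → Conn L a b → E a b
conn-fold q f (edge m) = f m
conn-fold q f crefl = erefl q
conn-fold q f (csym c) = esym q (conn-fold q f c)
conn-fold q f (ctrans c d) = etrans q (conn-fold q f c) (conn-fold q f d)

conn-mono : ∀ {A : Set} {L L' : List (A × A)} → (∀ {p} → p ∈ L → p ∈ L') → ∀ {a b} → Conn L a b → Conn L' a b
conn-mono {L' = L'} f = conn-fold (conn-equiv L') (edge ∘ f)

conn-wk : ∀ {A : Set} {p} {L : List (A × A)} {a b} → Conn L a b → Conn (p ∷ L) a b
conn-wk = conn-mono there

-- One passage through the new pair is enough: two passages in the same direction shorten to one,
-- and two in opposite directions cancel.
conn-cons : ∀ {A : Set} {u v} {L : List (A × A)} {a b} → Conn ((u , v) ∷ L) a b →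
  Conn L a b ⊎ (Conn L a u × Conn L v b) ⊎ (Conn L a v × Conn L u b)
conn-cons {u = u} {v} {L} = conn-fold q step
  where
  E : _ → _ → Set
  E a b = Conn L a b ⊎ (Conn L a u × Conn L v b) ⊎ (Conn L a v × Conn L u b)
  step : ∀ {a b} → (a , b) ∈ (u , v) ∷ L → E a b
  step (here refl) = inj₂ (inj₁ (crefl , crefl))
  step (there m) = inj₁ (edge m)
  s : ∀ {a b} → E a b → E b a
  s (inj₁ c) = inj₁ (csym c)
  s (inj₂ (inj₁ (c , d))) = inj₂ (inj₂ (csym d , csym c))
  s (inj₂ (inj₂ (c , d))) = inj₂ (inj₁ (csym d , csym c))
  t : ∀ {a b c} → E a b → E b c → E a c
  t (inj₁ c) (inj₁ d) = inj₁ (ctrans c d)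
  t (inj₁ c) (inj₂ (inj₁ (d , e))) = inj₂ (inj₁ (ctrans c d , e))
  t (inj₁ c) (inj₂ (inj₂ (d , e))) = inj₂ (inj₂ (ctrans c d , e))
  t (inj₂ (inj₁ (c , d))) (inj₁ e) = inj₂ (inj₁ (c , ctrans d e))
  t (inj₂ (inj₁ (c , d))) (inj₂ (inj₁ (e , f))) = inj₂ (inj₁ (c , f))
  t (inj₂ (inj₁ (c , d))) (inj₂ (inj₂ (e , f))) = inj₁ (ctrans c f)
  t (inj₂ (inj₂ (c , d))) (inj₁ e) = inj₂ (inj₂ (c , ctrans d e))
  t (inj₂ (inj₂ (c , d))) (inj₂ (inj₁ (e , f))) = inj₁ (ctrans c f)
  t (inj₂ (inj₂ (c , d))) (inj₂ (inj₂ (e , f))) = inj₂ (inj₂ (c , f))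
  q : IsEquiv E
  q = record { erefl = inj₁ crefl ; esym = s ; etrans = t }

nc-dec : ∀ {A : Set} {R : A → A → Set} {k} → NumClasses R k → ∀ a b → Dec (R a b)
nc-dec (r , sur , iff) a b = map′ (proj₁ (iff a b)) (proj₂ (iff a b)) (r a Fₚ.≟ r b)

-- The label of `v` is punched out of the range, and its class takes over the label of `u`.
nc-merge : ∀ {A : Set} {k} (L : List (A × A)) (u v : A) → ¬ Conn L u v → NumClasses (Conn L) (suc k) →
  NumClasses (Conn ((u , v) ∷ L)) k
nc-merge {A} {k} L u v u≁v (r , sur , iff) = r' , onto , both
  where
  v≢u : r v ≢ r u
  v≢u eq = u≁v (csym (proj₁ (iff v u) eq))
  go : (i : Fin (suc k)) → Dec (r v ≡ i) → Fin k
  go i (yes _) = punchOut v≢u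
  go i (no ne) = punchOut ne
  r' : A → Fin k
  r' a = go (r a) (r v Fₚ.≟ r a)
  onto : ∀ i → ∃ λ a → r' a ≡ i
  onto i with sur (punchIn (r v) i)
  ... | a , eq = a , lem (r v Fₚ.≟ r a)
    where
    lem : (d : Dec (r v ≡ r a)) → go (r a) d ≡ i
    lem (yes e) = contradiction (sym (trans e eq)) (Fₚ.punchInᵢ≢i (r v) i)
    lem (no ne) = trans (Fₚ.punchOut-cong (r v) {i≢k = λ e → Fₚ.punchInᵢ≢i (r v) i (sym e)} eq) (Fₚ.punchOut-punchIn (r v))
  C : A → A → Set
  C = Conn ((u , v) ∷ L)
  uv : C u v
  uv = edge (here refl)
  emb : ∀ {a b} → r a ≡ r b → C a b
  emb eq = conn-wk (proj₁ (iff _ _) eq)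
  f : ∀ a b (d : Dec (r v ≡ r a)) (e : Dec (r v ≡ r b)) → go (r a) d ≡ go (r b) e → C a b
  f a b (yes d) (yes e) eq = emb (trans (sym d) e)
  f a b (yes d) (no e)  eq = ctrans (emb (sym d)) (ctrans (csym uv) (emb (Fₚ.punchOut-injective v≢u e eq)))
  f a b (no d)  (yes e) eq = ctrans (emb (Fₚ.punchOut-injective d v≢u eq)) (ctrans uv (emb e))
  f a b (no d)  (no e)  eq = emb (Fₚ.punchOut-injective d e eq)
  go-cong : ∀ {i j} (d : Dec (r v ≡ i)) (e : Dec (r v ≡ j)) → i ≡ j → go i d ≡ go j e
  go-cong (yes d) (yes e) eq = refl
  go-cong (yes d) (no e)  eq = contradiction (trans d eq) e
  go-cong (no d)  (yes e) eq = contradiction (trans e (sym eq)) d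
  go-cong (no d)  (no e)  eq = Fₚ.punchOut-cong (r v) eq
  uv' : r' u ≡ r' v
  uv' with r v Fₚ.≟ r u | r v Fₚ.≟ r v
  ... | yes e | _     = contradiction e v≢u
  ... | no _  | no ne = contradiction refl ne
  ... | no _  | yes _ = Fₚ.punchOut-cong (r v) refl
  step : ∀ {a b} → (a , b) ∈ (u , v) ∷ L → r' a ≡ r' b
  step (here refl) = uv'
  step {a} {b} (there m) = go-cong (r v Fₚ.≟ r a) (r v Fₚ.≟ r b) (proj₂ (iff a b) (edge m))
  both : ∀ a b → (r' a ≡ r' b → C a b) × (C a b → r' a ≡ r' b)
  both a b = f a b (r v Fₚ.≟ r a) (r v Fₚ.≟ r b) , conn-fold (≡-equiv r') step

conn-absorb : ∀ {A : Set} {u v} {L : List (A × A)} → Conn L u v → ∀ {a b} → Conn ((u , v) ∷ L) a b → Conn L a b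
conn-absorb {L = L} uv = conn-fold (conn-equiv L) λ { (here refl) → uv ; (there m) → edge m }

module Classes {A : Set} {N : ℕ} (fA : Finite A N) where
  abstract
    -- Pairs are inserted one at a time, and each either closes a cycle or lowers the count by one.
    -- The classifying map obtained on the way also makes `Conn` decidable.
    classes : (L : List (A × A)) → Σ ℕ (NumClasses (Conn L))
    classes [] = N , nc-pull id (λ b → b , refl) (λ a b → ≡⇒conn) (λ a b → conn-fold (≡-equiv id) (λ ())) fA
    classes ((u , v) ∷ L) with classes L
    ... | k , nk with nc-dec nk u v
    ...   | yes uv = k , nc-pull id (λ b → b , crefl) (λ _ _ → conn-wk) (λ _ _ → conn-absorb uv) nk
    classes ((u , v) ∷ L) | zero , nk | no ≁ with proj₁ nk u
    ...   | ()
    classes ((u , v) ∷ L) | suc k , nk | no ≁ = k , nc-merge L u v ≁ nk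

  cls : List (A × A) → ℕ
  cls L = proj₁ (classes L)

  nc-cls : ∀ L → NumClasses (Conn L) (cls L)
  nc-cls L = proj₂ (classes L)

  conn? : ∀ L a b → Dec (Conn L a b)
  conn? L = nc-dec (nc-cls L)

  cls-anti : ∀ L L' → (∀ {a b} → Conn L a b → Conn L' a b) → cls L' ≤ cls L
  cls-anti L L' sub = nc-anti (λ _ _ → sub) (nc-cls L) (nc-cls L')

  cls-cong : ∀ L L' → (∀ {a b} → Conn L a b → Conn L' a b) → (∀ {a b} → Conn L' a b → Conn L a b) →
    cls L ≡ cls L'
  cls-cong L L' f g = ≤-antisym (cls-anti L' L g) (cls-anti L L' f)

  cls-close : ∀ {u v} L → Conn L u v → cls ((u , v) ∷ L) ≡ cls L
  cls-close {u} {v} L uv = cls-cong ((u , v) ∷ L) L (conn-absorb uv) conn-wk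

  cls-merge : ∀ {u v} L → ¬ Conn L u v → cls L ≡ suc (cls ((u , v) ∷ L))
  cls-merge {u} {v} L ≁ with classes L
  ... | zero , nk with proj₁ nk u
  ...   | ()
  cls-merge {u} {v} L ≁ | suc k , nk =
    cong suc (nc-unique id (λ b → b , crefl) (λ _ _ → id) (λ _ _ → id)
      (nc-merge L u v ≁ nk) (nc-cls ((u , v) ∷ L)))

  cls-lip : ∀ {u v} L → cls L ≤ suc (cls ((u , v) ∷ L))
  cls-lip {u} {v} L with conn? L u v
  ... | yes uv = ≤-trans (≤-reflexive (sym (cls-close L uv))) (ℕₚ.n≤1+n _)
  ... | no ≁ = ≤-reflexive (cls-merge L ≁)

  cls-lip* : ∀ Q L → cls L ≤ length Q + cls (Q ++ L)
  cls-lip* [] L = ≤-refl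
  cls-lip* (p ∷ Q) L = ≤-trans (cls-lip* Q L)
    (≤-trans (ℕₚ.+-monoʳ-≤ (length Q) (cls-lip (Q ++ L))) (≤-reflexive (+-suc (length Q) _)))

  -- Adding (a , c) to the left-hand list makes it generate every pair of the right-hand one.
  cls-switch : ∀ {a b c d} L → cls ((a , b) ∷ (c , d) ∷ L) ≤ suc (cls ((a , c) ∷ (b , d) ∷ L))
  cls-switch {a} {b} {c} {d} L = ≤-trans (cls-lip {a} {c} _)
    (s≤s (cls-anti ((a , c) ∷ (b , d) ∷ L) ((a , c) ∷ (a , b) ∷ (c , d) ∷ L)
      (conn-fold (conn-equiv _) λ
        { (here refl) → edge (here refl)
        ; (there (here refl)) → ctrans (csym (edge (there (here refl))))
            (ctrans (edge (here refl)) (edge (there (there (here refl)))))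
        ; (there (there m)) → edge (there (there (there m))) })))

-- Partial matchings and the ends of their paths

unique-↭ : ∀ {A : Set} {xs ys : List A} → xs ↭ ys → Unique xs → Unique ys
unique-↭ p = SetoidPerm.Unique-resp-↭ (setoid _) (↭⇒↭ₛ p)

unique-∉ : ∀ {A : Set} {x : A} {xs} → Unique (x ∷ xs) → x ∉ xs
unique-∉ (px ∷ _) = All¬⇒¬Any px

unique-∷ : ∀ {A : Set} {x : A} {xs} → x ∉ xs → Unique xs → Unique (x ∷ xs)
unique-∷ x∉ q = ¬Any⇒All¬ _ x∉ ∷ q

unique-tail : ∀ {A : Set} {x : A} {xs} → Unique (x ∷ xs) → Unique xs
unique-tail (_ ∷ q) = q

unique-++ʳ : ∀ {A : Set} (xs : List A) {ys} → Unique (xs ++ ys) → Unique ys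
unique-++ʳ [] q = q
unique-++ʳ (x ∷ xs) q = unique-++ʳ xs (unique-tail q)

unique-++ˡ : ∀ {A : Set} (xs : List A) {ys} → Unique (xs ++ ys) → Unique xs
unique-++ˡ [] _ = []
unique-++ˡ (x ∷ xs) q = unique-∷ (λ m → unique-∉ q (∈-++⁺ˡ m)) (unique-++ˡ xs (unique-tail q))

unique-disjoint : ∀ {A : Set} (xs : List A) {ys} → Unique (xs ++ ys) → ∀ {z} → z ∈ xs → z ∉ ys
unique-disjoint (x ∷ xs) q (here refl) m = unique-∉ q (∈-++⁺ʳ xs m)
unique-disjoint (x ∷ xs) q (there n) m = unique-disjoint xs (unique-tail q) n m

flat : ∀ {A : Set} → List (A × A) → List A
flat [] = []
flat ((u , v) ∷ L) = u ∷ v ∷ flat L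

flat-++ : ∀ {A : Set} (L M : List (A × A)) → flat (L ++ M) ≡ flat L ++ flat M
flat-++ [] M = refl
flat-++ ((u , v) ∷ L) M = cong (λ z → u ∷ v ∷ z) (flat-++ L M)

flat-↭ : ∀ {A : Set} {L M : List (A × A)} → L ↭ M → flat L ↭ flat M
flat-↭ Perm.refl = ↭-refl
flat-↭ (prep (u , v) p) = prep u (prep v (flat-↭ p))
flat-↭ (swap (u , v) (w , z) p) = ↭-trans (shifts (u ∷ v ∷ []) (w ∷ z ∷ [])) (prep w (prep z (prep u (prep v (flat-↭ p)))))
flat-↭ (Perm.trans p q) = ↭-trans (flat-↭ p) (flat-↭ q)

∈-flat : ∀ {A : Set} {u v : A} {L} → (u , v) ∈ L → u ∈ flat L × v ∈ flat L
∈-flat (here refl) = here refl , there (here refl)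
∈-flat (there m) = let a , b = ∈-flat m in there (there a) , there (there b)

AllP : ∀ {A : Set} → (A → A → Set) → List (A × A) → Set
AllP Q = All (λ p → Q (proj₁ p) (proj₂ p))

conn-↭ : ∀ {A : Set} {L L' : List (A × A)} → L ↭ L' → ∀ {a b} → Conn L a b → Conn L' a b
conn-↭ p = conn-mono (∈-resp-↭ p)

-- The pair at `u`, turned so that `u` comes first. This changes the list but not the equivalence it
-- generates. `R` stays arbitrary because the same matching is combined with the pairs of `α`, of
-- `β`, and of both.
record Pick {A : Set} (u : A) (L : List (A × A)) : Set₁ where
  field
    mate  : A
    rest  : List (A × A)
    flat↭ : flat L ↭ u ∷ mate ∷ flat rest
    all   : ∀ {Q : A → A → Set} → (∀ {a b} → Q a b → Q b a) → AllP Q L → AllP Q ((u , mate) ∷ rest)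
    conn  : ∀ {R a b} → Conn (L ++ R) a b → Conn ((u , mate) ∷ rest ++ R) a b
    conn⁻ : ∀ {R a b} → Conn ((u , mate) ∷ rest ++ R) a b → Conn (L ++ R) a b
    len   : length L ≡ suc (length rest)

pick : ∀ {A : Set} {u : A} L → u ∈ flat L → Pick u L
pick ((u , v) ∷ L) (here refl) = record
  { mate = v ; rest = L ; flat↭ = ↭-refl ; all = λ _ → id ; conn = id ; conn⁻ = id ; len = refl }
pick ((w , u) ∷ L) (there (here refl)) = record
  { mate = w ; rest = L ; flat↭ = swap w u ↭-refl ; all = λ { s (q ∷ qs) → s q ∷ qs }
  ; conn = conn-fold (conn-equiv _) (λ { (here refl) → csym (edge (here refl)) ; (there m) → edge (there m) })
  ; conn⁻ = conn-fold (conn-equiv _) (λ { (here refl) → csym (edge (here refl)) ; (there m) → edge (there m) })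
  ; len = refl }
pick {u = u} ((a , b) ∷ L) (there (there m)) = record
  { mate = P.mate ; rest = (a , b) ∷ P.rest
  ; flat↭ = ↭-trans (prep a (prep b P.flat↭)) (shifts (a ∷ b ∷ []) (u ∷ P.mate ∷ []))
  ; all = λ { s (q ∷ qs) → case P.all s qs of λ { (r ∷ rs) → r ∷ q ∷ rs } }
  ; conn = conn-fold (conn-equiv _) (λ { (here refl) → edge (there (here refl))
                                       ; (there m) → conn-mono sw (conn-wk (P.conn (edge m))) })
  ; conn⁻ = conn-fold (conn-equiv _) (λ { (here refl) → conn-wk (P.conn⁻ (edge (here refl)))
                                        ; (there (here refl)) → edge (here refl)
                                        ; (there (there m)) → conn-wk (P.conn⁻ (edge (there m))) })
  ; len = cong suc P.len }
  where
  module P = Pick (pick L m)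
  sw : ∀ {B : Set} {p q r : B} {M} → p ∈ q ∷ r ∷ M → p ∈ r ∷ q ∷ M
  sw (here e) = there (here e)
  sw (there (here e)) = here e
  sw (there (there e)) = there (there e)

-- A fixed-point-free involution, that is, a perfect matching given as a function.
record FPI (A : Set) : Set where
  field
    fun : A → A
    inv : ∀ a → fun (fun a) ≡ a
    fpf : ∀ a → fun a ≢ a

module Ends {A : Set} {N : ℕ} (fA : Finite A N) (α : FPI A) where
  open Classes fA
  open FPI α
  private
    _≟_ = fin-≟ fA

  -- Each pair is listed in both orders; only the generated equivalence is ever counted.
  pairs : List (A × A)
  pairs = map (λ a → a , fun a) (enum fA)

  pair-conn : ∀ L a → Conn (L ++ pairs) a (fun a)
  pair-conn L a = edge (∈-++⁺ʳ L (∈-map⁺ _ (∈-enum fA a)))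

  conn-base : ∀ {E : A → A → Set} L → IsEquiv E → (∀ {a b} → (a , b) ∈ L → E a b) → (∀ a → E a (fun a)) →
    ∀ {a b} → Conn (L ++ pairs) a b → E a b
  conn-base {E} L q f g = conn-fold q λ m → case ∈-++⁻ L m of λ
    { (inj₁ k) → f k ; (inj₂ k) → case ∈-map⁻ _ k of λ { (a , _ , refl) → g a } }

  -- Joining the free ends `u` and `v` concatenates their two paths, whose far ends `f u` and `f v`
  -- become partners.
  splice : (A → A) → A → A → A → A
  splice f u v w with f w ≟ u
  ... | yes _ = f v
  ... | no _ with f w ≟ v
  ...   | yes _ = f u
  ...   | no _ = f w

  splice-l : ∀ f {u v w} → f w ≡ u → splice f u v w ≡ f v
  splice-l f {u} {v} {w} e with f w ≟ u
  ... | yes _ = refl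
  ... | no n = contradiction e n

  splice-r : ∀ f {u v w} → u ≢ v → f w ≡ v → splice f u v w ≡ f u
  splice-r f {u} {v} {w} u≢v e with f w ≟ u
  ... | yes e' = contradiction (trans (sym e') e) u≢v
  ... | no _ with f w ≟ v
  ...   | yes _ = refl
  ...   | no n = contradiction e n

  splice-o : ∀ f {u v w} → f w ≢ u → f w ≢ v → splice f u v w ≡ f w
  splice-o f {u} {v} {w} n n' with f w ≟ u
  ... | yes e = contradiction e n
  ... | no _ with f w ≟ v
  ...   | yes e = contradiction e n'
  ...   | no _ = refl

  -- The graph with edges D and α is a union of cycles and of paths whose ends are
  -- the points outside D; ends D sends such a point to the other end of its path.
  ends : List (A × A) → A → A
  ends [] = fun
  ends ((u , v) ∷ D) = splice (ends D) u v

  ends-avoid : ∀ Q D {w} → ends D w ∉ flat Q → ends (Q ++ D) w ≡ ends D w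
  ends-avoid [] D n = refl
  ends-avoid ((u , v) ∷ Q) D {w} n = trans (splice-o (ends (Q ++ D))
      (λ e → n (here (trans (sym ih) e))) (λ e → n (there (here (trans (sym ih) e))))) ih
    where ih = ends-avoid Q D {w} (n ∘ there ∘ there)

  ends-label : ∀ {B : Set} (g : A → B) → (∀ a → g (fun a) ≡ g a) → ∀ D → AllP (λ u v → g u ≡ g v) D →
    ∀ w → g (ends D w) ≡ g w
  ends-label g gα [] _ w = gα w
  ends-label g gα ((u , v) ∷ D) (q ∷ qs) w with ends D w ≟ u
  ... | yes e = trans (ends-label g gα D qs v) (trans (sym q) (trans (cong g (sym e)) (ends-label g gα D qs w)))
  ... | no _ with ends D w ≟ v
  ...   | yes e = trans (ends-label g gα D qs u) (trans q (trans (cong g (sym e)) (ends-label g gα D qs w)))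
  ...   | no _ = ends-label g gα D qs w

  -- Nothing is asserted at the points of `D`, where `ends D` has no meaning. The field `only` is
  -- the degree argument: a component with all degrees at most two has no third free end.
  record Spec (D : List (A × A)) : Set where
    private M = ends D
    field
      out  : ∀ {w} → w ∉ flat D → M w ∉ flat D
      invo : ∀ {w} → w ∉ flat D → M (M w) ≡ w
      nofix : ∀ {w} → w ∉ flat D → M w ≢ w
      path : ∀ {w} → w ∉ flat D → Conn (D ++ pairs) w (M w)
      only : ∀ {w z} → w ∉ flat D → z ∉ flat D → Conn (D ++ pairs) w z → z ≡ w ⊎ z ≡ M w

  spec : ∀ D → Unique (flat D) → Spec D
  spec [] _ = record
    { out = λ _ ()
    ; invo = λ _ → inv _
    ; nofix = λ _ → fpf _
    ; path = λ _ → pair-conn [] _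
    ; only = λ _ _ → conn-base [] eqv (λ ()) (λ _ → inj₂ refl)
    }
    where
    eqv : IsEquiv (λ a b → b ≡ a ⊎ b ≡ fun a)
    eqv = record
      { erefl = inj₁ refl
      ; esym = λ { (inj₁ e) → inj₁ (sym e) ; (inj₂ e) → inj₂ (trans (sym (inv _)) (cong fun (sym e))) }
      ; etrans = λ { (inj₁ refl) d → d ; (inj₂ refl) (inj₁ d) → inj₂ d ; (inj₂ refl) (inj₂ d) → inj₁ (trans d (inv _)) }
      }
  spec ((u , v) ∷ D) uq = record { out = out' ; invo = invo' ; nofix = nofix' ; path = path' ; only = only' }
    where
    S = spec D (unique-tail (unique-tail uq))
    open Spec S
    M = ends D
    M' = ends ((u , v) ∷ D)
    u≢v : u ≢ v
    u≢v e = unique-∉ uq (here e)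
    u∉ : u ∉ flat D
    u∉ = unique-∉ uq ∘ there
    v∉ : v ∉ flat D
    v∉ = unique-∉ (unique-tail uq)
    data View (w : A) : Set where
      toL : M w ≡ u → w ≡ M u → M' w ≡ M v → View w
      toR : M w ≡ v → w ≡ M v → M' w ≡ M u → View w
      oth : M w ≢ u → M w ≢ v → M' w ≡ M w → View w
    view : ∀ {w} → w ∉ flat D → View w
    view {w} w∉ = case M w ≟ u of λ
      { (yes e) → toL e (trans (sym (invo w∉)) (cong M e)) (splice-l M e)
      ; (no n) → case M w ≟ v of λ
        { (yes e) → toR e (trans (sym (invo w∉)) (cong M e)) (splice-r M u≢v e)
        ; (no n') → oth n n' (splice-o M n n') } }
    low : ∀ {w} → w ∉ u ∷ v ∷ flat D → w ∉ flat D
    low w∉ = w∉ ∘ there ∘ there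
    notin : ∀ {z} → z ≢ u → z ≢ v → z ∉ flat D → z ∉ u ∷ v ∷ flat D
    notin a b c (here e) = a e
    notin a b c (there (here e)) = b e
    notin a b c (there (there e)) = c e
    out' : ∀ {w} → w ∉ u ∷ v ∷ flat D → M' w ∉ u ∷ v ∷ flat D
    out' {w} w∉ with view (low w∉)
    ... | toL e e' q = subst (_∉ _) (sym q) (notin
            (λ r → w∉ (there (here (trans e' (trans (cong M (sym r)) (invo v∉)))))) (nofix v∉) (out v∉))
    ... | toR e e' q = subst (_∉ _) (sym q) (notin (nofix u∉)
            (λ r → w∉ (here (trans e' (trans (cong M (sym r)) (invo u∉))))) (out u∉))
    ... | oth n n' q = subst (_∉ _) (sym q) (notin n n' (out (low w∉)))
    invo' : ∀ {w} → w ∉ u ∷ v ∷ flat D → M' (M' w) ≡ w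
    invo' {w} w∉ with view (low w∉)
    ... | toL e e' q = trans (cong M' q) (trans (splice-r M u≢v (invo v∉)) (sym e'))
    ... | toR e e' q = trans (cong M' q) (trans (splice-l M (invo u∉)) (sym e'))
    ... | oth n n' q = trans (cong M' q) (trans (splice-o M (λ r → w∉ (here (trans (sym (invo (low w∉))) r)))
                          (λ r → w∉ (there (here (trans (sym (invo (low w∉))) r))))) (invo (low w∉)))
    nofix' : ∀ {w} → w ∉ u ∷ v ∷ flat D → M' w ≢ w
    nofix' {w} w∉ r with view (low w∉)
    ... | toL e e' q = u≢v (trans (sym e) (trans (cong M (trans (sym r) q)) (invo v∉)))
    ... | toR e e' q = u≢v (sym (trans (sym e) (trans (cong M (trans (sym r) q)) (invo u∉))))
    ... | oth n n' q = nofix (low w∉) (trans (sym q) r)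
    path' : ∀ {w} → w ∉ u ∷ v ∷ flat D → Conn ((u , v) ∷ D ++ pairs) w (M' w)
    path' {w} w∉ with view (low w∉)
    ... | toL e e' q = subst₂ (Conn _) refl (sym q)
            (ctrans (ctrans (conn-wk (path (low w∉))) (≡⇒conn e)) (ctrans (edge (here refl)) (conn-wk (path v∉))))
    ... | toR e e' q = subst₂ (Conn _) refl (sym q)
            (ctrans (ctrans (conn-wk (path (low w∉))) (≡⇒conn e)) (ctrans (csym (edge (here refl))) (conn-wk (path u∉))))
    ... | oth n n' q = subst₂ (Conn _) refl (sym q) (conn-wk (path (low w∉)))
    only' : ∀ {w z} → w ∉ u ∷ v ∷ flat D → z ∉ u ∷ v ∷ flat D → Conn ((u , v) ∷ D ++ pairs) w z → z ≡ w ⊎ z ≡ M' w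
    only' {w} {z} w∉ z∉ c with conn-cons c
    ... | inj₁ d = case only (low w∉) (low z∉) d of λ
      { (inj₁ e) → inj₁ e
      ; (inj₂ e) → inj₂ (trans e (sym (splice-o M (λ r → z∉ (here (trans e r))) (λ r → z∉ (there (here (trans e r))))))) }
    ... | inj₂ (inj₁ (d , d')) = case only (low w∉) u∉ d , only v∉ (low z∉) d' of λ
      { (inj₁ e , _) → contradiction (here (sym e)) w∉
      ; (inj₂ e , inj₁ e') → contradiction (there (here e')) z∉
      ; (inj₂ e , inj₂ e') → inj₂ (trans e' (sym (splice-l M (sym e)))) }
    ... | inj₂ (inj₂ (d , d')) = case only (low w∉) v∉ d , only u∉ (low z∉) d' of λ
      { (inj₁ e , _) → contradiction (there (here (sym e))) w∉
      ; (inj₂ e , inj₁ e') → contradiction (here e') z∉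
      ; (inj₂ e , inj₂ e') → inj₂ (trans e' (sym (splice-r M u≢v (sym e)))) }

  A[_] : List (A × A) → ℕ
  A[ L ] = cls (L ++ pairs)

  merge-ends : ∀ {u v} D → Unique (flat ((u , v) ∷ D)) → ends D u ≢ v → A[ D ] ≡ suc A[ (u , v) ∷ D ]
  merge-ends {u} {v} D uq n = cls-merge (D ++ pairs) λ c →
    case Spec.only (spec D (unique-tail (unique-tail uq))) (unique-∉ uq ∘ there) (unique-∉ (unique-tail uq)) c of λ
      { (inj₁ e) → unique-∉ uq (here (sym e)) ; (inj₂ e) → n (sym e) }

  A-drop : ∀ Q D → A[ Q ++ D ] ≤ A[ D ]
  A-drop Q D = cls-anti (D ++ pairs) ((Q ++ D) ++ pairs)
    (conn-mono (λ {p} m → subst (p ∈_) (sym (Listₚ.++-assoc Q D pairs)) (∈-++⁺ʳ Q m)))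

  A-↭ : ∀ {L L'} → L ↭ L' → A[ L ] ≡ A[ L' ]
  A-↭ {L} {L'} p = cls-cong (L ++ pairs) (L' ++ pairs) (conn-↭ (↭-++ʳ pairs p)) (conn-↭ (↭-++ʳ pairs (↭-sym p)))

  A-lip : ∀ Q D → A[ D ] ≤ length Q + A[ Q ++ D ]
  A-lip Q D = ≤-trans (cls-lip* Q (D ++ pairs)) (≤-reflexive (cong (λ z → length Q + cls z) (sym (Listₚ.++-assoc Q D pairs))))

  -- Pairing off the two ends of a path closes a cycle that meets nothing else.
  switch-close : ∀ {a b c d} K D → Unique (flat ((a , b) ∷ (c , d) ∷ K ++ D)) → ends D a ≡ c →
    suc A[ (a , b) ∷ (c , d) ∷ K ++ D ] ≤ A[ (a , c) ∷ (b , d) ∷ K ++ D ]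
  switch-close {a} {b} {c} {d} K D uq e = ≤-trans (s≤s (cls-anti _ _ back)) (≤-reflexive (sym (cls-merge {a} {b} ((a , c) ∷ (b , d) ∷ (K ++ D) ++ pairs) apart)))
    where
    uqKD : Unique (flat K ++ flat D)
    uqKD = subst Unique (flat-++ K D) (unique-tail (unique-tail (unique-tail (unique-tail uq))))
    uqD = unique-++ʳ (flat K) uqKD
    S = spec D uqD
    inD : ∀ {z} → z ∈ flat D → z ∈ flat (K ++ D)
    inD m = subst (_ ∈_) (sym (flat-++ K D)) (∈-++⁺ʳ (flat K) m)
    inK : ∀ {z} → z ∈ flat K → z ∈ flat (K ++ D)
    inK m = subst (_ ∈_) (sym (flat-++ K D)) (∈-++⁺ˡ m)
    a∉ : a ∉ flat D
    a∉ = unique-∉ uq ∘ there ∘ there ∘ there ∘ inD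
    open Spec S
    W : A → Set
    W = Conn (D ++ pairs) a
    notW : ∀ {z} → z ∉ flat D → z ≢ a → z ≢ c → ¬ W z
    notW z∉ n n' w = case only a∉ z∉ w of λ { (inj₁ q) → n q ; (inj₂ q) → n' (trans q e) }
    b≢a : b ≢ a
    b≢a q = unique-∉ uq (here (sym q))
    bW : ¬ W b
    bW = notW (unique-∉ (unique-tail uq) ∘ there ∘ there ∘ inD) b≢a (λ q → unique-∉ (unique-tail uq) (here q))
    dW : ¬ W d
    dW = notW (unique-∉ (unique-tail (unique-tail (unique-tail uq))) ∘ inD) (λ q → unique-∉ uq (there (there (here (sym q)))))
      (λ q → unique-∉ (unique-tail (unique-tail uq)) (here (sym q)))
    kW : ∀ {z} → z ∈ flat K → ¬ W z
    kW m = notW (unique-disjoint (flat K) uqKD m)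
      (λ { refl → unique-∉ uq (there (there (there (inK m)))) })
      (λ { refl → unique-∉ (unique-tail (unique-tail uq)) (there (inK m)) })
    aW : W a
    aW = crefl
    cW : W c
    cW = subst W e (path a∉)
    E : A → A → Set
    E p q = (W p → W q) × (W q → W p)
    eqv : IsEquiv E
    eqv = record { erefl = id , id ; esym = λ (f , g) → g , f ; etrans = λ (f , g) (f' , g') → f' ∘ f , g ∘ g' }
    apart : ¬ Conn ((a , c) ∷ (b , d) ∷ (K ++ D) ++ pairs) a b
    apart con = bW (proj₁ (conn-base ((a , c) ∷ (b , d) ∷ K ++ D) eqv (λ
      { (here refl) → (λ _ → cW) , (λ _ → aW)
      ; (there (here refl)) → (λ w → contradiction w bW) , (λ w → contradiction w dW)
      ; (there (there m)) → case ∈-++⁻ K m of λ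
        { (inj₁ k) → (λ w → contradiction w (kW (proj₁ (∈-flat k)))) , (λ w → contradiction w (kW (proj₂ (∈-flat k))))
        ; (inj₂ k) → let r = edge (∈-++⁺ˡ k) in (λ w → ctrans w r) , (λ w → ctrans w (csym r)) } })
      (λ z → let r = pair-conn D z in (λ w → ctrans w r) , (λ w → ctrans w (csym r))) con) aW)
    ac : Conn ((a , b) ∷ (c , d) ∷ (K ++ D) ++ pairs) a c
    ac = conn-mono (λ {p} m → there (there (subst (p ∈_) (sym (Listₚ.++-assoc K D pairs)) (∈-++⁺ʳ K m)))) cW
    back : ∀ {p q} → Conn ((a , b) ∷ (a , c) ∷ (b , d) ∷ (K ++ D) ++ pairs) p q → Conn ((a , b) ∷ (c , d) ∷ (K ++ D) ++ pairs) p q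
    back = conn-fold (conn-equiv _) λ
      { (here refl) → edge (here refl)
      ; (there (here refl)) → ac
      ; (there (there (here refl))) → ctrans (csym (edge (here refl))) (ctrans ac (edge (there (here refl))))
      ; (there (there (there m))) → edge (there (there m)) }

  Perfect : List (A × A) → Set
  Perfect L = Unique (flat L) × (∀ a → a ∈ flat L)

  perfect-↭ : ∀ {L L'} → flat L ↭ flat L' → Perfect L → Perfect L'
  perfect-↭ p (uq , co) = unique-↭ p uq , λ a → ∈-resp-↭ p (co a)

  -- Without the first two pairs the free ends are exactly `u`, `u'`, `w`, `w'`. If the path from
  -- `u` ended at `w` or `w'`, then `u` and `w` would be connected; so it ends at `u'`, and the
  -- switched pairs only put two cycles in series.
  switch-conn : ∀ {u u' w w'} R → Perfect ((u , u') ∷ (w , w') ∷ R) → ¬ Conn ((u , u') ∷ (w , w') ∷ R ++ pairs) u w →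
    ∀ {a b} → Conn ((u , u') ∷ (w , w') ∷ R ++ pairs) a b → Conn ((u , w) ∷ (u' , w') ∷ R ++ pairs) a b
  switch-conn {u} {u'} {w} {w'} R (uq , co) ≁ = conn-fold (conn-equiv _) λ
      { (here refl) → up uu' ; (there (here refl)) → ctrans (csym (edge (here refl))) (ctrans (up uu') (edge (there (here refl)))) ; (there (there m)) → edge (there (there m)) }
    where
    up : ∀ {p q a b} → Conn (R ++ pairs) a b → Conn (p ∷ q ∷ R ++ pairs) a b
    up = conn-wk ∘ conn-wk
    u∉ : u ∉ flat R
    u∉ = unique-∉ uq ∘ there ∘ there ∘ there
    open Spec (spec R (unique-tail (unique-tail (unique-tail (unique-tail uq)))))
    uu' : Conn (R ++ pairs) u u'
    uu' with co (ends R u)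
    ... | here e = contradiction e (nofix u∉)
    ... | there (here e) = subst (Conn _ u) e (path u∉)
    ... | there (there (here e)) = contradiction (up (subst (Conn _ u) e (path u∉))) ≁
    ... | there (there (there (here e))) =
          contradiction (ctrans (up (subst (Conn _ u) e (path u∉))) (csym (edge (there (here refl))))) ≁
    ... | there (there (there (there m))) = contradiction m (out u∉)

  -- The new list generates everything that the old one does and also joins the classes of `u` and
  -- `w`, which were different.
  switch-fewer : ∀ {u u' w w'} R → Perfect ((u , u') ∷ (w , w') ∷ R) → ¬ Conn ((u , u') ∷ (w , w') ∷ R ++ pairs) u w →
    suc A[ (u , w) ∷ (u' , w') ∷ R ] ≤ A[ (u , u') ∷ (w , w') ∷ R ]
  switch-fewer {u} {u'} {w} {w'} R pf ≁ = ≤-trans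
    (s≤s (cls-anti ((u , w) ∷ (u , u') ∷ (w , w') ∷ R ++ pairs) ((u , w) ∷ (u' , w') ∷ R ++ pairs)
      (conn-fold (conn-equiv _) λ { (here refl) → edge (here refl) ; (there m) → switch-conn R pf ≁ (edge m) })))
    (≤-reflexive (sym (cls-merge _ ≁)))

  A-pick : ∀ {u K} (p : Pick u K) D → A[ K ++ D ] ≡ A[ (u , Pick.mate p) ∷ Pick.rest p ++ D ]
  A-pick {u} {K} p D = cls-cong _ _
    (λ {a} {b} c → subst (λ z → Conn ((u , Pick.mate p) ∷ z) a b) (sym (Listₚ.++-assoc (Pick.rest p) D pairs))
      (Pick.conn p (subst (λ z → Conn z a b) (Listₚ.++-assoc K D pairs) c)))
    (λ {a} {b} c → subst (λ z → Conn z a b) (sym (Listₚ.++-assoc K D pairs))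
      (Pick.conn⁻ p (subst (λ z → Conn ((u , Pick.mate p) ∷ z) a b) (Listₚ.++-assoc (Pick.rest p) D pairs) c)))

  -- The hypothesis says that no path of `D` has both ends in `Q`. Hence no pair of `Q` closes a
  -- cycle when it is inserted, and each merges two classes.
  merge-all : ∀ Q D → Unique (flat (Q ++ D)) → (∀ {w} → w ∈ flat Q → ends D w ∉ flat Q) →
    A[ D ] ≡ length Q + A[ Q ++ D ]
  merge-all [] D uq n = refl
  merge-all ((u , v) ∷ Q) D uq n = trans (merge-all Q D (unique-tail (unique-tail uq)) (λ m k → n (there (there m)) (there (there k))))
    (trans (cong (length Q +_) (merge-ends (Q ++ D) uq
      λ e → n (here refl) (there (here (trans (sym (ends-avoid Q D (n (here refl) ∘ there ∘ there))) e)))))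
      (+-suc (length Q) _))

-- Removing the mixed pairs of a matching

-- The involution is required only on `xs`, since it is applied to ends of paths as well as to an
-- `FPI`. The bound `n` carries the recursion, because the mate of the head is taken out of the
-- middle of the list.
pair-up : ∀ {A : Set} (f : A → A) n xs → length xs ≤ n → Unique xs → (∀ {u} → u ∈ xs → f u ∈ xs) →
  (∀ {u} → u ∈ xs → f (f u) ≡ u) → (∀ {u} → u ∈ xs → f u ≢ u) →
  Σ (List (A × A)) λ L → flat L ↭ xs × AllP (λ a b → b ≡ f a) L
pair-up f n [] _ _ _ _ _ = [] , ↭-refl , []
pair-up f (suc n) (u ∷ xs) (s≤s le) uq cl iv nf with cl (here refl)
... | here e = contradiction e (nf (here refl))
... | there m with ∈-∃++ m
...   | ys , zs , refl = let L , fl , q = rec in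
        (u , f u) ∷ L , ↭-trans (prep u (prep (f u) fl)) (prep u (↭-sym p)) , refl ∷ q
  where
  p : ys ++ f u ∷ zs ↭ f u ∷ ys ++ zs
  p = shift (f u) ys zs
  uq' : Unique (u ∷ f u ∷ ys ++ zs)
  uq' = unique-↭ (prep u p) uq
  up : ∀ {w} → w ∈ ys ++ zs → w ∈ u ∷ ys ++ f u ∷ zs
  up k = there (∈-resp-↭ (↭-sym p) (there k))
  cl' : ∀ {w} → w ∈ ys ++ zs → f w ∈ ys ++ zs
  cl' {w} k with ∈-resp-↭ (prep u p) (cl (up k))
  ... | here e = contradiction (subst (_∈ ys ++ zs) (trans (sym (iv (up k))) (cong f e)) k) (unique-∉ (unique-tail uq'))
  ... | there (here e) = contradiction (there (subst (_∈ _) (trans (sym (iv (up k))) (trans (cong f e) (iv (here refl)))) k)) (unique-∉ uq')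
  ... | there (there j) = j
  rec = pair-up f n (ys ++ zs) (≤-trans (ℕₚ.n≤1+n _) (≤-trans (≤-reflexive (sym (↭-length p))) le))
    (unique-tail (unique-tail uq')) cl' (iv ∘ up) (nf ∘ up)

length-flat : ∀ {A : Set} (L : List (A × A)) → length (flat L) ≡ length L + length L
length-flat [] = refl
length-flat (p ∷ L) = cong suc (trans (cong suc (length-flat L)) (sym (+-suc _ _)))

unique-map : ∀ {A B : Set} (f : A → B) xs → (∀ {a b} → a ∈ xs → b ∈ xs → f a ≡ f b → a ≡ b) → Unique xs → Unique (map f xs)
unique-map f [] inj uq = []
unique-map f (x ∷ xs) inj uq = unique-∷
  (λ m → case ∈-map⁻ f m of λ { (b , k , e) → unique-∉ uq (subst (_∈ xs) (sym (inj (here refl) (there k) e)) k) })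
  (unique-map f xs (λ a b → inj (there a) (there b)) (unique-tail uq))

-- The two counts make sense for any list of pairs: for a partial matching they count paths along
-- with cycles, and the intermediate stages rely on this.
module Counts {Φ : Set} {N : ℕ} (fΦ : Finite Φ N) (α β : FPI Φ) where
  module Eα = Ends fΦ α
  module Eβ = Ends fΦ β
  open Classes fΦ public
  open Eα public using (Perfect; perfect-↭) renaming (A[_] to αc)
  open Eβ public using () renaming (A[_] to βc)

  -- The difference αc - βc drops by at most k from L to L'.
  Drop≤ : ℕ → List (Φ × Φ) → List (Φ × Φ) → Set
  Drop≤ k L L' = αc L + βc L' ≤ αc L' + βc L + k

  drop-trans : ∀ {k l L L' L''} → Drop≤ k L L' → Drop≤ l L' L'' → Drop≤ (k + l) L L''
  drop-trans {k} {l} {L} {L'} {L''} p q = ℕₚ.+-cancelʳ-≤ (αc L' + βc L') _ _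
    (subst₂ _≤_ (solve 4 (λ a b a' b'' → (a :+ b) :+ (a' :+ b'') := (a :+ b'') :+ (a' :+ b)) refl (αc L) (βc L') (αc L') (βc L''))
      (solve 6 (λ a' b k a'' b' l → (a' :+ b :+ k) :+ (a'' :+ b' :+ l) := (a'' :+ b :+ (k :+ l)) :+ (a' :+ b')) refl
        (αc L') (βc L) k (αc L'') (βc L') l)
      (ℕₚ.+-mono-≤ p q))
    where open +-*-Solver

  drop-≡ : ∀ {k L L' M M'} → αc L ≡ αc M → βc L ≡ βc M → αc L' ≡ αc M' → βc L' ≡ βc M' → Drop≤ k L L' → Drop≤ k M M'
  drop-≡ {k} e f e' f' p = subst₂ _≤_ (cong₂ _+_ e f') (cong₂ (λ a b → a + b + k) e' f) p

module Unmixing {Φ : Set} {N : ℕ} (fΦ : Finite Φ N) (α β : FPI Φ) {V : Set} (_≟V_ : DecidableEquality V)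
  (tail : Φ → V) (side : Φ → Bool) where
  open Counts fΦ α β

  Pure : Φ → Φ → Set
  Pure u v = side u ≡ side v × tail u ≡ tail v

  module Main (α-side : ∀ a → side (FPI.fun α a) ≡ side a)
    (β-pure : ∀ a → Pure (FPI.fun β a) a) (x y : V) (x≢y : x ≢ y) where

    Mixed : Φ → Φ → Set
    Mixed u v = side u ≢ side v × tail u ≡ tail v × (tail u ≡ x ⊎ tail u ≡ y)

    sides : ∀ {D} → AllP Pure D → ∀ w → side (Eα.ends D w) ≡ side w
    sides {D} pD = Eα.ends-label side α-side D (All.map proj₁ pD)

    tails : ∀ {D} → AllP (λ u v → tail u ≡ tail v) D → ∀ w → tail (Eβ.ends D w) ≡ tail w
    tails {D} = Eβ.ends-label tail (proj₂ ∘ β-pure) D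

    βsides : ∀ {D} → AllP Pure D → ∀ w → side (Eβ.ends D w) ≡ side w
    βsides {D} pD = Eβ.ends-label side (proj₁ ∘ β-pure) D (All.map proj₁ pD)

    -- Here `xs` will have `suc h + suc h` members. Each of the first `h` rounds uses two of them
    -- and loses one class of `α` against two of `β`; the last round loses one class of `α` against
    -- possibly none of `β`. The balance `1 - h` is the `2 - suc h` of the inequality.
    Greedy : ℕ → List (Φ × Φ) → List Φ → Set
    Greedy h D xs = Σ (List (Φ × Φ)) λ L → flat L ↭ xs ++ map (Eα.ends D) xs × AllP Pure L ×
      αc D + βc (L ++ D) + suc h ≤ αc (L ++ D) + βc D + 2

    -- Each of the two conditions excludes at most one candidate, so one of three survives. In the
    -- last round of the greedy choice a single candidate is left and nothing can be guaranteed,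
    -- which is why that round is counted separately.
    choose : ∀ (f : Φ → Φ) (p q : Φ) r1 r2 r3 tl → Unique (r1 ∷ r2 ∷ r3 ∷ tl) →
      (∀ {a b} → a ∈ r1 ∷ r2 ∷ r3 ∷ tl → b ∈ r1 ∷ r2 ∷ r3 ∷ tl → f a ≡ f b → a ≡ b) →
      Σ Φ λ r → Σ (List Φ) λ rest → r1 ∷ r2 ∷ r3 ∷ tl ↭ r ∷ rest × p ≢ r × q ≢ f r
    choose f p q r1 r2 r3 tl uq inj with fin-≟ fΦ p r1 | fin-≟ fΦ q (f r1) | fin-≟ fΦ p r2 | fin-≟ fΦ q (f r2)
    ... | no n | no n' | _ | _ = r1 , r2 ∷ r3 ∷ tl , ↭-refl , n , n'
    ... | _ | _ | no n | no n' = r2 , r1 ∷ r3 ∷ tl , swap r1 r2 ↭-refl , n , n'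
    ... | yes e | _ | yes e' | _ = contradiction (here (trans (sym e) e')) (unique-∉ uq)
    ... | _ | yes e | _ | yes e' = contradiction (here (inj (here refl) (there (here refl)) (trans (sym e) e'))) (unique-∉ uq)
    ... | yes e | no _ | no _ | yes e' = r3 , r1 ∷ r2 ∷ tl , ↭-trans (prep r1 (swap r2 r3 ↭-refl)) (swap r1 r3 ↭-refl) ,
      (λ k → unique-∉ uq (there (here (trans (sym e) k)))) ,
      (λ k → unique-∉ (unique-tail uq) (here (inj (there (here refl)) (there (there (here refl))) (trans (sym e') k))))
    ... | no _ | yes e | yes e' | no _ = r3 , r1 ∷ r2 ∷ tl , ↭-trans (prep r1 (swap r2 r3 ↭-refl)) (swap r1 r3 ↭-refl) ,
      (λ k → unique-∉ (unique-tail uq) (here (trans (sym e') k))) ,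
      (λ k → unique-∉ uq (there (here (inj (here refl) (there (there (here refl))) (trans (sym e) k)))))

    -- Joining two x-y paths at x leaves a y-y path, which is then closed at y.
    greedy : ∀ h D xs s → length xs ≡ suc h + suc h → AllP Pure D → Unique (flat D) → Unique xs →
      (∀ {u} → u ∈ xs → u ∉ flat D) → (∀ {u} → u ∈ xs → side u ≡ s × tail u ≡ x × tail (Eα.ends D u) ≡ y) → Greedy h D xs
    greedy-step : ∀ h D s x0 r rest → length rest ≡ suc h + suc h → AllP Pure D → Unique (flat D) → Unique (x0 ∷ r ∷ rest) →
      (∀ {u} → u ∈ x0 ∷ r ∷ rest → u ∉ flat D) →
      (∀ {u} → u ∈ x0 ∷ r ∷ rest → side u ≡ s × tail u ≡ x × tail (Eα.ends D u) ≡ y) →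
      Eβ.ends D x0 ≢ r → Eβ.ends D (Eα.ends D x0) ≢ Eα.ends D r → Greedy (suc h) D (x0 ∷ r ∷ rest)

    module Joined (D : List (Φ × Φ)) (s : Bool) (x0 x1 : Φ) (rest : List Φ) (pD : AllP Pure D) (uD : Unique (flat D))
      (uq : Unique (x0 ∷ x1 ∷ rest)) (out : ∀ {u} → u ∈ x0 ∷ x1 ∷ rest → u ∉ flat D)
      (lab : ∀ {u} → u ∈ x0 ∷ x1 ∷ rest → side u ≡ s × tail u ≡ x × tail (Eα.ends D u) ≡ y) where
      M = Eα.ends D
      open Eα.Spec (Eα.spec D uD) using (invo; path) renaming (out to M-out) public
      y0 = M x0
      y1 = M x1
      x0∈ : x0 ∈ x0 ∷ x1 ∷ rest
      x0∈ = here refl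
      x1∈ : x1 ∈ x0 ∷ x1 ∷ rest
      x1∈ = there (here refl)
      xy : ∀ {u w} → u ∈ x0 ∷ x1 ∷ rest → w ∈ x0 ∷ x1 ∷ rest → M u ≢ w
      xy u w e = x≢y (trans (sym (proj₁ (proj₂ (lab w)))) (trans (cong tail (sym e)) (proj₂ (proj₂ (lab u)))))
      M-inj : ∀ {u w} → u ∈ x0 ∷ x1 ∷ rest → w ∈ x0 ∷ x1 ∷ rest → M u ≡ M w → u ≡ w
      M-inj u w e = trans (sym (invo (out u))) (trans (cong M e) (invo (out w)))
      D' = (y0 , y1) ∷ (x0 , x1) ∷ D
      uD1 : Unique (flat ((x0 , x1) ∷ D))
      uD1 = unique-∷ (λ { (here e) → unique-∉ uq (here e) ; (there m) → out x0∈ m }) (unique-∷ (out x1∈) uD)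
      uD' : Unique (flat D')
      uD' = unique-∷ (λ { (here e) → unique-∉ uq (here (M-inj x0∈ x1∈ e)) ; (there (here e)) → xy x0∈ x0∈ e
                        ; (there (there (here e))) → xy x0∈ x1∈ e ; (there (there (there m))) → M-out (out x0∈) m })
        (unique-∷ (λ { (here e) → xy x1∈ x0∈ e ; (there (here e)) → xy x1∈ x1∈ e ; (there (there m)) → M-out (out x1∈) m }) uD1)
      pD' : AllP Pure D'
      pD' = (trans (sides pD x0) (trans (proj₁ (lab x0∈)) (sym (trans (sides pD x1) (proj₁ (lab x1∈))))) ,
             trans (proj₂ (proj₂ (lab x0∈))) (sym (proj₂ (proj₂ (lab x1∈))))) ∷
            (trans (proj₁ (lab x0∈)) (sym (proj₁ (lab x1∈))) ,
             trans (proj₁ (proj₂ (lab x0∈))) (sym (proj₁ (proj₂ (lab x1∈))))) ∷ pD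
      α-count : αc D ≡ suc (αc D')
      α-count = trans (Eα.merge-ends D uD1 (xy x0∈ x1∈)) (cong suc (sym (cls-close ((x0 , x1) ∷ D ++ Eα.pairs)
        (ctrans (csym (conn-wk (path (out x0∈)))) (ctrans (edge (here refl)) (conn-wk (path (out x1∈))))))))

    greedy-step h D s x0 r rest len pD uD uq out lab n n' =
      let L , fl , pL , ineq = rec in
      L ++ (J.y0 , J.y1) ∷ (x0 , r) ∷ [] ,
      ↭-trans (↭-reflexive (flat-++ L _)) (↭-trans (↭-++ʳ _ (subst (λ z → flat L ↭ rest ++ z) mapM fl)) perm) ,
      All-++ pL (All.head J.pD' ∷ All.head (All.tail J.pD') ∷ []) ,
      subst (λ z → αc D + βc z + suc (suc h) ≤ αc z + βc D + 2) (sym (Listₚ.++-assoc L _ D))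
        (subst₂ _≤_
          (trans (solve 3 (λ a b h → con 2 :+ (a :+ b :+ (con 1 :+ h)) := (con 1 :+ a) :+ b :+ (con 2 :+ h)) refl (αc J.D') (βc (L ++ J.D')) h)
            (cong (λ z → z + βc (L ++ J.D') + suc (suc h)) (sym J.α-count)))
          (trans (solve 2 (λ a b → con 2 :+ (a :+ b :+ con 2) := a :+ (con 2 :+ b) :+ con 2) refl (αc (L ++ J.D')) (βc J.D'))
            (cong (λ z → αc (L ++ J.D') + z + 2) (sym β-count)))
          (s≤s (s≤s ineq)))
      where
      open +-*-Solver
      module J = Joined D s x0 r rest pD uD uq out lab
      Tl = All.map proj₂ pD
      S = Eβ.ends D
      -- Both pairs are chosen to join different paths of `β`. The pair at x cannot spoil the one at
      -- y, because these paths stay at one vertex and x differs from y.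
      β-count : βc D ≡ suc (suc (βc J.D'))
      β-count = trans (Eβ.merge-ends D J.uD1 n) (cong suc (Eβ.merge-ends ((x0 , r) ∷ D) J.uD'
        (λ e → n' (trans (sym (Eβ.splice-o S (off J.x0∈) (off J.x1∈))) e))))
        where
        off : ∀ {w} → w ∈ x0 ∷ r ∷ rest → S J.y0 ≢ w
        off w e = x≢y (trans (sym (proj₁ (proj₂ (lab w)))) (trans (cong tail (sym e)) (trans (tails Tl J.y0) (proj₂ (proj₂ (lab J.x0∈))))))
      M'≡ : ∀ {u} → u ∈ rest → Eα.ends J.D' u ≡ J.M u
      M'≡ {u} m = trans (Eα.splice-o (Eα.ends ((x0 , r) ∷ D))
          (λ e → unique-∉ uq (there (subst (_∈ rest) (J.M-inj um J.x0∈ (trans (sym step) e)) m)))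
          (λ e → unique-∉ (unique-tail uq) (subst (_∈ rest) (J.M-inj um J.x1∈ (trans (sym step) e)) m))) step
        where
        um = there (there m)
        step = Eα.splice-o J.M (J.xy um J.x0∈) (J.xy um J.x1∈)
      mapM : map (Eα.ends J.D') rest ≡ map J.M rest
      mapM = Listₚ.map-cong-local (All.tabulate M'≡)
      rec : Greedy h J.D' rest
      rec = greedy h J.D' rest s len J.pD' J.uD' (unique-tail (unique-tail uq))
        (λ {u} m → λ { (here e) → J.xy J.x0∈ (there (there m)) (sym e)
            ; (there (here e)) → J.xy J.x1∈ (there (there m)) (sym e)
            ; (there (there (here e))) → unique-∉ uq (there (subst (_∈ rest) e m))
            ; (there (there (there (here e)))) → unique-∉ (unique-tail uq) (subst (_∈ rest) e m)
            ; (there (there (there (there k)))) → out (there (there m)) k })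
        (λ m → let a , b , c = lab (there (there m)) in a , b , trans (cong tail (M'≡ m)) c)
      perm : (rest ++ map J.M rest) ++ J.y0 ∷ J.y1 ∷ x0 ∷ r ∷ [] ↭ (x0 ∷ r ∷ rest) ++ J.y0 ∷ J.y1 ∷ map J.M rest
      perm = ↭-trans (↭-++-comm (rest ++ map J.M rest) _)
        (↭-trans (shifts (J.y0 ∷ J.y1 ∷ []) (x0 ∷ r ∷ [])) (prep x0 (prep r (shifts (J.y0 ∷ J.y1 ∷ []) rest))))

    greedy h D [] s () pD uD uq out lab
    greedy zero D (x0 ∷ x1 ∷ []) s len pD uD uq out lab = (y0 , y1) ∷ (x0 , x1) ∷ [] ,
      shifts (y0 ∷ y1 ∷ []) (x0 ∷ x1 ∷ []) , All.head pD' ∷ All.head (All.tail pD') ∷ [] ,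
      subst₂ _≤_ (trans (solve 2 (λ a b → con 1 :+ a :+ b :+ con 1 := con 1 :+ a :+ b :+ con 1) refl (αc D') (βc D')) (cong (λ z → z + βc D' + 1) (sym α-count)))
        (solve 2 (λ a b → con 1 :+ a :+ b :+ con 1 := a :+ b :+ con 2) refl (αc D') (βc D))
        (ℕₚ.+-monoˡ-≤ 1 (ℕₚ.+-monoʳ-≤ (suc (αc D')) (Eβ.A-drop ((y0 , y1) ∷ (x0 , x1) ∷ []) D)))
      where
      open +-*-Solver
      open Joined D s x0 x1 [] pD uD uq out lab
    greedy zero D (x0 ∷ []) s ()
    greedy zero D (x0 ∷ x1 ∷ x2 ∷ xs) s ()
    greedy (suc h) D (x0 ∷ []) s ()
    greedy (suc h) D (x0 ∷ x1 ∷ []) s len = contradiction (trans len (cong suc (+-suc (suc h) (suc h)))) (λ ())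
    greedy (suc h) D (x0 ∷ x1 ∷ x2 ∷ []) s len = contradiction (trans len (cong suc (trans (+-suc (suc h) (suc h)) (cong (suc ∘ suc) (+-suc h h))))) (λ ())
    greedy (suc h) D (x0 ∷ r1 ∷ r2 ∷ r3 ∷ tl) s len pD uD uq out lab
      with choose (Eα.ends D) (Eβ.ends D x0) (Eβ.ends D (Eα.ends D x0)) r1 r2 r3 tl (unique-tail uq)
             (λ a b → Joined.M-inj D s x0 r1 (r2 ∷ r3 ∷ tl) pD uD uq out lab (there a) (there b))
    ... | r , rest , p , n , n' =
      let L , fl , pL , ineq = greedy-step h D s x0 r rest len' pD uD (unique-↭ p' uq) (out ∘ ∈-resp-↭ (↭-sym p')) (lab ∘ ∈-resp-↭ (↭-sym p')) n n'
      in L , ↭-trans fl (↭-++ (↭-sym p') (map⁺ (Eα.ends D) (↭-sym p'))) , pL , ineq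
      where
      open import Data.List.Relation.Binary.Permutation.Propositional.Properties using (map⁺)
      p' : x0 ∷ r1 ∷ r2 ∷ r3 ∷ tl ↭ x0 ∷ r ∷ rest
      p' = prep x0 p
      len' : length rest ≡ suc h + suc h
      len' = ℕₚ.suc-injective (trans (sym (↭-length p)) (trans (ℕₚ.suc-injective len) (+-suc (suc h) (suc h))))

    bool-third : ∀ {a b s : Bool} → a ≢ b → a ≢ s → b ≡ s
    bool-third {true} {true} n _ = contradiction refl n
    bool-third {true} {false} {true} _ n = contradiction refl n
    bool-third {true} {false} {false} _ _ = refl
    bool-third {false} {false} n _ = contradiction refl n
    bool-third {false} {true} {true} _ _ = refl
    bool-third {false} {true} {false} _ n = contradiction refl n

    onSide : Bool → Φ × Φ → Φ
    onSide s (a , b) with side a Boolₚ.≟ s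
    ... | yes _ = a
    ... | no _  = b

    onSide-side : ∀ s {a b} → side a ≢ side b → side (onSide s (a , b)) ≡ s
    onSide-side s {a} {b} n with side a Boolₚ.≟ s
    ... | yes e = e
    ... | no n' = bool-third n n'

    onSide-∈ : ∀ s a b → onSide s (a , b) ≡ a ⊎ onSide s (a , b) ≡ b
    onSide-∈ s a b with side a Boolₚ.≟ s
    ... | yes _ = inj₁ refl
    ... | no _  = inj₂ refl

    onSide-l : ∀ {a b} → onSide (side a) (a , b) ≡ a
    onSide-l {a} {b} with side a Boolₚ.≟ side a
    ... | yes _ = refl
    ... | no n = contradiction refl n

    onSide-r : ∀ {a b} → side a ≢ side b → onSide (side b) (a , b) ≡ b
    onSide-r {a} {b} n with side a Boolₚ.≟ side b
    ... | yes e = contradiction e n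
    ... | no _ = refl

    onSide⊆ : ∀ s Q {u} → u ∈ map (onSide s) Q → u ∈ flat Q
    onSide⊆ s ((a , b) ∷ Q) (here e) with onSide-∈ s a b
    ... | inj₁ q = here (trans e q)
    ... | inj₂ q = there (here (trans e q))
    onSide⊆ s ((a , b) ∷ Q) (there m) = there (there (onSide⊆ s Q m))

    onSide⊇ : ∀ Q → AllP (λ a b → side a ≢ side b) Q → ∀ {u} → u ∈ flat Q → u ∈ map (onSide (side u)) Q
    onSide⊇ ((a , b) ∷ Q) (n ∷ ns) (here refl) = here (sym onSide-l)
    onSide⊇ ((a , b) ∷ Q) (n ∷ ns) (there (here refl)) = here (sym (onSide-r n))
    onSide⊇ ((a , b) ∷ Q) (n ∷ ns) (there (there m)) = there (onSide⊇ Q ns m)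

    onSide-unique : ∀ s Q → Unique (flat Q) → Unique (map (onSide s) Q)
    onSide-unique s [] uq = []
    onSide-unique s ((a , b) ∷ Q) uq = unique-∷ (λ m → case onSide-∈ s a b of λ
      { (inj₁ e) → unique-∉ uq (there (subst (_∈ _) e (onSide⊆ s Q m)))
      ; (inj₂ e) → unique-∉ (unique-tail uq) (subst (_∈ _) e (onSide⊆ s Q m)) })
      (onSide-unique s Q (unique-tail (unique-tail uq)))

    onSide-sides : ∀ s Q → AllP (λ a b → side a ≢ side b) Q → ∀ {u} → u ∈ map (onSide s) Q → side u ≡ s
    onSide-sides s (p ∷ Q) (n ∷ ns) (here refl) = onSide-side s n
    onSide-sides s (p ∷ Q) (n ∷ ns) (there m) = onSide-sides s Q ns m

    MixedAt : V → Φ → Φ → Set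
    MixedAt z u v = side u ≢ side v × tail u ≡ z × tail v ≡ z

    at-tail : ∀ {z} Q → AllP (MixedAt z) Q → ∀ {u} → u ∈ flat Q → tail u ≡ z
    at-tail (p ∷ Q) ((_ , e , _) ∷ qs) (here refl) = e
    at-tail (p ∷ Q) ((_ , _ , e) ∷ qs) (there (here refl)) = e
    at-tail (p ∷ Q) (_ ∷ qs) (there (there m)) = at-tail Q qs m

    split : ∀ K → AllP Mixed K → Σ (List (Φ × Φ)) λ KX → Σ (List (Φ × Φ)) λ KY →
      K ↭ KX ++ KY × AllP (MixedAt x) KX × AllP (MixedAt y) KY
    split [] [] = [] , [] , ↭-refl , [] , []
    split (p ∷ K) ((n , e , inj₁ ex) ∷ qs) with split K qs
    ... | KX , KY , r , mx , my = p ∷ KX , KY , prep p r , (n , ex , trans (sym e) ex) ∷ mx , my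
    split (p ∷ K) ((n , e , inj₂ ey) ∷ qs) with split K qs
    ... | KX , KY , r , mx , my = KX , p ∷ KY , ↭-trans (prep p r) (↭-sym (shift p KX KY)) , mx , (n , ey , trans (sym e) ey) ∷ my

    module Base (D K KX KY : List (Φ × Φ)) (pf : Perfect (K ++ D)) (pD : AllP Pure D) (K↭ : K ↭ KX ++ KY)
      (mx : AllP (MixedAt x) KX) (my : AllP (MixedAt y) KY)
      (crossing : ∀ {u} → u ∈ flat K → tail (Eα.ends D u) ≢ tail u) where
      M = Eα.ends D
      flatKD : flat (K ++ D) ↭ (flat KX ++ flat KY) ++ flat D
      flatKD = ↭-trans (↭-reflexive (flat-++ K D)) (↭-++ʳ (flat D) (↭-trans (flat-↭ K↭) (↭-reflexive (flat-++ KX KY))))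
      uqAll : Unique ((flat KX ++ flat KY) ++ flat D)
      uqAll = unique-↭ flatKD (proj₁ pf)
      coAll : ∀ u → u ∈ (flat KX ++ flat KY) ++ flat D
      coAll u = ∈-resp-↭ flatKD (proj₂ pf u)
      uD : Unique (flat D)
      uD = unique-++ʳ (flat KX ++ flat KY) uqAll
      uqK : Unique (flat KX ++ flat KY)
      uqK = unique-++ˡ (flat KX ++ flat KY) uqAll
      open Eα.Spec (Eα.spec D uD) using (out; invo) public
      offX : ∀ {u} → u ∈ flat KX → u ∉ flat D
      offX m = unique-disjoint _ uqAll (∈-++⁺ˡ m)
      offY : ∀ {u} → u ∈ flat KY → u ∉ flat D
      offY m = unique-disjoint _ uqAll (∈-++⁺ʳ (flat KX) m)
      locate : ∀ {u} → u ∉ flat D → (u ∈ flat KX) ⊎ (u ∈ flat KY)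
      locate {u} n with ∈-++⁻ (flat KX ++ flat KY) (coAll u)
      ... | inj₁ m = ∈-++⁻ (flat KX) m
      ... | inj₂ m = contradiction m n
      K∋ : ∀ {u} → (u ∈ flat KX) ⊎ (u ∈ flat KY) → u ∈ flat K
      K∋ m = ∈-resp-↭ (↭-sym (↭-trans (flat-↭ K↭) (↭-reflexive (flat-++ KX KY)))) ([ ∈-++⁺ˡ , ∈-++⁺ʳ (flat KX) ]′ m)
      X→Y : ∀ {u} → u ∈ flat KX → M u ∈ flat KY
      X→Y {u} m with locate (out (offX m))
      ... | inj₁ k = contradiction (trans (at-tail KX mx k) (sym (at-tail KX mx m))) (crossing (K∋ (inj₁ m)))
      ... | inj₂ k = k
      Y→X : ∀ {u} → u ∈ flat KY → M u ∈ flat KX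
      Y→X {u} m with locate (out (offY m))
      ... | inj₁ k = k
      ... | inj₂ k = contradiction (trans (at-tail KY my k) (sym (at-tail KY my m))) (crossing (K∋ (inj₂ m)))
      X∩Y : ∀ {u} → u ∈ flat KX → u ∉ flat KY
      X∩Y m k = x≢y (trans (sym (at-tail KX mx m)) (at-tail KY my k))

      -- Every path of `D` between mixed flags has one end at x and one at y. So no path has two
      -- ends in `KY`, and each pair of `KY` merges two classes; adding `KX` can only merge more.
      α-bound : αc (K ++ D) + length KY ≤ αc D
      α-bound = subst (αc (K ++ D) + length KY ≤_) (trans (+-comm _ (length KY)) (sym (Eα.merge-all KY D uqY (λ m k → X∩Y (Y→X m) k))))
        (ℕₚ.+-monoˡ-≤ (length KY) (≤-trans (≤-reflexive (Eα.A-↭ (↭-trans (↭-++ʳ D K↭) (↭-reflexive (Listₚ.++-assoc KX KY D)))))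
          (Eα.A-drop KX (KY ++ D))))
        where
        uqY : Unique (flat (KY ++ D))
        uqY = subst Unique (sym (flat-++ KY D)) (unique-++ʳ (flat KX) (unique-↭ (↭-reflexive (Listₚ.++-assoc (flat KX) (flat KY) (flat D))) uqAll))

    -- Each inserted pair costs at most one class, and the last pair at each terminal costs none:
    -- once all the others are present, the path of `β` from its first flag stays at that terminal,
    -- where only its second flag is still free. These two free insertions are the 2.
    β-bound : ∀ D u v KX w z KY → Perfect ((u , v) ∷ (w , z) ∷ KX ++ KY ++ D) →
      AllP (MixedAt x) ((u , v) ∷ KX) → AllP (MixedAt y) ((w , z) ∷ KY) → AllP Pure D →
      βc D + 2 ≤ βc ((u , v) ∷ (w , z) ∷ KX ++ KY ++ D) + (length ((u , v) ∷ KX) + length ((w , z) ∷ KY))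
    β-bound D u v KX w z KY (uq , co) ((_ , ux , vx) ∷ mx) ((_ , wy , zy) ∷ my) pD = subst₂ _≤_
        (solve 1 (λ a → con 2 :+ a := a :+ con 2) refl (βc D))
        (trans (solve 3 (λ a b c → con 2 :+ ((a :+ b) :+ c) := c :+ ((con 1 :+ a) :+ (con 1 :+ b))) refl (length KX) (length KY) (βc D0))
          (cong (_+ (suc (length KX) + suc (length KY))) (sym closing)))
        (s≤s (s≤s (subst₂ (λ q r → βc D ≤ q + βc r) (Listₚ.length-++ KX) (Listₚ.++-assoc KX KY D) (Eβ.A-lip (KX ++ KY) D))))
      where
      open +-*-Solver
      D0 = KX ++ KY ++ D
      uq0 : Unique (flat D0)
      uq0 = unique-tail (unique-tail (unique-tail (unique-tail uq)))
      T0 : AllP (λ a b → tail a ≡ tail b) D0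
      T0 = All-++ (All.map (λ (_ , a , b) → trans a (sym b)) mx) (All-++ (All.map (λ (_ , a , b) → trans a (sym b)) my) (All.map proj₂ pD))
      open Eβ.Spec (Eβ.spec D0 uq0)
      u∉ : u ∉ flat D0
      u∉ = unique-∉ uq ∘ there ∘ there ∘ there
      w∉ : w ∉ flat D0
      w∉ = unique-∉ (unique-tail (unique-tail uq)) ∘ there
      uv : Conn (D0 ++ Eβ.pairs) u v
      uv with co (Eβ.ends D0 u)
      ... | here e = contradiction e (nofix u∉)
      ... | there (here e) = subst (Conn _ u) e (path u∉)
      ... | there (there (here e)) = contradiction (trans (sym ux) (trans (sym (tails T0 u)) (trans (cong tail e) wy))) x≢y
      ... | there (there (there (here e))) = contradiction (trans (sym ux) (trans (sym (tails T0 u)) (trans (cong tail e) zy))) x≢y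
      ... | there (there (there (there m))) = contradiction m (out u∉)
      wz : Conn (D0 ++ Eβ.pairs) w z
      wz with co (Eβ.ends D0 w)
      ... | there (there (here e)) = contradiction e (nofix w∉)
      ... | there (there (there (here e))) = subst (Conn _ w) e (path w∉)
      ... | here e = contradiction (trans (sym (trans (cong tail (sym e)) (trans (tails T0 w) wy))) ux) (≢-sym x≢y)
      ... | there (here e) = contradiction (trans (sym (trans (cong tail (sym e)) (trans (tails T0 w) wy))) vx) (≢-sym x≢y)
      ... | there (there (there (there m))) = contradiction m (out w∉)
      closing : βc ((u , v) ∷ (w , z) ∷ D0) ≡ βc D0
      closing = trans (cls-close ((w , z) ∷ D0 ++ Eβ.pairs) (conn-wk uv)) (cls-close (D0 ++ Eβ.pairs) wz)

    record Unmixed (L₀ : List (Φ × Φ)) : Set where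
      field
        list : List (Φ × Φ)
        perfect : Perfect list
        pure : AllP Pure list
        drop : Drop≤ 2 L₀ list

    base : ∀ D K → Perfect (K ++ D) → AllP Mixed K → AllP Pure D →
      (∀ {u} → u ∈ flat K → tail (Eα.ends D u) ≢ tail u) → Unmixed (K ++ D)
    base D K pf mK pD crossing with split K mK
    ... | [] , [] , K↭ , mx , my = record { list = K ++ D ; perfect = pf ; pure = All-++ (All-resp-↭ (↭-sym K↭) []) pD ; drop = ℕₚ.m≤m+n _ 2 }
    ... | (u , v) ∷ KX , [] , K↭ , mx , my = contradiction (Base.X→Y D K _ _ pf pD K↭ mx my crossing (here refl)) (λ ())
    ... | [] , (w , z) ∷ KY , K↭ , mx , my = contradiction (Base.Y→X D K _ _ pf pD K↭ mx my crossing (here refl)) (λ ())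
    ... | (u , v) ∷ KX' , (w , z) ∷ KY' , K↭ , mx , my = record { list = LF ++ LT ++ D ; perfect = pfL ; pure = All-++ pLF (All-++ pLT pD) ; drop = ineq }
      where
      KX = (u , v) ∷ KX'
      KY = (w , z) ∷ KY'
      open Base D K KX KY pf pD K↭ mx my crossing
      neX = All.map (proj₁) mx
      xs : Bool → List Φ
      xs s = map (onSide s) KX
      xs-D : ∀ s {u} → u ∈ xs s → u ∉ flat D
      xs-D s m = offX (onSide⊆ s KX m)
      xs-side : ∀ s {u} → u ∈ xs s → side u ≡ s
      xs-side s = onSide-sides s KX neX
      lab : ∀ s {u} → u ∈ xs s → side u ≡ s × tail u ≡ x × tail (M u) ≡ y
      lab s m = xs-side s m , at-tail KX mx (onSide⊆ s KX m) , at-tail KY my (X→Y (onSide⊆ s KX m))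
      xs-unique : ∀ s → Unique (xs s)
      xs-unique s = onSide-unique s KX (unique-++ˡ (flat KX) uqK)
      len : ∀ s → length (xs s) ≡ length KX
      len s = Listₚ.length-map (onSide s) KX
      module Sβ = Eβ.Spec (Eβ.spec D uD)
      S-closed : ∀ s {u} → u ∈ xs s → Eβ.ends D u ∈ xs s
      S-closed s {u} m with locate (Sβ.out (xs-D s m))
      ... | inj₁ k = subst (λ b → Eβ.ends D u ∈ xs b) (trans (βsides pD u) (xs-side s m)) (onSide⊇ KX neX k)
      ... | inj₂ k = contradiction (trans (sym (at-tail KX mx (onSide⊆ s KX m))) (trans (sym (tails (All.map proj₂ pD) u)) (at-tail KY my k))) x≢y
      -- Paths of `β` through pure pairs keep vertex and side, so they match the mixed flags at x on
      -- one side among themselves.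
      even : ∃ λ h → length KX ≡ h + h
      even = let L , fl , _ = pair-up (Eβ.ends D) _ (xs true) ≤-refl (xs-unique true) (S-closed true) (Sβ.invo ∘ xs-D true) (Sβ.nofix ∘ xs-D true)
             in length L , trans (sym (len true)) (trans (sym (↭-length fl)) (length-flat L))
      half : ∃ λ h → length KX ≡ suc h + suc h
      half with even
      ... | zero , ()
      ... | suc h , e = h , e
      h = proj₁ half
      GT : Greedy h D (xs true)
      GT = greedy h D (xs true) true (trans (len true) (proj₂ half)) pD uD (xs-unique true) (xs-D true) (lab true)
      LT = proj₁ GT
      pLT = proj₁ (proj₂ (proj₂ GT))
      ys : Bool → List Φ
      ys s = map M (xs s)
      ys-side : ∀ s {u} → u ∈ ys s → side u ≡ s
      ys-side s m = case ∈-map⁻ M m of λ { (a , k , e) → trans (cong side e) (trans (sides pD a) (xs-side s k)) }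
      ys-Y : ∀ s {u} → u ∈ ys s → u ∈ flat KY
      ys-Y s m = case ∈-map⁻ M m of λ { (a , k , e) → subst (_∈ flat KY) (sym e) (X→Y (onSide⊆ s KX k)) }
      zs : Bool → List Φ
      zs s = xs s ++ ys s
      zs-side : ∀ s {u} → u ∈ zs s → side u ≡ s
      zs-side s m = [ xs-side s , ys-side s ]′ (∈-++⁻ (xs s) m)
      zs-D : ∀ s {u} → u ∈ zs s → u ∉ flat D
      zs-D s m = [ xs-D s , (λ k → offY (ys-Y s k)) ]′ (∈-++⁻ (xs s) m)
      zs-unique : ∀ s → Unique (zs s)
      zs-unique s = Unique-++ (xs-unique s) (unique-map M (xs s)
        (λ a b e → trans (sym (invo (xs-D s a))) (trans (cong M e) (invo (xs-D s b)))) (xs-unique s))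
        (λ (a , b) → X∩Y (onSide⊆ s KX a) (ys-Y s b))
      zs-complete : ∀ {u} → u ∉ flat D → u ∈ zs (side u)
      zs-complete {u} n with locate n
      ... | inj₁ k = ∈-++⁺ˡ (onSide⊇ KX neX k)
      ... | inj₂ k = ∈-++⁺ʳ (xs (side u)) (subst (_∈ ys (side u)) (invo n)
              (∈-map⁺ M (subst (λ b → M u ∈ xs b) (sides pD u) (onSide⊇ KX neX (Y→X k)))))
      flT : flat LT ↭ zs true
      flT = proj₁ (proj₂ GT)
      -- Paths of `α` never change side, so rematching side `true` leaves the ends on side `false`
      -- as they were.
      M'≡ : ∀ {u} → u ∈ xs false → Eα.ends (LT ++ D) u ≡ M u
      M'≡ {u} m = Eα.ends-avoid LT D λ k → contradiction (trans (sym (zs-side true (∈-resp-↭ flT k))) (trans (sides pD u) (xs-side false m))) (λ ())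
      uLTD : Unique (flat LT ++ flat D)
      uLTD = Unique-++ (unique-↭ (↭-sym flT) (zs-unique true)) uD (λ (a , b) → zs-D true (∈-resp-↭ flT a) b)
      GF : Greedy h (LT ++ D) (xs false)
      GF = greedy h (LT ++ D) (xs false) false (trans (len false) (proj₂ half)) (All-++ pLT pD) (subst Unique (sym (flat-++ LT D)) uLTD) (xs-unique false)
        (λ m k → case ∈-++⁻ (flat LT) (subst (_ ∈_) (flat-++ LT D) k) of λ
          { (inj₁ j) → contradiction (trans (sym (zs-side true (∈-resp-↭ flT j))) (xs-side false m)) (λ ())
          ; (inj₂ j) → xs-D false m j })
        (λ m → let a , b , c = lab false m in a , b , trans (cong tail (M'≡ m)) c)
      LF = proj₁ GF
      pLF = proj₁ (proj₂ (proj₂ GF))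
      flF : flat LF ↭ zs false
      flF = subst (λ q → flat LF ↭ xs false ++ q) (Listₚ.map-cong-local (All.tabulate M'≡)) (proj₁ (proj₂ GF))
      flL : flat (LF ++ LT ++ D) ↭ zs false ++ zs true ++ flat D
      flL = ↭-trans (↭-reflexive (trans (flat-++ LF (LT ++ D)) (cong (flat LF ++_) (flat-++ LT D)))) (↭-++ flF (↭-++ʳ (flat D) flT))
      pfL : Perfect (LF ++ LT ++ D)
      pfL = unique-↭ (↭-sym flL) (Unique-++ (zs-unique false) (unique-↭ (↭-++ʳ (flat D) flT) uLTD)
              (λ (a , b) → case ∈-++⁻ (zs true) b of λ
                { (inj₁ k) → contradiction (trans (sym (zs-side true k)) (zs-side false a)) (λ ())
                ; (inj₂ k) → zs-D false a k })) ,
            λ a → ∈-resp-↭ (↭-sym flL) (everywhere a)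
        where
        open import Data.List.Membership.DecPropositional (fin-≟ fΦ) using (_∈?_)
        everywhere : ∀ a → a ∈ zs false ++ zs true ++ flat D
        everywhere a with a ∈? flat D | side a | zs-complete {a}
        ... | yes m | _ | _ = ∈-++⁺ʳ (zs false) (∈-++⁺ʳ (zs true) m)
        ... | no n | false | c = ∈-++⁺ˡ (c n)
        ... | no n | true  | c = ∈-++⁺ʳ (zs false) (∈-++⁺ˡ (c n))
      perm : (u , v) ∷ (w , z) ∷ KX' ++ KY' ++ D ↭ K ++ D
      perm = ↭-trans (prep (u , v) (↭-trans (↭-sym (shift (w , z) KX' (KY' ++ D))) (↭-reflexive (sym (Listₚ.++-assoc KX' KY D))))) (↭-++ʳ D (↭-sym K↭))
      bβ : βc D + 2 ≤ βc (K ++ D) + (length KX + length KY)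
      bβ = subst (λ q → βc D + 2 ≤ q + (length KX + length KY)) (Eβ.A-↭ perm)
        (β-bound D u v KX' w z KY' (perfect-↭ (flat-↭ (↭-sym perm)) pf) mx my pD)
      -- Removing the mixed pairs gains at least `length KY` classes of `α` and at most
      -- `length KX + length KY - 2` of `β`, so the difference drops by at most `length KX - 2`.
      -- Each of the two greedy choices adds at most `2 - suc h`. Since `length KX` is
      -- `suc h + suc h`, the total is 2.
      ineq : Drop≤ 2 (K ++ D) (LF ++ LT ++ D)
      ineq = ℕₚ.+-cancelʳ-≤ (length KX + length KY + βc D + αc D + αc (LT ++ D) + βc (LT ++ D) + 2) _ _ (subst₂ _≤_
        (trans (solve 8 (λ aK kY bD aD bT h aT bL → aK :+ kY :+ (bD :+ con 2) :+ (aD :+ bT :+ (con 1 :+ h) :+ (aT :+ bL :+ (con 1 :+ h)))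
               := (aK :+ bL) :+ (((con 1 :+ h) :+ (con 1 :+ h)) :+ kY :+ bD :+ aD :+ aT :+ bT :+ con 2)) refl
               (αc (K ++ D)) (length KY) (βc D) (αc D) (βc (LT ++ D)) h (αc (LT ++ D)) (βc (LF ++ LT ++ D)))
            (cong (λ m → αc (K ++ D) + βc (LF ++ LT ++ D) + (m + length KY + βc D + αc D + αc (LT ++ D) + βc (LT ++ D) + 2)) (sym (proj₂ half))))
        (solve 8 (λ aD bK kX kY aT bD aL bT → aD :+ (bK :+ (kX :+ kY)) :+ (aT :+ bD :+ con 2 :+ (aL :+ bT :+ con 2))
             := (aL :+ bK :+ con 2) :+ (kX :+ kY :+ bD :+ aD :+ aT :+ bT :+ con 2)) refl
             (αc D) (βc (K ++ D)) (length KX) (length KY) (αc (LT ++ D)) (βc D) (αc (LF ++ LT ++ D)) (βc (LT ++ D)))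
        (ℕₚ.+-mono-≤ (ℕₚ.+-mono-≤ α-bound bβ) (ℕₚ.+-mono-≤ (proj₂ (proj₂ (proj₂ GT))) (proj₂ (proj₂ (proj₂ GF))))))
        where open +-*-Solver

    switch-drop : ∀ {u u' w w'} K D → Unique (flat ((u , u') ∷ (w , w') ∷ K ++ D)) → Eα.ends D u ≡ w →
      Drop≤ 0 ((u , u') ∷ (w , w') ∷ K ++ D) ((u , w) ∷ (u' , w') ∷ K ++ D)
    switch-drop {u} {u'} {w} {w'} K D uq e = ≤-trans (ℕₚ.+-monoʳ-≤ _ (cls-switch {u} {w} {u'} {w'} _))
      (≤-trans (≤-reflexive (+-suc _ _)) (≤-trans (ℕₚ.+-monoˡ-≤ _ (Eα.switch-close K D uq e)) (≤-reflexive (sym (ℕₚ.+-identityʳ _)))))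

    mixed-sym : ∀ {a b} → Mixed a b → Mixed b a
    mixed-sym (n , e , inj₁ q) = ≢-sym n , sym e , inj₁ (trans (sym e) q)
    mixed-sym (n , e , inj₂ q) = ≢-sym n , sym e , inj₂ (trans (sym e) q)

    unmix : ∀ n D K → length K ≤ n → Perfect (K ++ D) → AllP Mixed K → AllP Pure D → Unmixed (K ++ D)
    unmix n D K le pf mK pD with any? (λ u → tail (Eα.ends D u) ≟V tail u) (flat K)
    ... | no none = base D K pf mK pD (λ m e → none (lose m e))
    unmix zero D [] le pf mK pD | yes ()
    unmix (suc n) D K le pf mK pD | yes some with find some
    ... | u , u∈ , tu = record { list = R.list ; perfect = R.perfect ; pure = R.pure
        ; drop = drop-trans {0} {2} {L' = new} (drop-≡ {0} {L' = (u , w) ∷ (u' , w') ∷ K2 ++ D} {M' = new} (sym (recount Eα.A-pick Eα.A-↭)) (sym (recount Eβ.A-pick Eβ.A-↭)) (Eα.A-↭ reorder) (Eβ.A-↭ reorder) (switch-drop K2 D (proj₁ pf2) refl)) R.drop }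
      where
      w = Eα.ends D u
      P1 = pick K u∈
      u' = Pick.mate P1
      K1 = Pick.rest P1
      uqD : Unique (flat D)
      uqD = unique-++ʳ (flat K) (subst Unique (flat-++ K D) (proj₁ pf))
      open Eα.Spec (Eα.spec D uqD)
      u∉D : u ∉ flat D
      u∉D = unique-disjoint (flat K) (subst Unique (flat-++ K D) (proj₁ pf)) u∈
      mK1 : AllP Mixed ((u , u') ∷ K1)
      mK1 = Pick.all P1 mixed-sym mK
      flat1 : flat (K ++ D) ↭ u ∷ u' ∷ flat (K1 ++ D)
      flat1 = ↭-trans (↭-reflexive (flat-++ K D)) (↭-trans (↭-++ʳ (flat D) (Pick.flat↭ P1)) (↭-reflexive (cong (λ q → u ∷ u' ∷ q) (sym (flat-++ K1 D)))))
      -- `w` lies on the side of `u`, and the mate `u'` lies on the other one, so `w` belongs to a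
      -- different mixed pair.
      w∈K1 : w ∈ flat K1
      w∈K1 with ∈-resp-↭ flat1 (proj₂ pf w)
      ... | here e = contradiction e (nofix u∉D)
      ... | there (here e) = contradiction (trans (sym (sides pD u)) (cong side e)) (proj₁ (All.head mK1))
      ... | there (there m) = [ id , (λ k → contradiction k (out u∉D)) ]′ (∈-++⁻ (flat K1) (subst (w ∈_) (flat-++ K1 D) m))
      P2 = pick K1 w∈K1
      w' = Pick.mate P2
      K2 = Pick.rest P2
      mK2 : AllP Mixed ((w , w') ∷ K2)
      mK2 = Pick.all P2 mixed-sym (All.tail mK1)
      flat2 : flat (K ++ D) ↭ u ∷ u' ∷ w ∷ w' ∷ flat (K2 ++ D)
      flat2 = ↭-trans flat1 (prep u (prep u' (↭-trans (↭-reflexive (flat-++ K1 D)) (↭-trans (↭-++ʳ (flat D) (Pick.flat↭ P2))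
        (↭-reflexive (cong (λ q → w ∷ w' ∷ q) (sym (flat-++ K2 D))))))))
      pf2 : Perfect ((u , u') ∷ (w , w') ∷ K2 ++ D)
      pf2 = perfect-↭ {K ++ D} flat2 pf
      D' = (u , w) ∷ (u' , w') ∷ D
      new = K2 ++ D'
      reorder : (u , w) ∷ (u' , w') ∷ K2 ++ D ↭ new
      reorder = shifts ((u , w) ∷ (u' , w') ∷ []) K2
      pureu : Pure u w
      pureu = sym (sides pD u) , sym tu
      -- There are only two sides, so the two abandoned mates agree.
      pureu' : Pure u' w'
      pureu' = bool-third (proj₁ (All.head mK1)) (λ e → proj₁ (All.head mK2) (trans (sides pD u) e)) ,
        trans (sym (proj₁ (proj₂ (All.head mK1)))) (trans (sym tu) (proj₁ (proj₂ (All.head mK2))))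
      recount : ∀ {c : List (Φ × Φ) → ℕ} → (∀ {u K} (p : Pick u K) D → c (K ++ D) ≡ c ((u , Pick.mate p) ∷ Pick.rest p ++ D)) →
        (∀ {L L'} → L ↭ L' → c L ≡ c L') → c (K ++ D) ≡ c ((u , u') ∷ (w , w') ∷ K2 ++ D)
      recount {c} cp c↭ = trans (cp P1 D) (trans (c↭ (↭-sym (shift (u , u') K1 D)))
        (trans (cp P2 ((u , u') ∷ D)) (trans (c↭ (prep (w , w') (shift (u , u') K2 D))) (c↭ (swap (w , w') (u , u') ↭-refl)))))
      R = unmix n D' K2 (ℕₚ.≤-pred (≤-trans (s≤s (≤-trans (ℕₚ.n≤1+n _) (≤-reflexive (sym (Pick.len P2))))) (≤-trans (≤-reflexive (sym (Pick.len P1))) le)))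
        (perfect-↭ {(u , u') ∷ (w , w') ∷ K2 ++ D} (↭-trans (prep u (swap u' w ↭-refl)) (flat-↭ reorder)) pf2)
        (All.tail mK2) (pureu ∷ pureu' ∷ pD)
      module R = Unmixed R

    abstract
      unmixing : ∀ D K → Perfect (K ++ D) → AllP Mixed K → AllP Pure D → Unmixed (K ++ D)
      unmixing D K = unmix (length K) D K ≤-refl

-- Euler's inequality, merging vertices and two-colourings

record Pick₂ {A : Set} (u w : A) (L : List (A × A)) : Set₁ where
  field
    mate₁ mate₂ : A
    rest  : List (A × A)
    flat↭ : flat L ↭ u ∷ mate₁ ∷ w ∷ mate₂ ∷ flat rest
    all   : ∀ {Q : A → A → Set} → (∀ {a b} → Q a b → Q b a) → AllP Q L → AllP Q ((u , mate₁) ∷ (w , mate₂) ∷ rest)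
    conn  : ∀ {R a b} → Conn (L ++ R) a b → Conn ((u , mate₁) ∷ (w , mate₂) ∷ rest ++ R) a b
    conn⁻ : ∀ {R a b} → Conn ((u , mate₁) ∷ (w , mate₂) ∷ rest ++ R) a b → Conn (L ++ R) a b

pick₂ : ∀ {A : Set} {u w : A} {L} (p : Pick u L) → w ∈ flat (Pick.rest p) → Pick₂ u w L
pick₂ {u = u} {w} {L} p m = record
  { mate₁ = P.mate ; mate₂ = Q.mate ; rest = Q.rest
  ; flat↭ = ↭-trans P.flat↭ (prep u (prep P.mate Q.flat↭))
  ; all = λ s a → All.head (P.all s a) ∷ Q.all s (All.tail (P.all s a))
  ; conn = λ {R} c → conn-fold (conn-equiv _) (λ
      { (here refl) → edge (here refl) ; (there k) → conn-wk (Q.conn {R} (edge k)) }) (P.conn {R} c)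
  ; conn⁻ = λ {R} c → P.conn⁻ {R} (conn-fold (conn-equiv _) (λ
      { (here refl) → edge (here refl) ; (there k) → conn-wk (Q.conn⁻ {R} (edge k)) }) c)
  }
  where
  module P = Pick p
  module Q = Pick (pick P.rest m)

module Counts₂ {Φ : Set} {N : ℕ} (fΦ : Finite Φ N) (α β : FPI Φ) where
  open Counts fΦ α β public

  module _ {u w : Φ} {L : List (Φ × Φ)} (p : Pick₂ u w L) where
    open Pick₂ p
    picked switched : List (Φ × Φ)
    picked = (u , mate₁) ∷ (w , mate₂) ∷ rest
    switched = (u , w) ∷ (mate₁ , mate₂) ∷ rest
    αc-picked : αc L ≡ αc picked
    αc-picked = cls-cong _ _ conn conn⁻
    βc-picked : βc L ≡ βc picked
    βc-picked = cls-cong _ _ conn conn⁻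
    flat-switched : flat L ↭ flat switched
    flat-switched = ↭-trans flat↭ (prep u (swap mate₁ w ↭-refl))

  -- For the flags of a graph, a class of `γ` alone consists of the four flags of an edge, and a
  -- matching that closes up every vertex turns these classes into connected components. So `γc []`
  -- and `γc L` supply the edges and the components of Euler's formula, up to isolated vertices.
  γ : List (Φ × Φ)
  γ = Eα.pairs ++ Eβ.pairs

  γc : List (Φ × Φ) → ℕ
  γc L = cls (L ++ γ)

  α⊆γ : ∀ L {a b} → Conn (L ++ Eα.pairs) a b → Conn (L ++ γ) a b
  α⊆γ L = conn-mono λ m → [ ∈-++⁺ˡ , (λ k → ∈-++⁺ʳ L (∈-++⁺ˡ k)) ]′ (∈-++⁻ L m)

  β⊆γ : ∀ L {a b} → Conn (L ++ Eβ.pairs) a b → Conn (L ++ γ) a b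
  β⊆γ L = conn-mono λ m → [ ∈-++⁺ˡ , (λ k → ∈-++⁺ʳ L (∈-++⁺ʳ Eα.pairs k)) ]′ (∈-++⁻ L m)

  -- Switching L towards α never decreases αc L + βc L - 2 γc L, and L = α gives equality.
  EulerAt : List (Φ × Φ) → Set
  EulerAt L = αc L + βc L + γc [] ≤ αc [] + (γc L + γc L)

  euler-done : ∀ L → Perfect L → AllP (λ u v → FPI.fun α u ≡ v) L → EulerAt L
  euler-done L (uq , co) al = subst₂ (λ p q → p + q + γc [] ≤ αc [] + (γc L + γc L)) (sym a≡) (sym b≡)
    (≤-trans (≤-reflexive (+-assoc (αc []) (γc []) (γc []))) (ℕₚ.+-monoʳ-≤ (αc []) (ℕₚ.+-mono-≤ g g)))
    where
    L⊆α : ∀ {a b} → (a , b) ∈ L → Conn Eα.pairs a b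
    L⊆α {a} m = subst (Conn _ a) (All.lookup al m) (Eα.pair-conn [] a)
    a≡ : αc L ≡ αc []
    a≡ = cls-cong (L ++ Eα.pairs) Eα.pairs (Eα.conn-base L (conn-equiv _) L⊆α (Eα.pair-conn [])) (conn-mono (∈-++⁺ʳ L))
    g : γc [] ≤ γc L
    g = cls-anti (L ++ γ) γ (conn-fold (conn-equiv _) λ m → [ (λ k → conn-mono ∈-++⁺ˡ (L⊆α k)) , edge ]′ (∈-++⁻ L m))
    mates : ∀ a → Conn (L ++ Eβ.pairs) a (FPI.fun α a)
    mates a = subst (Conn _ a) (sym (All.head (Pick.all p (λ {a} {b} e → trans (cong (FPI.fun α) (sym e)) (FPI.inv α a)) al)))
      (Pick.conn⁻ p {Eβ.pairs} (edge (here refl)))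
      where p = pick L (co a)
    b≡ : βc L ≡ γc []
    b≡ = cls-cong (L ++ Eβ.pairs) γ
      (Eβ.conn-base L (conn-equiv _) (λ m → conn-mono ∈-++⁺ˡ (L⊆α m)) (Eβ.pair-conn Eα.pairs))
      (conn-fold (conn-equiv _) λ m → [ (λ k → case ∈-map⁻ _ k of λ { (a , _ , refl) → mates a }) , (λ k → edge (∈-++⁺ʳ L k)) ]′ (∈-++⁻ Eα.pairs m))

  -- Pairing `u` with `w` splits off a cycle of `α`. If `u` and `u'` stay connected, `γc` does not
  -- grow and `βc` falls by at most one. Otherwise the path of `β` from `u` must end at `w`, so that
  -- `βc` grows too, and the two units gained pay for at most one new component, which counts twice.
  euler-switch : ∀ {u u' w w'} R → Perfect ((u , u') ∷ (w , w') ∷ R) → FPI.fun α u ≡ w →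
    EulerAt ((u , w) ∷ (u' , w') ∷ R) → EulerAt ((u , u') ∷ (w , w') ∷ R)
  euler-switch {u} {u'} {w} {w'} R pf e ih = by (conn? (new ++ γ) u u')
    where
    open +-*-Solver
    old = (u , u') ∷ (w , w') ∷ R
    new = (u , w) ∷ (u' , w') ∷ R
    a< : suc (αc old) ≤ αc new
    a< = subst (λ z → suc (αc ((u , u') ∷ (w , w') ∷ z)) ≤ αc ((u , w) ∷ (u' , w') ∷ z)) (Listₚ.++-identityʳ R)
      (Eα.switch-close R [] (subst (λ z → Unique (flat ((u , u') ∷ (w , w') ∷ z))) (sym (Listₚ.++-identityʳ R)) (proj₁ pf)) e)
    split : βc old ≤ suc (βc new) → γc new ≤ γc old → EulerAt old
    split b g = ≤-trans (ℕₚ.+-monoˡ-≤ (γc []) (≤-trans (ℕₚ.+-monoʳ-≤ (αc old) b) (≤-trans (≤-reflexive (+-suc _ _)) (ℕₚ.+-monoˡ-≤ (βc new) a<))))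
      (≤-trans ih (ℕₚ.+-monoʳ-≤ (αc []) (ℕₚ.+-mono-≤ g g)))
    by : Dec (Conn (new ++ γ) u u') → EulerAt old
    by (yes c) = split (cls-switch {u} {u'} {w} {w'} (R ++ Eβ.pairs)) (cls-anti (old ++ γ) (new ++ γ) (conn-fold (conn-equiv _) λ
      { (here refl) → c
      ; (there (here refl)) → ctrans (csym (edge (here refl))) (ctrans c (edge (there (here refl))))
      ; (there (there m)) → edge (there (there m)) }))
    by (no ≁) = ℕₚ.+-cancelʳ-≤ 2 _ _ (≤-trans (≤-reflexive (solve 3 (λ a b c → a :+ b :+ c :+ con 2 := (con 1 :+ a) :+ (con 1 :+ b) :+ c) refl (αc old) (βc old) (γc [])))
        (≤-trans (ℕₚ.+-monoˡ-≤ (γc []) (ℕₚ.+-mono-≤ a< b<)) (≤-trans ih (≤-trans (ℕₚ.+-monoʳ-≤ (αc []) (ℕₚ.+-mono-≤ g g))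
          (≤-reflexive (solve 2 (λ a c → a :+ ((con 1 :+ c) :+ (con 1 :+ c)) := a :+ (c :+ c) :+ con 2) refl (αc []) (γc old)))))))
      where
      g : γc new ≤ suc (γc old)
      g = cls-switch {u} {w} {u'} {w'} (R ++ γ)
      uq = proj₁ pf
      u∉ : u ∉ flat R
      u∉ = unique-∉ uq ∘ there ∘ there ∘ there
      open Eβ.Spec (Eβ.spec R (unique-tail (unique-tail (unique-tail (unique-tail uq)))))
      up : ∀ {a b} → Conn (R ++ Eβ.pairs) a b → Conn (new ++ γ) a b
      up = conn-wk ∘ conn-wk ∘ β⊆γ R
      other : Eβ.ends R u ≡ w
      other with proj₂ pf (Eβ.ends R u)
      ... | here q = contradiction q (nofix u∉)
      ... | there (here q) = contradiction (up (subst (Conn _ u) q (path u∉))) ≁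
      ... | there (there (here q)) = q
      ... | there (there (there (here q))) =
            contradiction (ctrans (up (subst (Conn _ u) q (path u∉))) (csym (edge (there (here refl))))) ≁
      ... | there (there (there (there m))) = contradiction m (out u∉)
      b< : suc (βc old) ≤ βc new
      b< = Eβ.switch-close [] R uq other

  -- Every switch raises `αc`, which never exceeds `αc []`; `n` bounds the distance that remains.
  euler : ∀ n L → αc [] ≤ αc L + n → Perfect L → EulerAt L
  euler n L le pf with any? (λ p → ¬? (fin-≟ fΦ (FPI.fun α (proj₁ p)) (proj₂ p))) L
  ... | no none = euler-done L pf (All.tabulate λ {p} m → case fin-≟ fΦ (FPI.fun α (proj₁ p)) (proj₂ p) of λ
        { (yes e) → e ; (no ne) → contradiction (lose m ne) none })
  ... | yes some with find some
  ...   | (u , u') , m , ne with ∈-∃++ m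
  ...     | xs , ys , refl = subst₂ (λ a b → a + b + γc [] ≤ αc [] + (γc L + γc L)) (sym ea) (sym eb)
            (subst (λ g → αc old + βc old + γc [] ≤ αc [] + (g + g)) (sym eg) (euler-switch rest pf' refl (step n le)))
    where
    w = FPI.fun α u
    L↭ : xs ++ (u , u') ∷ ys ↭ (u , u') ∷ xs ++ ys
    L↭ = shift (u , u') xs ys
    w∈ : w ∈ flat (xs ++ ys)
    w∈ with ∈-resp-↭ (flat-↭ L↭) (proj₂ pf w)
    ... | here q = contradiction q (FPI.fpf α u)
    ... | there (here q) = contradiction q ne
    ... | there (there k) = k
    P = pick (xs ++ ys) w∈
    open Pick P
    old = (u , u') ∷ (w , mate) ∷ rest
    new = (u , w) ∷ (u' , mate) ∷ rest
    to : ∀ R {a b} → Conn ((xs ++ (u , u') ∷ ys) ++ R) a b → Conn (old ++ R) a b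
    to R c = conn-fold (conn-equiv _) (λ { (here refl) → edge (here refl) ; (there k) → conn-wk (conn {R} (edge k)) }) (conn-↭ (↭-++ʳ R L↭) c)
    from : ∀ R {a b} → Conn (old ++ R) a b → Conn ((xs ++ (u , u') ∷ ys) ++ R) a b
    from R c = conn-↭ (↭-++ʳ R (↭-sym L↭)) (conn-fold (conn-equiv _) (λ { (here refl) → edge (here refl) ; (there k) → conn-wk (conn⁻ {R} (edge k)) }) c)
    ea : αc (xs ++ (u , u') ∷ ys) ≡ αc old
    ea = cls-cong _ _ (to Eα.pairs) (from Eα.pairs)
    eb : βc (xs ++ (u , u') ∷ ys) ≡ βc old
    eb = cls-cong _ _ (to Eβ.pairs) (from Eβ.pairs)
    eg : γc (xs ++ (u , u') ∷ ys) ≡ γc old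
    eg = cls-cong _ _ (to γ) (from γ)
    pf' : Perfect old
    pf' = perfect-↭ {xs ++ (u , u') ∷ ys} (↭-trans (flat-↭ L↭) (prep u (prep u' flat↭))) pf
    more : suc (αc old) ≤ αc new
    more = subst (λ z → suc (αc ((u , u') ∷ (w , mate) ∷ z)) ≤ αc ((u , w) ∷ (u' , mate) ∷ z)) (Listₚ.++-identityʳ rest)
      (Eα.switch-close rest [] (subst (λ z → Unique (flat ((u , u') ∷ (w , mate) ∷ z))) (sym (Listₚ.++-identityʳ rest)) (proj₁ pf')) refl)
    step : ∀ n → αc [] ≤ αc (xs ++ (u , u') ∷ ys) + n → EulerAt new
    step zero le = contradiction (≤-trans more (≤-trans (cls-anti Eα.pairs (new ++ Eα.pairs) (conn-mono (∈-++⁺ʳ new)))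
      (≤-trans le (≤-reflexive (trans (ℕₚ.+-identityʳ _) ea))))) ℕₚ.1+n≰n
    step (suc n) le = euler n new (≤-trans le (≤-trans (≤-reflexive (trans (cong (_+ suc n) ea) (+-suc _ n))) (ℕₚ.+-monoˡ-≤ n more)))
      (perfect-↭ {old} (prep u (swap u' w ↭-refl)) pf')

module Merging {Φ : Set} {N : ℕ} (fΦ : Finite Φ N) (α β : FPI Φ) {V : Set} (_≟V_ : DecidableEquality V)
  (tail : Φ → V) (β-tail : ∀ a → tail (FPI.fun β a) ≡ tail a) where
  open Counts₂ fΦ α β

  Level : Φ → Φ → Set
  Level u v = tail u ≡ tail v

  Transitive : List (Φ × Φ) → Set
  Transitive L = ∀ a b → tail a ≡ tail b → Conn (L ++ Eβ.pairs) a b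

  record Merged (L₀ : List (Φ × Φ)) : Set where
    field
      list : List (Φ × Φ)
      perfect : Perfect list
      level : AllP Level list
      transitive : Transitive list
      drop : Drop≤ 0 L₀ list

  merging : ∀ n L → βc L ≤ n → Perfect L → AllP Level L → Merged L
  merging n L le pf lv with any? (λ a → any? (λ b → (tail a ≟V tail b) ×-dec ¬? (conn? (L ++ Eβ.pairs) a b)) (enum fΦ)) (enum fΦ)
  ... | no none = record { list = L ; perfect = pf ; level = lv ; drop = ℕₚ.m≤m+n _ 0 ; transitive = λ a b e →
        case conn? (L ++ Eβ.pairs) a b of λ { (yes c) → c ; (no ≁) → contradiction (lose (∈-enum fΦ a) (lose (∈-enum fΦ b) (e , ≁))) none } }
  ... | yes some with find some
  ...   | u , _ , some' with find some'
  ...     | w , _ , tuw , ≁ = go n le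
    where
    P = pick L (proj₂ pf u)
    module P = Pick P
    w∈ : w ∈ flat P.rest
    w∈ with ∈-resp-↭ P.flat↭ (proj₂ pf w)
    ... | here e = contradiction (≡⇒conn (sym e)) ≁
    ... | there (here e) = contradiction (subst (Conn _ u) (sym e) (P.conn⁻ {Eβ.pairs} (edge (here refl)))) ≁
    ... | there (there m) = m
    P₂ = pick₂ P w∈
    open Pick₂ P₂
    pf' : Perfect (picked P₂)
    pf' = perfect-↭ {L} flat↭ pf
    fewer : suc (βc (switched P₂)) ≤ βc L
    fewer = ≤-trans (Eβ.switch-fewer rest pf' (≁ ∘ conn⁻ {Eβ.pairs})) (≤-reflexive (sym (βc-picked P₂)))
    lv' : AllP Level (switched P₂)
    lv' = case all sym lv of λ { (p ∷ q ∷ r) → tuw ∷ trans (sym p) (trans tuw q) ∷ r }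
    less : Drop≤ 0 L (switched P₂)
    less = ≤-trans (ℕₚ.+-monoˡ-≤ _ (≤-trans (≤-reflexive (αc-picked P₂)) (cls-switch {u} {mate₁} {w} {mate₂} (rest ++ Eα.pairs))))
      (≤-trans (≤-reflexive (sym (+-suc _ _))) (≤-trans (ℕₚ.+-monoʳ-≤ _ fewer) (≤-reflexive (sym (ℕₚ.+-identityʳ _)))))
    go : ∀ n → βc L ≤ n → Merged L
    go zero le = contradiction (≤-trans fewer le) (λ ())
    go (suc n) le = record { list = R.list ; perfect = R.perfect ; level = R.level ; transitive = R.transitive
        ; drop = drop-trans {0} {0} {L} {switched P₂} less R.drop }
      where
      module R = Merged (merging n (switched P₂) (ℕₚ.≤-pred (≤-trans fewer le)) (perfect-↭ {L} (flat-switched P₂) pf) lv')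

  abstract
    merge-vertices : ∀ L → Perfect L → AllP Level L → Merged L
    merge-vertices L = merging (βc L) L ≤-refl

module Colouring {Φ : Set} {N : ℕ} (fΦ : Finite Φ N) (β : FPI Φ) where
  open Classes fΦ
  open Ends fΦ β
  open FPI β

  -- A proper colouring of the cycles of `β` and the matching orients every vertex: of the two flags
  -- of a dart, the colour singles out the one that looks forward. Paths begin and end with `β` and
  -- so have odd length, which gives `flip-ends`.
  record Colour (L : List (Φ × Φ)) : Set where
    field
      col : Φ → Bool
      flip-β : ∀ a → col (fun a) ≡ not (col a)
      flip-L : AllP (λ u v → col u ≡ not (col v)) L
      flip-ends : ∀ {w} → w ∉ flat L → col (ends L w) ≡ not (col w)

  colour-∷ : ∀ {u v L} → Unique (flat ((u , v) ∷ L)) → (C : Colour L) → Colour.col C u ≡ not (Colour.col C v) → Colour ((u , v) ∷ L)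
  colour-∷ {u} {v} {L} uq C e = record { col = col ; flip-β = flip-β ; flip-L = e ∷ flip-L ; flip-ends = λ {w} w∉ → go w w∉ }
    where
    open Colour C
    go : ∀ w → w ∉ u ∷ v ∷ flat L → col (ends ((u , v) ∷ L) w) ≡ not (col w)
    go w w∉ with fin-≟ fΦ (ends L w) u
    ... | yes q = trans (flip-ends (unique-∉ (unique-tail uq))) (trans (sym e) (trans (cong col (sym q)) (flip-ends (w∉ ∘ there ∘ there))))
    ... | no _ with fin-≟ fΦ (ends L w) v
    ...   | yes q = trans (flip-ends (unique-∉ uq ∘ there)) (trans (cong not e) (trans (Boolₚ.not-involutive _) (trans (cong col (sym q)) (flip-ends (w∉ ∘ there ∘ there)))))
    ...   | no _ = flip-ends (w∉ ∘ there ∘ there)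

  -- If u and v have the same colour they lie on different paths, so one path can be recoloured.
  colouring : (c : Φ → Bool) → (∀ a → c (fun a) ≡ not (c a)) → ∀ L → Unique (flat L) → Colour L
  colouring c cβ [] _ = record { col = c ; flip-β = cβ ; flip-L = [] ; flip-ends = λ _ → cβ _ }
  colouring c cβ ((u , v) ∷ L) uq with colouring c cβ L (unique-tail (unique-tail uq))
  ... | C with Colour.col C u Boolₚ.≟ not (Colour.col C v)
  ...   | yes e = colour-∷ uq C e
  ...   | no ne = colour-∷ uq C' e'
    where
    open Colour C
    open Spec (spec L (unique-tail (unique-tail uq)))
    u∉ : u ∉ flat L
    u∉ = unique-∉ uq ∘ there
    v∉ : v ∉ flat L
    v∉ = unique-∉ (unique-tail uq)
    twist : Φ → Bool
    twist w with conn? (L ++ pairs) v w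
    ... | yes _ = true
    ... | no _ = false
    twist-cong : ∀ {a b} → Conn (L ++ pairs) a b → twist a ≡ twist b
    twist-cong {a} {b} ab with conn? (L ++ pairs) v a | conn? (L ++ pairs) v b
    ... | yes _ | yes _ = refl
    ... | no _ | no _ = refl
    ... | yes c | no n = contradiction (ctrans c ab) n
    ... | no n | yes c = contradiction (ctrans c (csym ab)) n
    tw-v : twist v ≡ true
    tw-v with conn? (L ++ pairs) v v
    ... | yes _ = refl
    ... | no n = contradiction crefl n
    tw-u : twist u ≡ false
    tw-u with conn? (L ++ pairs) v u
    ... | no _ = refl
    ... | yes k = case only v∉ u∉ k of λ
      { (inj₁ e) → contradiction (here e) (unique-∉ uq)
      ; (inj₂ e) → contradiction (trans (cong col e) (flip-ends v∉)) ne }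
    xor-not : ∀ a b → a xor not b ≡ not (a xor b)
    xor-not true b = refl
    xor-not false b = refl
    flipped : ∀ {a b} → Conn (L ++ pairs) a b → col b ≡ not (col a) → twist b xor col b ≡ not (twist a xor col a)
    flipped {a} {b} k e = trans (cong₂ _xor_ (sym (twist-cong k)) e) (xor-not (twist a) (col a))
    C' : Colour L
    C' = record { col = λ w → twist w xor col w
      ; flip-β = λ a → flipped (pair-conn L a) (flip-β a)
      ; flip-L = All.tabulate λ {p} m → flipped (csym (edge (∈-++⁺ˡ m))) (All.lookup flip-L m)
      ; flip-ends = λ w∉ → flipped (path w∉) (flip-ends w∉) }
    e' : twist u xor col u ≡ not (twist v xor col v)
    e' rewrite tw-v | tw-u with col u | col v
    ... | true  | true  = refl
    ... | true  | false = contradiction refl ne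
    ... | false | true  = contradiction refl ne
    ... | false | false = refl

  abstract
    two-colouring : (c : Φ → Bool) → (∀ a → c (fun a) ≡ not (c a)) → ∀ L → Unique (flat L) → Colour L
    two-colouring = colouring

module Separation {Φ : Set} {N : ℕ} (fΦ : Finite Φ N) (α β : FPI Φ) {V : Set} (_≟V_ : DecidableEquality V)
  (tail : Φ → V) (side : Φ → Bool) (α-side : ∀ a → side (FPI.fun α a) ≡ side a) (β-side : ∀ a → side (FPI.fun β a) ≡ side a)
  (β-tail : ∀ a → tail (FPI.fun β a) ≡ tail a) (x y : V) (x≢y : x ≢ y)
  (mixed : ∀ u v → side u ≢ side v → tail u ≡ tail v → tail u ≡ x ⊎ tail u ≡ y) where
  open Counts₂ fΦ α β
  private
    module U = Unmixing fΦ α β _≟V_ tail side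
    module UM = U.Main α-side (λ a → β-side a , β-tail a) x y x≢y

  SameVertex : Φ → Φ → Set
  SameVertex u v = side u ≡ side v × tail u ≡ tail v

  record Separated (L : List (Φ × Φ)) : Set where
    field
      list : List (Φ × Φ)
      perfect : Perfect list
      level : AllP SameVertex list
      transitive : ∀ a b → SameVertex a b → Conn (list ++ Eβ.pairs) a b
      drop : Drop≤ 2 L list

  split-mixed : ∀ (L : List (Φ × Φ)) → ∃ λ K → ∃ λ D → L ↭ K ++ D × AllP (λ u v → side u ≢ side v) K × AllP (λ u v → side u ≡ side v) D
  split-mixed [] = [] , [] , ↭-refl , [] , []
  split-mixed (p ∷ L) with split-mixed L | side (proj₁ p) Boolₚ.≟ side (proj₂ p)
  ... | K , D , r , a , b | yes e = K , p ∷ D , ↭-trans (prep p r) (↭-sym (shift p K D)) , a , e ∷ b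
  ... | K , D , r , a , b | no n = p ∷ K , D , prep p r , n ∷ a , b

  -- Merging uses side and vertex together, so that the two copies of a terminal, one on each side,
  -- stay apart.
  sv : Φ → Bool × V
  sv φ = side φ , tail φ
  private
    module Mg = Merging fΦ α β (≡-dec Boolₚ._≟_ _≟V_) sv (λ a → cong₂ _,_ (β-side a) (β-tail a))

  separate : ∀ L → Perfect L → AllP (λ u v → tail u ≡ tail v) L → Separated L
  separate L pf lv with split-mixed L
  ... | K , D , L↭ , mK , pD = record { list = Me.list ; perfect = Me.perfect
      ; level = All.map (λ e → cong proj₁ e , cong proj₂ e) Me.level
      ; transitive = λ a b (p , q) → Me.transitive a b (cong₂ _,_ p q)
      ; drop = drop-≡ {2} {K ++ D} {Me.list} {L} {Me.list} (Eα.A-↭ (↭-sym L↭)) (Eβ.A-↭ (↭-sym L↭)) refl refl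
          (drop-trans {2} {0} {K ++ D} {Un.list} {Me.list} Un.drop Me.drop) }
    where
    lv' : AllP (λ u v → tail u ≡ tail v) (K ++ D)
    lv' = All-resp-↭ L↭ lv
    un : UM.Unmixed (K ++ D)
    un = UM.unmixing D K (perfect-↭ {L} {K ++ D} (flat-↭ L↭) pf)
      (All.zipWith (λ {p} (n , e) → n , e , mixed (proj₁ p) (proj₂ p) n e) (mK , All-++ˡ K lv'))
      (All.zipWith id (pD , All-++ʳ K lv'))
    module Un = UM.Unmixed un
    me : Mg.Merged Un.list
    me = Mg.merge-vertices Un.list Un.perfect (All.map (λ (a , b) → cong₂ _,_ a b) Un.pure)
    module Me = Mg.Merged me

-- Embeddings as matchings of flags

enum-unique : ∀ {A : Set} {N} (fA : Finite A N) → Unique (enum fA)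
enum-unique {N = N} (r , sur , iff) = unique-map _ (allFin N)
  (λ {i} {j} _ _ e → trans (sym (proj₂ (sur i))) (trans (cong r e) (proj₂ (sur j)))) (allFin⁺ N)

sum-equiv : ∀ {A B : Set} {R : A → A → Set} {S : B → B → Set} → IsEquiv R → IsEquiv S → IsEquiv (Sum R S)
sum-equiv {R = R} {S} p q = record { erefl = λ {a} → r a ; esym = λ {a} {b} → s a b ; etrans = λ {a} {b} {c} → t a b c }
  where
  r : ∀ a → Sum R S a a
  r (inj₁ a) = erefl p
  r (inj₂ a) = erefl q
  s : ∀ a b → Sum R S a b → Sum R S b a
  s (inj₁ a) (inj₁ b) = esym p
  s (inj₂ a) (inj₂ b) = esym q
  t : ∀ a b c → Sum R S a b → Sum R S b c → Sum R S a c
  t (inj₁ a) (inj₁ b) (inj₁ c) = etrans p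
  t (inj₂ a) (inj₂ b) (inj₂ c) = etrans q

module Partner {A : Set} {N : ℕ} (fA : Finite A N) where
  private _≟_ = fin-≟ fA

  Perfect : List (A × A) → Set
  Perfect L = Unique (flat L) × (∀ a → a ∈ flat L)

  abstract
    pairing : (f : FPI A) → Σ (List (A × A)) λ L → Perfect L × AllP (λ a b → b ≡ FPI.fun f a) L
    pairing f = let L , fl , q = pair-up (FPI.fun f) _ (enum fA) ≤-refl (enum-unique fA) (λ _ → ∈-enum fA _) (λ _ → FPI.inv f _) (λ _ → FPI.fpf f _)
      in L , (unique-↭ (↭-sym fl) (enum-unique fA) , λ a → ∈-resp-↭ (↭-sym fl) (∈-enum fA a)) , q

    partner : List (A × A) → A → A
    -- A default that is not reached at any point of a perfect matching.
    partner [] a = a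
    partner ((u , v) ∷ L) a with a ≟ u
    ... | yes _ = v
    ... | no _ with a ≟ v
    ...   | yes _ = u
    ...   | no _ = partner L a

    partner-∈ : ∀ L {a b} → Unique (flat L) → (a , b) ∈ L → partner L a ≡ b × partner L b ≡ a
    partner-∈ ((u , v) ∷ L) uq (here refl) = l , r
      where
      l : partner ((u , v) ∷ L) u ≡ v
      l with u ≟ u
      ... | yes _ = refl
      ... | no n = contradiction refl n
      r : partner ((u , v) ∷ L) v ≡ u
      r with v ≟ u
      ... | yes e = e
      ... | no _ with v ≟ v
      ...   | yes _ = refl
      ...   | no n = contradiction refl n
    partner-∈ ((u , v) ∷ L) {a} {b} uq (there m) =
      trans (skip (proj₁ (∈-flat m))) (proj₁ ih) , trans (skip (proj₂ (∈-flat m))) (proj₂ ih)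
      where
      ih : partner L a ≡ b × partner L b ≡ a
      ih = partner-∈ L (unique-tail (unique-tail uq)) m
      skip : ∀ {a} → a ∈ flat L → partner ((u , v) ∷ L) a ≡ partner L a
      skip {a} k with a ≟ u
      ... | yes refl = contradiction (there k) (unique-∉ uq)
      ... | no _ with a ≟ v
      ...   | yes refl = contradiction k (unique-∉ (unique-tail uq))
      ...   | no _ = refl

    pair-of : ∀ (L : List (A × A)) {a} → a ∈ flat L → ∃ λ b → (a , b) ∈ L ⊎ (b , a) ∈ L
    pair-of ((u , v) ∷ L) (here refl) = v , inj₁ (here refl)
    pair-of ((u , v) ∷ L) (there (here refl)) = u , inj₂ (here refl)
    pair-of ((u , v) ∷ L) (there (there m)) with pair-of L m
    ... | b , inj₁ k = b , inj₁ (there k)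
    ... | b , inj₂ k = b , inj₂ (there k)

    partner-pair : ∀ L → Perfect L → ∀ a → (a , partner L a) ∈ L ⊎ (partner L a , a) ∈ L
    partner-pair L (uq , co) a with pair-of L (co a)
    ... | b , inj₁ k = inj₁ (subst (λ z → (a , z) ∈ L) (sym (proj₁ (partner-∈ L uq k))) k)
    ... | b , inj₂ k = inj₂ (subst (λ z → (z , a) ∈ L) (sym (proj₂ (partner-∈ L uq k))) k)

    partner-inv : ∀ L → Perfect L → ∀ a → partner L (partner L a) ≡ a
    partner-inv L pf a with partner-pair L pf a
    ... | inj₁ k = proj₂ (partner-∈ L (proj₁ pf) k)
    ... | inj₂ k = proj₁ (partner-∈ L (proj₁ pf) k)

    partner-rel : ∀ {Q : A → A → Set} L → Perfect L → (∀ {a b} → Q a b → Q b a) → AllP Q L → ∀ a → Q a (partner L a)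
    partner-rel L pf s al a with partner-pair L pf a
    ... | inj₁ k = All.lookup al k
    ... | inj₂ k = s (All.lookup al k)

iter-+ : ∀ {A : Set} (f : A → A) m k a → iter f m (iter f k a) ≡ iter f (m + k) a
iter-+ f zero k a = refl
iter-+ f (suc m) k a = cong f (iter-+ f m k a)

module Orbits {A : Set} {N : ℕ} (fA : Finite A N) (f : A → A) (f-inj : ∀ a b → f a ≡ f b → a ≡ b) where

  Reach : A → A → Set
  Reach a b = ∃ λ m → iter f m a ≡ b

  reach-trans : ∀ {a b c} → Reach a b → Reach b c → Reach a c
  reach-trans {a} (m , refl) (k , e) = k + m , trans (sym (iter-+ f k m a)) e

  -- A scheme asks for forward iterates of the rotation. Finiteness brings every point back to
  -- itself, which makes `Reach` symmetric.
  order : ∀ a → ∃ λ k → iter f (suc k) a ≡ a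
  order a with Fₚ.pigeonhole (ℕₚ.n<1+n N) (λ i → proj₁ fA (iter f (toℕ i) a))
  ... | i , j , i<j , e = cancel (toℕ i) (toℕ j) i<j (proj₁ (proj₂ (proj₂ fA) _ _) e)
    where
    cancel : ∀ i j → i < j → iter f i a ≡ iter f j a → ∃ λ k → iter f (suc k) a ≡ a
    cancel zero (suc j) _ e = j , sym e
    cancel (suc i) (suc j) (s≤s lt) e = cancel i j lt (f-inj _ _ e)

  back : ∀ a → Reach (f a) a
  back a with order a
  ... | k , e = k , trans (shift-iter k a) e
    where
    shift-iter : ∀ k a → iter f k (f a) ≡ iter f (suc k) a
    shift-iter zero a = refl
    shift-iter (suc k) a = cong f (shift-iter k a)

  reach-sym : ∀ {a b} → Reach a b → Reach b a
  reach-sym {a} (zero , e) = 0 , sym e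
  reach-sym {a} (suc m , refl) = reach-trans (back (iter f m a)) (reach-sym (m , refl))

  reach-equiv : IsEquiv Reach
  reach-equiv = record { erefl = 0 , refl ; esym = reach-sym ; etrans = reach-trans }

module _ (G : Graph) where

  abstract
    fin-Dart : Finite (Dart G) (sumFin (λ u → count (adj G u)))
    fin-Dart = fin-Σ _ _ (λ u → fin-count (adj G u))

  dart-≡ : ∀ {d d' : Dart G} → proj₁ d ≡ proj₁ d' → proj₁ (proj₂ d) ≡ proj₁ (proj₂ d') → d ≡ d'
  dart-≡ {u , v , e} {.u , .v , e'} refl refl = cong (λ z → u , v , z) (T-irrelevant e e')

  rev-rev : ∀ d → rev G (rev G d) ≡ d
  rev-rev d = dart-≡ refl refl

  rev-≢ : ∀ d → rev G d ≢ d
  rev-≢ (u , v , e) q with cong proj₁ q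
  ... | refl = subst T (adj-irr G u) e

  abstract
    fin-Flag : ∃ λ N → Finite (Flag G) N
    fin-Flag = _ , fin-transport {B = Dart G ⊎ Dart G} to inj onto (fin-sum fin-Dart fin-Dart)
      where
      to : Flag G → Dart G ⊎ Dart G
      to (d , true) = inj₁ d
      to (d , false) = inj₂ d
      inj : ∀ a b → to a ≡ to b → a ≡ b
      inj (d , true) (.d , true) refl = refl
      inj (d , false) (.d , false) refl = refl
      onto : ∀ b → ∃ λ a → to a ≡ b
      onto (inj₁ d) = (d , true) , refl
      onto (inj₂ d) = (d , false) , refl

  fF : Finite (Flag G) (proj₁ fin-Flag)
  fF = proj₂ fin-Flag

  -- The labels of the sides are normalised so that crossing any edge keeps the label; the signature
  -- in `α₀` is removed by relabelling.
  αF βF : FPI (Flag G)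
  αF = record { fun = λ (d , s) → rev G d , s ; inv = λ (d , s) → cong (_, s) (rev-rev d) ; fpf = λ (d , s) e → rev-≢ d (cong proj₁ e) }
  βF = record { fun = λ (d , s) → d , not s ; inv = λ (d , s) → cong (d ,_) (Boolₚ.not-involutive s) ; fpf = λ (d , s) e → Boolₚ.not-¬ refl (sym (cong proj₂ e)) }

  vertex : Flag G → Fin (n G)
  vertex (d , s) = proj₁ d

  module C = Counts₂ fF αF βF
  module M = Merging fF αF βF F._≟_ vertex (λ _ → refl)

  -- An embedding as a perfect matching of flags that joins the darts around each vertex into one cycle.
  -- No orientation of the vertices and no signature is recorded: both are absorbed in the labels of the sides.
  record Rot : Set where
    field
      list : List (Flag G × Flag G)
      perfect : C.Perfect list
      level : AllP M.Level list
      transitive : M.Transitive list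

  Undirected : Dart G → Dart G → Set
  Undirected d d' = d' ≡ d ⊎ d' ≡ rev G d

  nc-edges : NumClasses Undirected (numEdges G)
  nc-edges = nc-pull to onto reflects preserves
      (fin-Σ _ _ (λ u → fin-count (λ v → (toℕ u <ᵇ toℕ v) ∧ adj G u v)))
    where
    UEdge : Set
    UEdge = Σ (Fin (n G)) λ u → Σ (Fin (n G)) λ v → T ((toℕ u <ᵇ toℕ v) ∧ adj G u v)
    both : ∀ {a b} → T a → T b → T (a ∧ b)
    both {true} {true} _ _ = tt
    left : ∀ {a b} → T (a ∧ b) → T a
    left {true} _ = tt
    right : ∀ {a b} → T (a ∧ b) → T b
    right {true} t = t
    toWith : (d : Dart G) → Dec (toℕ (proj₁ d) < toℕ (proj₁ (proj₂ d))) → UEdge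
    toWith (u , v , e) (yes lt) = u , v , both (ℕₚ.<⇒<ᵇ lt) e
    toWith (u , v , e) (no nlt) = v , u , both (ℕₚ.<⇒<ᵇ (ℕₚ.≤∧≢⇒< (ℕₚ.≮⇒≥ nlt) (λ q → rev-≢ (u , v , e) (dart-≡ (Fₚ.toℕ-injective q) (sym (Fₚ.toℕ-injective q)))))) (proj₂ (proj₂ (rev G (u , v , e))))
    to : Dart G → UEdge
    to d = toWith d (toℕ (proj₁ d) ℕₚ.<? toℕ (proj₁ (proj₂ d)))
    uedge-≡ : ∀ {a b : UEdge} → proj₁ a ≡ proj₁ b → proj₁ (proj₂ a) ≡ proj₁ (proj₂ b) → a ≡ b
    uedge-≡ {u , v , e} {.u , .v , e'} refl refl = cong (λ z → u , v , z) (T-irrelevant e e')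
    ends-to : ∀ d (c : Dec _) → (proj₁ (toWith d c) ≡ proj₁ d × proj₁ (proj₂ (toWith d c)) ≡ proj₁ (proj₂ d)) ⊎
      (proj₁ (toWith d c) ≡ proj₁ (proj₂ d) × proj₁ (proj₂ (toWith d c)) ≡ proj₁ d)
    ends-to d (yes _) = inj₁ (refl , refl)
    ends-to d (no _) = inj₂ (refl , refl)
    onto : ∀ b → ∃ λ a → to a ≡ b
    onto (u , v , t) = (u , v , right {toℕ u <ᵇ toℕ v} t) , lem (toℕ u ℕₚ.<? toℕ v)
      where
      lem : (c : Dec _) → toWith (u , v , right {toℕ u <ᵇ toℕ v} t) c ≡ (u , v , t)
      lem (yes _) = uedge-≡ refl refl
      lem (no n) = contradiction (ℕₚ.<ᵇ⇒< (toℕ u) (toℕ v) (left t)) n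
    reflects : ∀ a b → to a ≡ to b → Undirected a b
    reflects a b e with ends-to a (toℕ (proj₁ a) ℕₚ.<? toℕ (proj₁ (proj₂ a))) | ends-to b (toℕ (proj₁ b) ℕₚ.<? toℕ (proj₁ (proj₂ b)))
    ... | inj₁ (p , q) | inj₁ (r , s) = inj₁ (dart-≡ (trans (sym r) (trans (cong proj₁ (sym e)) p)) (trans (sym s) (trans (cong (proj₁ ∘ proj₂) (sym e)) q)))
    ... | inj₁ (p , q) | inj₂ (r , s) = inj₂ (dart-≡ (trans (sym s) (trans (cong (proj₁ ∘ proj₂) (sym e)) q)) (trans (sym r) (trans (cong proj₁ (sym e)) p)))
    ... | inj₂ (p , q) | inj₁ (r , s) = inj₂ (dart-≡ (trans (sym r) (trans (cong proj₁ (sym e)) p)) (trans (sym s) (trans (cong (proj₁ ∘ proj₂) (sym e)) q)))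
    ... | inj₂ (p , q) | inj₂ (r , s) = inj₁ (dart-≡ (trans (sym s) (trans (cong (proj₁ ∘ proj₂) (sym e)) q)) (trans (sym r) (trans (cong proj₁ (sym e)) p)))
    preserves : ∀ a b → Undirected a b → to a ≡ to b
    preserves a .a (inj₁ refl) = refl
    preserves (u , v , e) .(rev G (u , v , e)) (inj₂ refl) = lem (toℕ u ℕₚ.<? toℕ v) (toℕ v ℕₚ.<? toℕ u)
      where
      lem : (c : Dec _) (c' : Dec _) → toWith (u , v , e) c ≡ toWith (rev G (u , v , e)) c'
      lem (yes p) (yes q) = contradiction q (ℕₚ.<⇒≯ p)
      lem (yes p) (no q) = uedge-≡ refl refl
      lem (no p) (yes q) = uedge-≡ refl refl
      lem (no p) (no q) = contradiction (ℕₚ.≤-antisym (ℕₚ.≮⇒≥ p) (ℕₚ.≮⇒≥ q))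
        (λ z → rev-≢ (u , v , e) (dart-≡ (Fₚ.toℕ-injective z) (sym (Fₚ.toℕ-injective z))))

  undirected-equiv : IsEquiv Undirected
  undirected-equiv = record
    { erefl = inj₁ refl
    ; esym = λ { (inj₁ e) → inj₁ (sym e) ; (inj₂ e) → inj₂ (trans (sym (rev-rev _)) (cong (rev G) (sym e))) }
    ; etrans = λ { (inj₁ refl) d → d ; (inj₂ refl) (inj₁ d) → inj₂ d ; (inj₂ refl) (inj₂ d) → inj₁ (trans d (rev-rev _)) } }

  isolated? : ∀ v → Dec (Isolated G v)
  isolated? v = Fₚ.all? (λ w → adj G v w Boolₚ.≟ false)

  -- Isolated vertices carry no flag. Each adds one vertex, one face and one component, so the three
  -- counts of classes are corrected by the same number.
  isolates : ℕ
  isolates = count (λ v → ⌊ isolated? v ⌋)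

  SameIsolated : Σ (Fin (n G)) (Isolated G) → Σ (Fin (n G)) (Isolated G) → Set
  SameIsolated a b = proj₁ a ≡ proj₁ b

  nc-isolates : NumClasses SameIsolated isolates
  nc-isolates = nc-pull {S = _≡_} (λ (v , i) → v , fromWitness i)
    (λ (v , t) → (v , toWitness t) , cong (v ,_) (T-irrelevant _ _))
    (λ a b e → cong proj₁ e) (λ { (v , i) (.v , j) refl → cong (v ,_) (T-irrelevant _ _) })
    (fin-count (λ v → ⌊ isolated? v ⌋))

  neighbour : ∀ v → ¬ Isolated G v → ∃ λ w → Edge G v w
  neighbour v n with Fₚ.any? (λ w → T? (adj G v w))
  ... | yes e = e
  ... | no none = contradiction (λ w → Boolₚ.¬-not {adj G v w} {true} (λ e → none (w , subst T (sym e) tt))) n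

  point : FaceCarrier G → Fin (n G)
  point (inj₁ f) = vertex f
  point (inj₂ w) = proj₁ w

  point-onto : ∀ v → ∃ λ p → point p ≡ v
  point-onto v with isolated? v
  ... | yes i = inj₂ (v , i) , refl
  ... | no ni = let w , e = neighbour v ni in inj₁ ((v , w , e) , true) , refl

  edgeList : List (Fin (n G) × Fin (n G))
  edgeList = map (λ d → proj₁ d , proj₁ (proj₂ d)) (enum fin-Dart)

  module V = Classes (fin-Fin (n G))

  components : ℕ
  components = V.cls edgeList

  edge-sym : ∀ {a b} → Edge G a b → Edge G b a
  edge-sym {a} {b} = subst T (adj-sym G a b)

  star-equiv : IsEquiv (Star (Edge G))
  star-equiv = record { erefl = ε ; esym = s ; etrans = _◅◅_ }
    where
    s : ∀ {a b} → Star (Edge G) a b → Star (Edge G) b a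
    s ε = ε
    s (e ◅ p) = s p ◅◅ (edge-sym e ◅ ε)

  star⇒conn : ∀ {a b} → Star (Edge G) a b → Conn edgeList a b
  star⇒conn ε = crefl
  star⇒conn (e ◅ p) = ctrans (edge (∈-map⁺ _ (∈-enum fin-Dart (_ , _ , e)))) (star⇒conn p)

  conn⇒star : ∀ {a b} → Conn edgeList a b → Star (Edge G) a b
  conn⇒star = conn-fold star-equiv λ m → case ∈-map⁻ _ m of λ { ((u , v , e) , _ , refl) → e ◅ ε }

  nc-components : NumComponents G components
  nc-components = nc-pull id (λ b → b , crefl) (λ _ _ → conn⇒star) (λ _ _ → star⇒conn) (V.nc-cls edgeList)

  star-isolated : ∀ {a b} → Isolated G a → Star (Edge G) a b → a ≡ b
  star-isolated i ε = refl
  star-isolated {a} i (_◅_ {j = j} e p) = ⊥-elim (subst T (i j) e)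

  isolated-vertex : ∀ φ → ¬ Isolated G (vertex φ)
  isolated-vertex ((u , v , e) , s) i = subst T (i v) e

  module _ (R : Rot) where
    open Rot R

    vertices-count : C.βc list + isolates ≡ n G
    vertices-count = nc-unique {R = Sum (Conn (list ++ C.Eβ.pairs)) SameIsolated} {S = _≡_} point point-onto reflects preserves
        (nc-sum (C.nc-cls (list ++ C.Eβ.pairs)) nc-isolates) (fin-Fin (n G))
      where
      reflects : ∀ a b → point a ≡ point b → Sum _ SameIsolated a b
      reflects (inj₁ a) (inj₁ b) e = transitive a b e
      reflects (inj₂ a) (inj₂ b) e = e
      reflects (inj₁ a) (inj₂ b) e = isolated-vertex a (subst (Isolated G) (sym e) (proj₂ b))
      reflects (inj₂ a) (inj₁ b) e = isolated-vertex b (subst (Isolated G) e (proj₂ a))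
      preserves : ∀ a b → Sum _ SameIsolated a b → point a ≡ point b
      preserves (inj₁ a) (inj₁ b) c = C.Eβ.conn-base list (≡-equiv vertex) (λ m → All.lookup level m) (λ _ → refl) c
      preserves (inj₂ a) (inj₂ b) e = e

    components-count : C.γc list + isolates ≡ components
    components-count = nc-unique {R = Sum (Conn (list ++ C.γ)) SameIsolated} {S = Star (Edge G)} point
        (λ v → proj₁ (point-onto v) , ≡⇒star (proj₂ (point-onto v))) reflects preserves
        (nc-sum (C.nc-cls (list ++ C.γ)) nc-isolates) nc-components
      where
      ≡⇒star : ∀ {a b} → a ≡ b → Star (Edge G) a b
      ≡⇒star refl = ε
      walk : ∀ {a b} → Star (Edge G) a b → ∀ φ ψ → vertex φ ≡ a → vertex ψ ≡ b → Conn (list ++ C.γ) φ ψ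
      walk ε φ ψ p q = C.β⊆γ list (transitive φ ψ (trans p (sym q)))
      walk {a} (_◅_ {j = j} e s) φ ψ p q = ctrans (C.β⊆γ list (transitive φ χ p))
        (ctrans (C.α⊆γ list (C.Eα.pair-conn list χ)) (walk s (FPI.fun αF χ) ψ refl q))
        where χ = (a , j , e) , true
      reflects : ∀ a b → Star (Edge G) (point a) (point b) → Sum _ SameIsolated a b
      reflects (inj₁ a) (inj₁ b) s = walk s a b refl refl
      reflects (inj₂ a) (inj₂ b) s = star-isolated (proj₂ a) s
      reflects (inj₁ a) (inj₂ b) s = isolated-vertex a (subst (Isolated G) (star-isolated (proj₂ b) (esym star-equiv s)) (proj₂ b))
      reflects (inj₂ a) (inj₁ b) s = isolated-vertex b (subst (Isolated G) (star-isolated (proj₂ a) s) (proj₂ a))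
      preserves : ∀ a b → Sum _ SameIsolated a b → Star (Edge G) (point a) (point b)
      preserves (inj₂ a) (inj₂ b) e = ≡⇒star e
      preserves (inj₁ a) (inj₁ b) = conn-fold (pull-equiv vertex star-equiv) λ m → case ∈-++⁻ list m of λ
        { (inj₁ k) → ≡⇒star (All.lookup level k)
        ; (inj₂ k) → case ∈-++⁻ C.Eα.pairs k of λ
          { (inj₁ j) → case ∈-map⁻ _ j of λ { (((u , v , e) , s) , _ , refl) → e ◅ ε }
          ; (inj₂ j) → case ∈-map⁻ _ j of λ { (((u , v , e) , s) , _ , refl) → ε } } }

  side-conn : ∀ d s s' → Conn C.γ (d , s) (d , s')
  side-conn d true true = crefl
  side-conn d false false = crefl
  side-conn d true false = C.β⊆γ [] (C.Eβ.pair-conn [] (d , true))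
  side-conn d false true = C.β⊆γ [] (C.Eβ.pair-conn [] (d , false))

  edges-γ : C.γc [] ≡ numEdges G
  edges-γ = nc-unique {R = Conn C.γ} {S = Undirected} proj₁ (λ d → (d , true) , inj₁ refl) reflects
      (λ _ _ → conn-fold (pull-equiv proj₁ undirected-equiv) λ m → case ∈-++⁻ C.Eα.pairs m of λ
        { (inj₁ k) → case ∈-map⁻ _ k of λ { (_ , _ , refl) → inj₂ refl }
        ; (inj₂ k) → case ∈-map⁻ _ k of λ { (_ , _ , refl) → inj₁ refl } })
      (C.nc-cls C.γ) nc-edges
    where
    reflects : ∀ a b → Undirected (proj₁ a) (proj₁ b) → Conn C.γ a b
    reflects (d , s) (.d , s') (inj₁ refl) = side-conn d s s'
    reflects (d , s) (.(rev G d) , s') (inj₂ refl) = ctrans (C.α⊆γ [] (C.Eα.pair-conn [] (d , s))) (side-conn (rev G d) s s')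

  -- `α` keeps the label of the side, so an edge gives one class for each of its two sides.
  edges-α : C.αc [] ≡ numEdges G + numEdges G
  edges-α = nc-unique {R = Conn C.Eα.pairs} {S = Sum Undirected Undirected} byside onto reflects
      (λ _ _ → C.Eα.conn-base [] (pull-equiv byside eqv) (λ ()) λ { (d , true) → inj₂ refl ; (d , false) → inj₂ refl })
      (C.nc-cls C.Eα.pairs) (nc-sum nc-edges nc-edges)
    where
    byside : Flag G → Dart G ⊎ Dart G
    byside (d , true) = inj₁ d
    byside (d , false) = inj₂ d
    eqv : IsEquiv (Sum Undirected Undirected)
    eqv = sum-equiv undirected-equiv undirected-equiv
    onto : ∀ b → ∃ λ a → Sum Undirected Undirected (byside a) b
    onto (inj₁ d) = (d , true) , inj₁ refl
    onto (inj₂ d) = (d , false) , inj₁ refl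
    same : ∀ d d' s → Undirected d d' → Conn C.Eα.pairs (d , s) (d' , s)
    same d .d s (inj₁ refl) = crefl
    same d .(rev G d) s (inj₂ refl) = C.Eα.pair-conn [] (d , s)
    reflects : ∀ a b → Sum Undirected Undirected (byside a) (byside b) → Conn C.Eα.pairs a b
    reflects (d , true) (d' , true) q = same d d' true q
    reflects (d , false) (d' , false) q = same d d' false q

  -- What makes truncated subtraction exact when the genus of a part is read off from its rotation.
  euler-genus-nonneg : (R : Rot) → n G + (C.αc (Rot.list R) + isolates) ≤ 2 * components + numEdges G
  euler-genus-nonneg R = ℕₚ.+-cancelʳ-≤ (numEdges G) _ _ (subst₂ _≤_
      (trans (solve 4 (λ a b e i → (a :+ b :+ e) :+ (i :+ i) := (b :+ i) :+ (a :+ i) :+ e) refl (C.αc list) (C.βc list) (numEdges G) isolates)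
        (cong (λ z → z + (C.αc list + isolates) + numEdges G) (vertices-count R)))
      (trans (solve 3 (λ e c i → (e :+ e :+ (c :+ c)) :+ (i :+ i) := con 2 :* (c :+ i) :+ e :+ e) refl (numEdges G) (C.γc list) isolates)
        (cong (λ z → 2 * z + numEdges G + numEdges G) (components-count R)))
      (ℕₚ.+-monoˡ-≤ (isolates + isolates) (subst₂ (λ p q → C.αc list + C.βc list + p ≤ q + (C.γc list + C.γc list)) edges-γ edges-α
        (C.euler (C.αc []) list (ℕₚ.m≤n+m _ _) perfect))))
    where
    open Rot R
    open +-*-Solver

  -- From embedding schemes to matchings of flags

  module _ (S : Scheme G) (h : Dart G → Bool)
    (untwist : ∀ d → twisted S (proj₁ d) (proj₁ (proj₂ d)) ≡ not (h d xor h (rev G d))) where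

    -- Shifts the labels of the sides of each dart by `h`, under which `α₀` with its signature
    -- becomes `αF`.
    relabel : Flag G → Flag G
    relabel (d , s) = d , s xor h d

    xor-twice : ∀ a b → (a xor b) xor b ≡ a
    xor-twice true true = refl
    xor-twice true false = refl
    xor-twice false true = refl
    xor-twice false false = refl

    relabel-inv : ∀ φ → relabel (relabel φ) ≡ φ
    relabel-inv (d , s) = cong (d ,_) (xor-twice s (h d))

    α₁-inv : ∀ φ → α₁ S (α₁ S φ) ≡ φ
    α₁-inv (d , true) = cong (_, true) (ρ⁻ρ S d)
    α₁-inv (d , false) = cong (_, false) (ρρ⁻ S d)

    turn : Flag G → Flag G
    turn = relabel ∘ α₁ S ∘ relabel

    turn-inv : ∀ φ → turn (turn φ) ≡ φ
    turn-inv φ = trans (cong (relabel ∘ α₁ S) (relabel-inv (α₁ S (relabel φ)))) (trans (cong relabel (α₁-inv (relabel φ))) (relabel-inv φ))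

    α₀-relabel : ∀ φ → relabel (α₀ S φ) ≡ FPI.fun αF (relabel φ)
    α₀-relabel (d@(u , v , e) , s) rewrite untwist d = cong (rev G d ,_) (lem s (h d) (h (rev G d)))
      where
      lem : ∀ s a b → (if not (a xor b) then s else not s) xor b ≡ s xor a
      lem true true true = refl
      lem true true false = refl
      lem true false true = refl
      lem true false false = refl
      lem false true true = refl
      lem false true false = refl
      lem false false true = refl
      lem false false false = refl

    α₀-inv : ∀ φ → α₀ S (α₀ S φ) ≡ φ
    α₀-inv φ = trans (sym (relabel-inv (α₀ S (α₀ S φ)))) (trans (cong relabel (trans (α₀-relabel (α₀ S φ))
      (trans (cong (FPI.fun αF) (α₀-relabel φ)) (FPI.inv αF (relabel φ))))) (relabel-inv φ))

    steps-equiv : IsEquiv (Star (FlagStep S))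
    steps-equiv = record { erefl = ε ; esym = s ; etrans = _◅◅_ }
      where
      s : ∀ {a b} → Star (FlagStep S) a b → Star (FlagStep S) b a
      s ε = ε
      s {a} (inj₁ refl ◅ p) = s p ◅◅ (inj₁ (sym (α₀-inv a)) ◅ ε)
      s {a} (inj₂ refl ◅ p) = s p ◅◅ (inj₂ (sym (α₁-inv a)) ◅ ε)

    nc-faces : ∀ L → C.Perfect L → AllP (λ a b → b ≡ turn a) L → NumFaces S (C.αc L + isolates)
    nc-faces L pf al = nc-pull h' onto reflects preserves (nc-sum (C.nc-cls (L ++ C.Eα.pairs)) nc-isolates)
      where
      h' : FaceCarrier G → Flag G ⊎ Σ (Fin (n G)) (Isolated G)
      h' (inj₁ f) = inj₁ (relabel f)
      h' (inj₂ w) = inj₂ w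
      onto : ∀ b → ∃ λ a → Sum (Conn (L ++ C.Eα.pairs)) SameIsolated (h' a) b
      onto (inj₁ f) = inj₁ (relabel f) , ≡⇒conn (relabel-inv f)
      onto (inj₂ w) = inj₂ w , refl
      turned : ∀ a → Conn (L ++ C.Eα.pairs) a (turn a)
      turned a = subst (Conn _ a) (All.head (Pick.all p (λ {a} {b} e → trans (sym (turn-inv a)) (cong turn (sym e))) al))
          (Pick.conn⁻ p {C.Eα.pairs} (edge (here refl)))
        where p = pick L (proj₂ pf a)
      fwd : ∀ {a b} → Star (FlagStep S) a b → Conn (L ++ C.Eα.pairs) (relabel a) (relabel b)
      fwd ε = crefl
      fwd {a} (inj₁ refl ◅ p) = ctrans (subst (Conn _ (relabel a)) (sym (α₀-relabel a)) (C.Eα.pair-conn L (relabel a))) (fwd p)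
      fwd {a} (inj₂ refl ◅ p) = ctrans (subst (Conn _ (relabel a)) (cong (relabel ∘ α₁ S) (relabel-inv a)) (turned (relabel a))) (fwd p)
      bwd : ∀ {a b} → Conn (L ++ C.Eα.pairs) a b → Star (FlagStep S) (relabel a) (relabel b)
      bwd = C.Eα.conn-base L (pull-equiv relabel steps-equiv)
        (λ {a} {b} m → inj₂ (trans (cong relabel (All.lookup al m)) (relabel-inv (α₁ S (relabel a)))) ◅ ε)
        (λ a → inj₁ (trans (cong (relabel ∘ FPI.fun αF) (sym (relabel-inv a))) (trans (cong relabel (sym (α₀-relabel (relabel a)))) (relabel-inv (α₀ S (relabel a))))) ◅ ε)
      reflects : ∀ a b → Sum _ SameIsolated (h' a) (h' b) → SameFace S a b
      reflects (inj₁ a) (inj₁ b) c = subst₂ (Star (FlagStep S)) (relabel-inv a) (relabel-inv b) (bwd c)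
      reflects (inj₂ a) (inj₂ b) e = e
      preserves : ∀ a b → SameFace S a b → Sum (Conn (L ++ C.Eα.pairs)) SameIsolated (h' a) (h' b)
      preserves (inj₁ a) (inj₁ b) p = fwd p
      preserves (inj₂ a) (inj₂ b) e = e

    conn-side : ∀ L d s s' → Conn (L ++ C.Eβ.pairs) (d , s) (d , s')
    conn-side L d true true = crefl
    conn-side L d false false = crefl
    conn-side L d true false = C.Eβ.pair-conn L (d , true)
    conn-side L d false true = C.Eβ.pair-conn L (d , false)

    scheme⇒rot : Σ Rot λ R → NumFaces S (C.αc (Rot.list R) + isolates)
    scheme⇒rot = record { list = L ; perfect = pf ; level = All.map (λ {p} e → trans (sym (turn-vertex (proj₁ p))) (cong vertex (sym e))) al ; transitive = tr } , nc-faces L pf al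
      where
      turn-vertex : ∀ φ → vertex (turn φ) ≡ vertex φ
      turn-vertex (d , s) with s xor h d
      ... | true = ρ-tail S d
      ... | false = trans (sym (ρ-tail S (ρ⁻ S d))) (cong proj₁ (ρρ⁻ S d))
      α₁-≢ : ∀ φ → α₁ S φ ≢ φ
      α₁-≢ (d , true) ()
      α₁-≢ (d , false) ()
      P = Partner.pairing fF (record { fun = turn ; inv = turn-inv ; fpf = λ φ e → α₁-≢ (relabel φ) (trans (sym (relabel-inv (α₁ S (relabel φ)))) (cong relabel e)) })
      L = proj₁ P
      pf = proj₁ (proj₂ P)
      al = proj₂ (proj₂ P)
      turned : ∀ a → Conn (L ++ C.Eβ.pairs) a (turn a)
      turned a = subst (Conn _ a) (All.head (Pick.all p (λ {a} {b} e → trans (sym (turn-inv a)) (cong turn (sym e))) al))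
          (Pick.conn⁻ p {C.Eβ.pairs} (edge (here refl)))
        where p = pick L (proj₂ pf a)
      around : ∀ d → Conn (L ++ C.Eβ.pairs) (d , true) (ρ S d , true)
      around d = ctrans (conn-side L d true (true xor h d)) (ctrans (turned (d , true xor h d))
        (ctrans (≡⇒conn (cong (relabel ∘ α₁ S) (relabel-inv (d , true)))) (conn-side L (ρ S d) (h (ρ S d)) true)))
      arounds : ∀ m d → Conn (L ++ C.Eβ.pairs) (d , true) (iter (ρ S) m d , true)
      arounds zero d = crefl
      arounds (suc m) d = ctrans (arounds m d) (around (iter (ρ S) m d))
      tr : M.Transitive L
      tr (d , s) (d' , s') e with ρ-cyclic S d d' e
      ... | m , refl = ctrans (conn-side L d s true) (ctrans (arounds m d) (conn-side L d' true s'))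

  -- One dart of each edge absorbs the whole signature: the dart from the smaller to the larger
  -- vertex keeps its labels, and the reverse dart is shifted by the negated signature.
  untwisting : (S : Scheme G) → ∃ λ (h : Dart G → Bool) → ∀ d → twisted S (proj₁ d) (proj₁ (proj₂ d)) ≡ not (h d xor h (rev G d))
  untwisting S = h , λ d → lem d
    where
    ahead : Dart G → Bool
    ahead (u , v , _) = ⌊ toℕ u ℕₚ.<? toℕ v ⌋
    h : Dart G → Bool
    h d@(u , v , _) = not (ahead d ∨ twisted S u v)
    lem : ∀ d → twisted S (proj₁ d) (proj₁ (proj₂ d)) ≡ not (h d xor h (rev G d))
    lem d@(u , v , e) rewrite twisted-sym S v u with toℕ u ℕₚ.<? toℕ v | toℕ v ℕₚ.<? toℕ u | twisted S u v
    ... | yes p | yes q | _ = contradiction q (ℕₚ.<⇒≯ p)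
    ... | yes p | no q | true = refl
    ... | yes p | no q | false = refl
    ... | no p | yes q | true = refl
    ... | no p | yes q | false = refl
    ... | no p | no q | _ = contradiction (ℕₚ.≤-antisym (ℕₚ.≮⇒≥ q) (ℕₚ.≮⇒≥ p))
        (λ z → rev-≢ d (dart-≡ (sym (Fₚ.toℕ-injective z)) (Fₚ.toℕ-injective z)))

  -- From matchings of flags back to embedding schemes

  module FromRot (R : Rot) where
    open Rot R
    open Partner fF
    N : Flag G → Flag G
    N = partner list
    N-inv = partner-inv list perfect
    K = Colouring.two-colouring fF βF proj₂ (λ _ → refl) list (proj₁ perfect)
    open Colouring.Colour K
    -- The side of a dart that is coloured `true`. The matching joins opposite colours, so leaving
    -- each dart by this side defines a permutation of the darts, which serves as the rotation.
    o : Dart G → Bool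
    o d = col (d , true)
    col-o : ∀ d s → col (d , s) ≡ not (s xor o d)
    col-o d true = sym (Boolₚ.not-involutive _)
    col-o d false = flip-β (d , true)
    N-col : ∀ φ → col (N φ) ≡ not (col φ)
    N-col = partner-rel {λ a b → col b ≡ not (col a)} list perfect (λ {a} {b} e → trans (sym (Boolₚ.not-involutive _)) (cong not (sym e)))
      (All.map (λ {p} e → trans (sym (Boolₚ.not-involutive _)) (cong not (sym e))) flip-L)
    N-tail : ∀ φ → vertex φ ≡ vertex (N φ)
    N-tail = partner-rel {λ a b → vertex a ≡ vertex b} list perfect sym level
    side-of : ∀ d s b → not (s xor o d) ≡ b → s ≡ (if b then o d else not (o d))
    side-of d s b refl with s | o d
    ... | true | true = refl
    ... | true | false = refl
    ... | false | true = refl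
    ... | false | false = refl
    side-neg : ∀ φ → col φ ≡ false → φ ≡ (proj₁ φ , not (o (proj₁ φ)))
    side-neg (d , s) e = cong (d ,_) (side-of d s false (trans (sym (col-o d s)) e))
    side-pos : ∀ φ → col φ ≡ true → φ ≡ (proj₁ φ , o (proj₁ φ))
    side-pos (d , s) e = cong (d ,_) (side-of d s true (trans (sym (col-o d s)) e))
    col-pos : ∀ d → col (d , o d) ≡ true
    col-pos d = trans (col-o d (o d)) (cong not (Boolₚ.xor-same (o d)))
    col-neg : ∀ d → col (d , not (o d)) ≡ false
    col-neg d = trans (flip-β (d , o d)) (cong not (col-pos d))
    next prev : Dart G → Dart G
    next d = proj₁ (N (d , o d))
    prev d = proj₁ (N (d , not (o d)))
    N-pos : ∀ d → N (d , o d) ≡ (next d , not (o (next d)))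
    N-pos d = side-neg _ (trans (N-col _) (cong not (col-pos d)))
    N-neg : ∀ d → N (d , not (o d)) ≡ (prev d , o (prev d))
    N-neg d = side-pos _ (trans (N-col _) (cong not (col-neg d)))
    next-prev : ∀ d → next (prev d) ≡ d
    next-prev d = cong proj₁ (trans (cong N (sym (N-neg d))) (N-inv _))
    prev-next : ∀ d → prev (next d) ≡ d
    prev-next d = cong proj₁ (trans (cong N (sym (N-pos d))) (N-inv _))
    open Orbits fin-Dart next (λ a b e → trans (sym (prev-next a)) (trans (cong prev e) (prev-next b)))
    reach-N : ∀ φ → Reach (proj₁ φ) (proj₁ (N φ))
    reach-N (d , s) with col (d , s) in eq
    ... | true = 1 , cong (proj₁ ∘ N) (sym (side-pos (d , s) eq))
    ... | false = subst (Reach d) (cong (proj₁ ∘ N) (sym (side-neg (d , s) eq))) (reach-sym (1 , next-prev d))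
    reach : ∀ {φ ψ} → Conn (list ++ C.Eβ.pairs) φ ψ → Reach (proj₁ φ) (proj₁ ψ)
    reach = C.Eβ.conn-base list (pull-equiv proj₁ reach-equiv)
      (λ {a} m → subst (λ z → Reach (proj₁ a) (proj₁ z)) (proj₁ (partner-∈ list (proj₁ perfect) m)) (reach-N a)) (λ _ → 0 , refl)
    h : Dart G → Bool
    h d = not (o d)
    hh : Fin (n G) → Fin (n G) → Bool
    hh u v with T? (adj G u v)
    ... | yes e = h (u , v , e)
    -- A signature has to be given for all pairs of vertices; the value at non-adjacent ones is
    -- arbitrary.
    ... | no _ = false
    hh≡h : ∀ d → hh (proj₁ d) (proj₁ (proj₂ d)) ≡ h d
    hh≡h (u , v , e) with T? (adj G u v)
    ... | yes e' = cong h (dart-≡ refl refl)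
    ... | no ne = contradiction e ne
    S : Scheme G
    S = record
      { ρ = next ; ρ⁻ = prev ; ρ-tail = λ d → sym (N-tail (d , o d)) ; ρρ⁻ = next-prev ; ρ⁻ρ = prev-next
      ; ρ-cyclic = λ d d' e → reach (transitive (d , true) (d' , true) e)
      ; twisted = λ u v → not (hh u v xor hh v u)
      ; twisted-sym = λ u v → cong not (Boolₚ.xor-comm (hh u v) (hh v u)) }
    untwist : ∀ d → twisted S (proj₁ d) (proj₁ (proj₂ d)) ≡ not (h d xor h (rev G d))
    untwist d = cong₂ (λ a b → not (a xor b)) (hh≡h d) (hh≡h (rev G d))
    turn≡N : ∀ φ → N φ ≡ turn S h untwist φ
    turn≡N (d , s) with s xor h d in eq
    ... | true = trans (cong N (cong (d ,_) (lem s (o d) eq))) (N-pos d)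
      where
      lem : ∀ s o → s xor not o ≡ true → s ≡ o
      lem true true _ = refl
      lem false false _ = refl
    ... | false = trans (cong N (cong (d ,_) (lem s (o d) eq))) (trans (N-neg d) (cong (prev d ,_) (sym (Boolₚ.not-involutive _))))
      where
      lem : ∀ s o → s xor not o ≡ false → s ≡ not o
      lem true false _ = refl
      lem false true _ = refl
    nf : NumFaces S (C.αc list + isolates)
    nf = nc-faces S h untwist list perfect (All.tabulate λ {p} m → trans (sym (proj₁ (partner-∈ list (proj₁ perfect) m))) (turn≡N (proj₁ p)))

  -- The scheme determines the numbers of components and faces that an embedding carries, so the
  -- computed ones can replace them.
  embeds⇒rot : ∀ g → EmbedsIn G g → Σ Rot λ R → 2 * components + numEdges G ≤ n G + (C.αc (Rot.list R) + isolates) + g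
  embeds⇒rot g (S , c , f , nc , nf , le) = proj₁ SR , subst₂ (λ c f → 2 * c + numEdges G ≤ n G + f + g)
      (nc-unique {S = Star (Edge G)} id (λ b → b , ε) (λ _ _ → id) (λ _ _ → id) nc nc-components)
      (nc-unique {S = SameFace S} id (λ b → b , face-refl b) (λ _ _ → id) (λ _ _ → id) nf (proj₂ SR)) le
    where
    SR = scheme⇒rot S (proj₁ (untwisting S)) (proj₂ (untwisting S))
    face-refl : ∀ b → SameFace S b b
    face-refl (inj₁ _) = ε
    face-refl (inj₂ _) = refl

  rot⇒embeds : ∀ g (R : Rot) → 2 * components + numEdges G ≤ n G + (C.αc (Rot.list R) + isolates) + g → EmbedsIn G g
  rot⇒embeds g R le = FromRot.S R , components , _ , nc-components , FromRot.nf R , le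

  trivial-pairing : Σ (List (Flag G × Flag G)) λ L → C.Perfect L × AllP (λ a b → b ≡ FPI.fun βF a) L
  trivial-pairing = Partner.pairing fF βF

  trivial-level : AllP (λ a b → vertex a ≡ vertex b) (proj₁ trivial-pairing)
  trivial-level = All.map (λ {p} e → cong vertex {x = FPI.fun βF (proj₁ p)} {y = proj₂ p} (sym e)) (proj₂ (proj₂ trivial-pairing))

  trivial-merged : M.Merged (proj₁ trivial-pairing)
  trivial-merged = M.merge-vertices (proj₁ trivial-pairing) (proj₁ (proj₂ trivial-pairing)) trivial-level

  -- Matching the two flags of each dart with each other makes every dart a vertex of its own;
  -- merging these yields some rotation system, of whatever genus.
  rot-exists : Rot
  rot-exists = record { list = M.Merged.list R ; perfect = M.Merged.perfect R ; level = M.Merged.level R ; transitive = M.Merged.transitive R }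
    where R = trivial-merged

-- Edge amalgamations

-- In contrast to an xy-sum, both parts contain the edge xy, and it is one edge of `P`. A sum
-- becomes an amalgamation when xy is added to all three graphs.
record Amalg (P A B : Graph) : Set where
  field
    φA : Fin (n A) → Fin (n P)
    φB : Fin (n B) → Fin (n P)
    φA-inj : ∀ a b → φA a ≡ φA b → a ≡ b
    φB-inj : ∀ a b → φB a ≡ φB b → a ≡ b
    φA-x : φA (x A) ≡ x P
    φA-y : φA (y A) ≡ y P
    φB-x : φB (x B) ≡ x P
    φB-y : φB (y B) ≡ y P
    cover : ∀ w → (∃ λ a → φA a ≡ w) ⊎ (∃ λ b → φB b ≡ w)
    shared : ∀ a b → φA a ≡ φB b → φA a ≡ x P ⊎ φA a ≡ y P
    edgeA : ∀ {a b} → Edge A a b → Edge P (φA a) (φA b)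
    edgeB : ∀ {a b} → Edge B a b → Edge P (φB a) (φB b)
    edges : ∀ {p q} → Edge P p q →
      (∃ λ a → ∃ λ b → φA a ≡ p × φA b ≡ q × Edge A a b) ⊎ (∃ λ a → ∃ λ b → φB a ≡ p × φB b ≡ q × Edge B a b)
    xyA : Edge A (x A) (y A)
    xyB : Edge B (x B) (y B)

module Terminal (G : Graph) (xy : Edge G (x G) (y G)) where
  eD : Bool → Dart G
  eD true = x G , y G , xy
  eD false = rev G (x G , y G , xy)

  Spec : Dart G → Set
  Spec d = ∃ λ z → d ≡ eD z

  spec? : ∀ d → Dec (Spec d)
  spec? d with fin-≟ (fin-Dart G) d (eD true) | fin-≟ (fin-Dart G) d (eD false)
  ... | yes e | _ = yes (true , e)
  ... | no _ | yes e = yes (false , e)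
  ... | no n | no n' = no λ { (true , e) → n e ; (false , e) → n' e }

  rev-eD : ∀ z → rev G (eD z) ≡ eD (not z)
  rev-eD true = refl
  rev-eD false = rev-rev G (eD true)

  spec-rev : ∀ {d} → Spec d → Spec (rev G d)
  spec-rev (z , e) = not z , trans (cong (rev G) e) (rev-eD z)

  spec-rev⁻ : ∀ {d} → Spec (rev G d) → Spec d
  spec-rev⁻ s = subst Spec (rev-rev G _) (spec-rev s)

  eD-inj : ∀ {z z'} → eD z ≡ eD z' → z ≡ z'
  eD-inj {true} {true} _ = refl
  eD-inj {false} {false} _ = refl
  eD-inj {true} {false} e = contradiction (cong proj₁ e) (x≢y G)
  eD-inj {false} {true} e = contradiction (sym (cong proj₁ e)) (x≢y G)

module Glue {P A B : Graph} (am : Amalg P A B) where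
  open Amalg am
  xyP : Edge P (x P) (y P)
  xyP = subst₂ (Edge P) φA-x φA-y (edgeA xyA)
  module TA = Terminal A xyA
  module TB = Terminal B xyB
  module TP = Terminal P xyP

  gA : Dart A → Dart P
  gA (a , b , e) = φA a , φA b , edgeA e
  gB : Dart B → Dart P
  gB (a , b , e) = φB a , φB b , edgeB e

  gA-rev : ∀ d → gA (rev A d) ≡ rev P (gA d)
  gA-rev d = dart-≡ P refl refl
  gB-rev : ∀ d → gB (rev B d) ≡ rev P (gB d)
  gB-rev d = dart-≡ P refl refl

  gA-inj : ∀ {d d'} → gA d ≡ gA d' → d ≡ d'
  gA-inj e = dart-≡ A (φA-inj _ _ (cong proj₁ e)) (φA-inj _ _ (cong (proj₁ ∘ proj₂) e))
  gB-inj : ∀ {d d'} → gB d ≡ gB d' → d ≡ d'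
  gB-inj e = dart-≡ B (φB-inj _ _ (cong proj₁ e)) (φB-inj _ _ (cong (proj₁ ∘ proj₂) e))

  gA-eD : ∀ z → gA (TA.eD z) ≡ TP.eD z
  gA-eD true = dart-≡ P φA-x φA-y
  gA-eD false = dart-≡ P φA-y φA-x
  gB-eD : ∀ z → gB (TB.eD z) ≡ TP.eD z
  gB-eD true = dart-≡ P φB-x φB-y
  gB-eD false = dart-≡ P φB-y φB-x

  common : ∀ {a b} → φA a ≡ φB b → (a ≡ x A × b ≡ x B) ⊎ (a ≡ y A × b ≡ y B)
  common {a} {b} e with shared a b e
  ... | inj₁ q = inj₁ (φA-inj _ _ (trans q (sym φA-x)) , φB-inj _ _ (trans (sym e) (trans q (sym φB-x))))
  ... | inj₂ q = inj₂ (φA-inj _ _ (trans q (sym φA-y)) , φB-inj _ _ (trans (sym e) (trans q (sym φB-y))))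

  cross : ∀ {d d'} → gA d ≡ gB d' → ∃ λ z → d ≡ TA.eD z × d' ≡ TB.eD z
  cross {a , b , e} {a' , b' , e'} q with common {a} {a'} (cong proj₁ q) | common {b} {b'} (cong (proj₁ ∘ proj₂) q)
  ... | inj₁ (refl , refl) | inj₂ (refl , refl) = true , dart-≡ A refl refl , dart-≡ B refl refl
  ... | inj₂ (refl , refl) | inj₁ (refl , refl) = false , dart-≡ A refl refl , dart-≡ B refl refl
  ... | inj₁ (refl , refl) | inj₁ (refl , refl) = ⊥-elim (subst T (adj-irr A _) e)
  ... | inj₂ (refl , refl) | inj₂ (refl , refl) = ⊥-elim (subst T (adj-irr A _) e)

  Φ : Set
  Φ = Flag A ⊎ Flag B

  fΦ : Finite Φ _
  fΦ = fin-sum (fF A) (fF B)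

  sum-FPI : FPI (Flag A) → FPI (Flag B) → FPI Φ
  sum-FPI f g = record { fun = fun ; inv = inv ; fpf = fpf }
    where
    fun : Φ → Φ
    fun (inj₁ a) = inj₁ (FPI.fun f a)
    fun (inj₂ b) = inj₂ (FPI.fun g b)
    inv : ∀ a → fun (fun a) ≡ a
    inv (inj₁ a) = cong inj₁ (FPI.inv f a)
    inv (inj₂ b) = cong inj₂ (FPI.inv g b)
    fpf : ∀ a → fun a ≢ a
    fpf (inj₁ a) e = FPI.fpf f a (inj₁-injective e)
    fpf (inj₂ b) e = FPI.fpf g b (inj₂-injective e)

  αΦ βΦ : FPI Φ
  αΦ = sum-FPI (αF A) (αF B)
  βΦ = sum-FPI (βF A) (βF B)

  open Counts₂ fΦ αΦ βΦ
  module CA = C A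
  module CB = C B
  module CP = C P

  side : Φ → Bool
  side (inj₁ _) = true
  side (inj₂ _) = false

  gvertex : Φ → Fin (n P)
  gvertex (inj₁ a) = φA (vertex A a)
  gvertex (inj₂ b) = φB (vertex B b)

  α-side : ∀ a → side (FPI.fun αΦ a) ≡ side a
  α-side (inj₁ a) = refl
  α-side (inj₂ b) = refl

  β-side : ∀ a → side (FPI.fun βΦ a) ≡ side a
  β-side (inj₁ a) = refl
  β-side (inj₂ b) = refl

  β-gvertex : ∀ a → gvertex (FPI.fun βΦ a) ≡ gvertex a
  β-gvertex (inj₁ a) = refl
  β-gvertex (inj₂ b) = refl

  -- The terminal edge occurs twice in Φ.  Its two copies bound a digon, whose flags are bigon;
  -- ζ identifies the outer sides of the two copies with the two sides of the terminal edge of P.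
  bigon : Bool → Bool → Φ
  bigon true z = inj₁ (TA.eD z , true)
  bigon false z = inj₂ (TB.eD z , true)

  zl : (d : Dart A) → Bool → Dec (TA.Spec d) → Flag P
  zl d s (yes _) = gA d , false
  zl d s (no _) = gA d , s
  zr : (d : Dart B) → Bool → Dec (TB.Spec d) → Flag P
  zr d s (yes _) = gB d , true
  zr d s (no _) = gB d , s

  ζ : Φ → Flag P
  ζ (inj₁ (d , s)) = zl d s (TA.spec? d)
  ζ (inj₂ (d , s)) = zr d s (TB.spec? d)

  NonBig : Φ → Set
  NonBig (inj₁ (d , s)) = TA.Spec d → s ≡ false
  NonBig (inj₂ (d , s)) = TB.Spec d → s ≡ false

  nonbig? : ∀ φ → NonBig φ ⊎ (∃ λ b → ∃ λ z → φ ≡ bigon b z)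
  nonbig? (inj₁ (d , false)) = inj₁ (λ _ → refl)
  nonbig? (inj₂ (d , false)) = inj₁ (λ _ → refl)
  nonbig? (inj₁ (d , true)) with TA.spec? d
  ... | yes (z , e) = inj₂ (true , z , cong (λ d → inj₁ (d , true)) e)
  ... | no n = inj₁ (λ s → contradiction s n)
  nonbig? (inj₂ (d , true)) with TB.spec? d
  ... | yes (z , e) = inj₂ (false , z , cong (λ d → inj₂ (d , true)) e)
  ... | no n = inj₁ (λ s → contradiction s n)

  bigon-big : ∀ b z → ¬ NonBig (bigon b z)
  bigon-big true z nb = case nb (z , refl) of λ ()
  bigon-big false z nb = case nb (z , refl) of λ ()

  ζ-inj : ∀ {φ ψ} → NonBig φ → NonBig ψ → ζ φ ≡ ζ ψ → φ ≡ ψ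
  ζ-inj {inj₁ (d , s)} {inj₁ (d' , s')} p q e with TA.spec? d | TA.spec? d'
  ... | yes c | yes c' = cong₂ (λ d s → inj₁ (d , s)) (gA-inj (cong proj₁ e)) (trans (p c) (sym (q c')))
  ... | no _ | no _ = cong₂ (λ d s → inj₁ (d , s)) (gA-inj (cong proj₁ e)) (cong proj₂ e)
  ... | yes c | no n = contradiction (subst TA.Spec (gA-inj (cong proj₁ e)) c) n
  ... | no n | yes c = contradiction (subst TA.Spec (sym (gA-inj (cong proj₁ e))) c) n
  ζ-inj {inj₂ (d , s)} {inj₂ (d' , s')} p q e with TB.spec? d | TB.spec? d'
  ... | yes c | yes c' = cong₂ (λ d s → inj₂ (d , s)) (gB-inj (cong proj₁ e)) (trans (p c) (sym (q c')))
  ... | no _ | no _ = cong₂ (λ d s → inj₂ (d , s)) (gB-inj (cong proj₁ e)) (cong proj₂ e)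
  ... | yes c | no n = contradiction (subst TB.Spec (gB-inj (cong proj₁ e)) c) n
  ... | no n | yes c = contradiction (subst TB.Spec (sym (gB-inj (cong proj₁ e))) c) n
  ζ-inj {inj₁ (d , s)} {inj₂ (d' , s')} p q e with TA.spec? d | TB.spec? d'
  ... | yes _ | yes _ = case cong proj₂ e of λ ()
  ... | yes _ | no n = let z , _ , r = cross (cong proj₁ e) in contradiction (z , r) n
  ... | no n | _ = let z , r , _ = cross (cong-dart e) in contradiction (z , r) n
    where
    cong-dart : ∀ {c} → (gA d , s) ≡ zr d' s' c → gA d ≡ gB d'
    cong-dart {yes _} e = cong proj₁ e
    cong-dart {no _} e = cong proj₁ e
  ζ-inj {inj₂ (d , s)} {inj₁ (d' , s')} p q e with TB.spec? d | TA.spec? d'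
  ... | yes _ | yes _ = case cong proj₂ e of λ ()
  ... | no n | yes _ = let z , _ , r = cross (sym (cong proj₁ e)) in contradiction (z , r) n
  ... | c | no n = let z , r , _ = cross (sym (cong-dart {c} e)) in contradiction (z , r) n
    where
    cong-dart : ∀ {c} → zr d s c ≡ (gA d' , s') → gB d ≡ gA d'
    cong-dart {yes _} e = cong proj₁ e
    cong-dart {no _} e = cong proj₁ e

  zl-yes : ∀ {d} s → TA.Spec d → ζ (inj₁ (d , s)) ≡ (gA d , false)
  zl-yes {d} s c with TA.spec? d
  ... | yes _ = refl
  ... | no n = contradiction c n
  zl-no : ∀ {d} s → ¬ TA.Spec d → ζ (inj₁ (d , s)) ≡ (gA d , s)
  zl-no {d} s n with TA.spec? d
  ... | yes c = contradiction c n
  ... | no _ = refl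
  zr-yes : ∀ {d} s → TB.Spec d → ζ (inj₂ (d , s)) ≡ (gB d , true)
  zr-yes {d} s c with TB.spec? d
  ... | yes _ = refl
  ... | no n = contradiction c n
  zr-no : ∀ {d} s → ¬ TB.Spec d → ζ (inj₂ (d , s)) ≡ (gB d , s)
  zr-no {d} s n with TB.spec? d
  ... | yes c = contradiction c n
  ... | no _ = refl

  ζ-onto′ : ∀ p → ∃ λ φ → NonBig φ × ζ φ ≡ p
  ζ-onto′ ((p , q , e) , s) with edges e
  ... | inj₁ (a , b , refl , refl , ea) = lem s (TA.spec? (a , b , ea))
    where
    d : Dart A
    d = (a , b , ea)
    gd : gA d ≡ (p , q , e)
    gd = dart-≡ P refl refl
    lem : ∀ s → Dec (TA.Spec d) → ∃ λ φ → NonBig φ × ζ φ ≡ ((p , q , e) , s)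
    lem s (no n) = inj₁ (d , s) , (λ c → contradiction c n) , trans (zl-no s n) (cong (_, s) gd)
    lem false (yes c) = inj₁ (d , false) , (λ _ → refl) , trans (zl-yes false c) (cong (_, false) gd)
    lem true (yes (z , r)) = inj₂ (TB.eD z , false) , (λ _ → refl) ,
      trans (zr-yes false (z , refl)) (cong (_, true) (trans (gB-eD z) (trans (sym (gA-eD z)) (trans (cong gA (sym r)) gd))))
  ... | inj₂ (a , b , refl , refl , eb) = lem s (TB.spec? (a , b , eb))
    where
    d : Dart B
    d = (a , b , eb)
    gd : gB d ≡ (p , q , e)
    gd = dart-≡ P refl refl
    lem : ∀ s → Dec (TB.Spec d) → ∃ λ φ → NonBig φ × ζ φ ≡ ((p , q , e) , s)
    lem s (no n) = inj₂ (d , s) , (λ c → contradiction c n) , trans (zr-no s n) (cong (_, s) gd)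
    lem true (yes c) = inj₂ (d , false) , (λ _ → refl) , trans (zr-yes false c) (cong (_, true) gd)
    lem false (yes (z , r)) = inj₁ (TA.eD z , false) , (λ _ → refl) ,
      trans (zl-yes false (z , refl)) (cong (_, false) (trans (gA-eD z) (trans (sym (gB-eD z)) (trans (cong gB (sym r)) gd))))

  abstract
    ζ-onto : ∀ p → ∃ λ φ → NonBig φ × ζ φ ≡ p
    ζ-onto = ζ-onto′

  κ : Flag P → Φ
  κ p = proj₁ (ζ-onto p)
  κ-nb : ∀ p → NonBig (κ p)
  κ-nb p = proj₁ (proj₂ (ζ-onto p))
  ζκ : ∀ p → ζ (κ p) ≡ p
  ζκ p = proj₂ (proj₂ (ζ-onto p))
  κζ : ∀ φ → NonBig φ → κ (ζ φ) ≡ φ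
  κζ φ nb = ζ-inj {κ (ζ φ)} {φ} (κ-nb (ζ φ)) nb (ζκ (ζ φ))

  α-nb : ∀ {φ} → NonBig φ → NonBig (FPI.fun αΦ φ)
  α-nb {inj₁ (d , s)} nb c = nb (TA.spec-rev⁻ c)
  α-nb {inj₂ (d , s)} nb c = nb (TB.spec-rev⁻ c)

  ζα : ∀ φ → ζ (FPI.fun αΦ φ) ≡ FPI.fun (αF P) (ζ φ)
  ζα (inj₁ (d , s)) = lem (TA.spec? d)
    where
    lem : Dec (TA.Spec d) → ζ (inj₁ (rev A d , s)) ≡ FPI.fun (αF P) (ζ (inj₁ (d , s)))
    lem (yes c) = trans (zl-yes s (TA.spec-rev c)) (trans (cong (_, false) (gA-rev d)) (cong (FPI.fun (αF P)) (sym (zl-yes s c))))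
    lem (no n) = trans (zl-no s (n ∘ TA.spec-rev⁻)) (trans (cong (_, s) (gA-rev d)) (cong (FPI.fun (αF P)) (sym (zl-no s n))))
  ζα (inj₂ (d , s)) = lem (TB.spec? d)
    where
    lem : Dec (TB.Spec d) → ζ (inj₂ (rev B d , s)) ≡ FPI.fun (αF P) (ζ (inj₂ (d , s)))
    lem (yes c) = trans (zr-yes s (TB.spec-rev c)) (trans (cong (_, true) (gB-rev d)) (cong (FPI.fun (αF P)) (sym (zr-yes s c))))
    lem (no n) = trans (zr-no s (n ∘ TB.spec-rev⁻)) (trans (cong (_, s) (gB-rev d)) (cong (FPI.fun (αF P)) (sym (zr-no s n))))

  -- On the copies of the terminal edge `ζ` forgets the side, so there `β` turns into the identity;
  -- elsewhere it is respected.
  ζβ : ∀ φ → ζ (FPI.fun βΦ φ) ≡ ζ φ ⊎ ζ (FPI.fun βΦ φ) ≡ FPI.fun (βF P) (ζ φ)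
  ζβ (inj₁ (d , s)) = lem (TA.spec? d)
    where
    lem : Dec (TA.Spec d) → ζ (inj₁ (d , not s)) ≡ ζ (inj₁ (d , s)) ⊎ ζ (inj₁ (d , not s)) ≡ FPI.fun (βF P) (ζ (inj₁ (d , s)))
    lem (yes c) = inj₁ (trans (zl-yes _ c) (sym (zl-yes s c)))
    lem (no n) = inj₂ (trans (zl-no _ n) (cong (FPI.fun (βF P)) (sym (zl-no s n))))
  ζβ (inj₂ (d , s)) = lem (TB.spec? d)
    where
    lem : Dec (TB.Spec d) → ζ (inj₂ (d , not s)) ≡ ζ (inj₂ (d , s)) ⊎ ζ (inj₂ (d , not s)) ≡ FPI.fun (βF P) (ζ (inj₂ (d , s)))
    lem (yes c) = inj₁ (trans (zr-yes _ c) (sym (zr-yes s c)))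
    lem (no n) = inj₂ (trans (zr-no _ n) (cong (FPI.fun (βF P)) (sym (zr-no s n))))

  ζ-vertex : ∀ φ → vertex P (ζ φ) ≡ gvertex φ
  ζ-vertex (inj₁ (d , s)) with TA.spec? d
  ... | yes _ = refl
  ... | no _ = refl
  ζ-vertex (inj₂ (d , s)) with TB.spec? d
  ... | yes _ = refl
  ... | no _ = refl

  κ-vertex : ∀ p → gvertex (κ p) ≡ vertex P p
  κ-vertex p = trans (sym (ζ-vertex (κ p))) (cong (vertex P) (ζκ p))

  digon : List (Φ × Φ)
  digon = (bigon true true , bigon false true) ∷ (bigon true false , bigon false false) ∷ []

  digon-∈ : ∀ z → (bigon true z , bigon false z) ∈ digon
  digon-∈ true = here refl
  digon-∈ false = there (here refl)

  bigon-∈ : ∀ b z → bigon b z ∈ flat digon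
  bigon-∈ true z = proj₁ (∈-flat (digon-∈ z))
  bigon-∈ false z = proj₂ (∈-flat (digon-∈ z))

  digon-big : ∀ {φ} → φ ∈ flat digon → ¬ NonBig φ
  digon-big (here refl) = bigon-big true true
  digon-big (there (here refl)) = bigon-big false true
  digon-big (there (there (here refl))) = bigon-big true false
  digon-big (there (there (there (here refl)))) = bigon-big false false

  eA-≢ : ∀ {s} → (Φ ∋ inj₁ (TA.eD true , s)) ≢ inj₁ (TA.eD false , s)
  eA-≢ e = case TA.eD-inj {true} {false} (cong proj₁ (inj₁-injective e)) of λ ()
  eB-≢ : ∀ {s} → (Φ ∋ inj₂ (TB.eD true , s)) ≢ inj₂ (TB.eD false , s)
  eB-≢ e = case TB.eD-inj {true} {false} (cong proj₁ (inj₂-injective e)) of λ ()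

  digon-unique : Unique (flat digon)
  digon-unique = ((λ ()) ∷ eA-≢ ∷ (λ ()) ∷ []) ∷ ((λ ()) ∷ eB-≢ ∷ []) ∷ ((λ ()) ∷ []) ∷ [] ∷ []

  both : ∀ {X Y : Set} → (X → Y) → X × X → Y × Y
  both f (a , b) = f a , f b

  flat-map : ∀ {X Y : Set} (f : X → Y) L → flat (map (both f) L) ≡ map f (flat L)
  flat-map f [] = refl
  flat-map f ((u , v) ∷ L) = cong (λ z → f u ∷ f v ∷ z) (flat-map f L)

  module Faces (K : List (Φ × Φ)) (nb : ∀ {φ} → φ ∈ flat K → NonBig φ) where
    LP : List (Flag P × Flag P)
    LP = map (both ζ) K

    κ-edge : ∀ {X : List (Φ × Φ)} {p q} → (p , q) ∈ LP → Conn ((digon ++ K) ++ X) (κ p) (κ q)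
    κ-edge {X} m = case ∈-map⁻ (both ζ) m of λ { ((a , b) , k , refl) →
      subst₂ (Conn _) (sym (κζ a (nb (proj₁ (∈-flat k))))) (sym (κζ b (nb (proj₂ (∈-flat k))))) (edge (∈-++⁺ˡ (∈-++⁺ʳ digon k))) }

    -- The digon is a face of its own, and `ζ` matches the remaining cycles with those of `P`.
    faces : αc (digon ++ K) ≡ CP.αc LP + 1
    faces = nc-unique {R = Conn ((digon ++ K) ++ Eα.pairs)} {S = Sum (Conn (LP ++ CP.Eα.pairs)) (_≡_ {A = ⊤})} h onto reflects preserves
        (nc-cls _) (nc-sum (CP.nc-cls _) fin-⊤)
      where
      h-aux : ∀ φ → (NonBig φ ⊎ (∃ λ b → ∃ λ z → φ ≡ bigon b z)) → Flag P ⊎ ⊤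
      h-aux φ (inj₁ _) = inj₁ (ζ φ)
      h-aux φ (inj₂ _) = inj₂ tt
      h : Φ → Flag P ⊎ ⊤
      h φ = h-aux φ (nonbig? φ)
      h-nb : ∀ {φ} → NonBig φ → h φ ≡ inj₁ (ζ φ)
      h-nb {φ} p with nonbig? φ
      ... | inj₁ _ = refl
      ... | inj₂ (b , z , refl) = contradiction p (bigon-big b z)
      h-big : ∀ b z → h (bigon b z) ≡ inj₂ tt
      h-big b z with nonbig? (bigon b z)
      ... | inj₁ p = contradiction p (bigon-big b z)
      ... | inj₂ _ = refl
      S' : Flag P ⊎ ⊤ → Flag P ⊎ ⊤ → Set
      S' = Sum (Conn (LP ++ CP.Eα.pairs)) (_≡_ {A = ⊤})
      S-eq : IsEquiv S'
      S-eq = sum-equiv (conn-equiv _) (≡-equiv id)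
      onto : ∀ b → ∃ λ a → S' (h a) b
      onto (inj₁ p) = κ p , subst (λ z → S' z (inj₁ p)) (sym (h-nb {κ p} (κ-nb p))) (≡⇒conn (ζκ p))
      onto (inj₂ tt) = bigon true true , subst (λ z → S' z (inj₂ tt)) (sym (h-big true true)) refl
      κ-conn : ∀ {p q} → Conn (LP ++ CP.Eα.pairs) p q → Conn ((digon ++ K) ++ Eα.pairs) (κ p) (κ q)
      κ-conn = CP.Eα.conn-base LP (pull-equiv κ (conn-equiv _))
        (κ-edge {Eα.pairs})
        (λ p → subst (Conn _ (κ p)) (ζ-inj {FPI.fun αΦ (κ p)} {κ (FPI.fun (αF P) p)} (α-nb {κ p} (κ-nb p)) (κ-nb _) (trans (ζα (κ p)) (trans (cong (FPI.fun (αF P)) (ζκ p)) (sym (ζκ _)))))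
          (Eα.pair-conn (digon ++ K) (κ p)))
      bigon-conn : ∀ b z → Conn ((digon ++ K) ++ Eα.pairs) (bigon true true) (bigon b z)
      bigon-conn true true = crefl
      bigon-conn false true = edge (here refl)
      bigon-conn true false = Eα.pair-conn (digon ++ K) (bigon true true)
      bigon-conn false false = ctrans (Eα.pair-conn (digon ++ K) (bigon true true)) (edge (there (here refl)))
      reflects : ∀ a b → S' (h a) (h b) → Conn ((digon ++ K) ++ Eα.pairs) a b
      reflects a b s with nonbig? a | nonbig? b
      ... | inj₁ p | inj₁ q = subst₂ (Conn _) (κζ a p) (κζ b q) (κ-conn s)
      ... | inj₂ (c , z , refl) | inj₂ (c' , z' , refl) = ctrans (csym (bigon-conn c z)) (bigon-conn c' z')
      to-both : ∀ {a b} → NonBig a → NonBig b → Conn (LP ++ CP.Eα.pairs) (ζ a) (ζ b) → S' (h a) (h b)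
      to-both {a} {b} p q c = subst₂ S' (sym (h-nb {a} p)) (sym (h-nb {b} q)) c
      to-big : ∀ b z b' z' → S' (h (bigon b z)) (h (bigon b' z'))
      to-big b z b' z' = subst₂ S' (sym (h-big b z)) (sym (h-big b' z')) refl
      α-bigon : ∀ b z → FPI.fun αΦ (bigon b z) ≡ bigon b (not z)
      α-bigon true z = cong (λ d → inj₁ (d , true)) (TA.rev-eD z)
      α-bigon false z = cong (λ d → inj₂ (d , true)) (TB.rev-eD z)
      preserves : ∀ a b → Conn ((digon ++ K) ++ Eα.pairs) a b → S' (h a) (h b)
      preserves _ _ = Eα.conn-base (digon ++ K) (pull-equiv h S-eq)
        (λ { {a} {b} (here refl) → to-big true true false true ; (there (here refl)) → to-big true false false false
           ; {a} {b} (there (there m)) → to-both {a} {b} (nb (proj₁ (∈-flat m))) (nb (proj₂ (∈-flat m))) (edge (∈-++⁺ˡ (∈-map⁺ (both ζ) m))) })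
        (λ a → case nonbig? a of λ
          { (inj₁ p) → to-both {a} {FPI.fun αΦ a} p (α-nb {a} p) (subst (Conn _ (ζ a)) (sym (ζα a)) (CP.Eα.pair-conn LP (ζ a)))
          ; (inj₂ (b , z , refl)) → subst (λ w → S' (h (bigon b z)) (h w)) (sym (α-bigon b z)) (to-big b z b (not z)) })

    ζ-conn : ∀ {φ ψ} → Conn ((digon ++ K) ++ Eβ.pairs) φ ψ → Conn (LP ++ CP.Eβ.pairs) (ζ φ) (ζ ψ)
    ζ-conn = Eβ.conn-base (digon ++ K) (pull-equiv ζ (conn-equiv _))
      (λ { (here refl) → dg true ; (there (here refl)) → dg false
         ; (there (there m)) → edge (∈-++⁺ˡ (∈-map⁺ (both ζ) m)) })
      (λ a → case ζβ a of λ { (inj₁ e) → ≡⇒conn (sym e) ; (inj₂ e) → subst (Conn _ (ζ a)) (sym e) (CP.Eβ.pair-conn LP (ζ a)) })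
      where
      dg : ∀ z → Conn (LP ++ CP.Eβ.pairs) (ζ (bigon true z)) (ζ (bigon false z))
      dg z = subst₂ (Conn _) (sym (trans (zl-yes true (z , refl)) (cong (_, false) (gA-eD z))))
        (sym (trans (zr-yes true (z , refl)) (cong (_, true) (gB-eD z)))) (CP.Eβ.pair-conn LP (TP.eD z , false))

    home : ∀ φ → Conn ((digon ++ K) ++ Eβ.pairs) (κ (ζ φ)) φ
    home φ with nonbig? φ
    ... | inj₁ p = ≡⇒conn (κζ φ p)
    ... | inj₂ (true , z , refl) = ctrans (≡⇒conn (trans (cong κ (trans (zl-yes true (z , refl)) (sym (zl-yes false (z , refl))))) (κζ (inj₁ (TA.eD z , false)) (λ _ → refl))))
            (Eβ.pair-conn (digon ++ K) (inj₁ (TA.eD z , false)))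
    ... | inj₂ (false , z , refl) = ctrans (≡⇒conn (trans (cong κ (trans (zr-yes true (z , refl)) (sym (zr-yes false (z , refl))))) (κζ (inj₂ (TB.eD z , false)) (λ _ → refl))))
            (Eβ.pair-conn (digon ++ K) (inj₂ (TB.eD z , false)))

    κ-conn-β : ∀ {p q} → Conn (LP ++ CP.Eβ.pairs) p q → Conn ((digon ++ K) ++ Eβ.pairs) (κ p) (κ q)
    κ-conn-β = CP.Eβ.conn-base LP (pull-equiv κ (conn-equiv _))
      (κ-edge {Eβ.pairs}) flipped
      where
      flipped : ∀ p → Conn ((digon ++ K) ++ Eβ.pairs) (κ p) (κ (FPI.fun (βF P) p))
      flipped p with ζβ (κ p)
      ... | inj₂ e = ctrans (Eβ.pair-conn (digon ++ K) (κ p)) (ctrans (csym (home (FPI.fun βΦ (κ p)))) (≡⇒conn (cong κ (trans e (cong (FPI.fun (βF P)) (ζκ p))))))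
      ... | inj₁ e = terminal p (spec-of (κ p) e)
        where
        spec-of : ∀ φ → ζ (FPI.fun βΦ φ) ≡ ζ φ → ∃ λ z → proj₁ (ζ φ) ≡ TP.eD z
        spec-of (inj₁ (d , s)) e with TA.spec? d
        ... | yes (z , refl) = z , gA-eD z
        ... | no _ = contradiction (sym (cong proj₂ e)) (Boolₚ.not-¬ refl)
        spec-of (inj₂ (d , s)) e with TB.spec? d
        ... | yes (z , refl) = z , gB-eD z
        ... | no _ = contradiction (sym (cong proj₂ e)) (Boolₚ.not-¬ refl)
        -- Changing the side of the terminal edge of `P` means, after doubling, passing from the
        -- outer side of one copy through the digon to the outer side of the other.
        across : ∀ z → Conn ((digon ++ K) ++ Eβ.pairs) (κ (TP.eD z , false)) (κ (TP.eD z , true))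
        across z = subst₂ (Conn _) (cong κ (trans (zl-yes true (z , refl)) (cong (_, false) (gA-eD z))))
          (cong κ (trans (zr-yes true (z , refl)) (cong (_, true) (gB-eD z))))
          (ctrans (home (bigon true z)) (ctrans (edge (∈-++⁺ˡ {xs = digon ++ K} (∈-++⁺ˡ {xs = digon} (digon-∈ z)))) (csym (home (bigon false z)))))
        terminal : ∀ p → (∃ λ z → proj₁ (ζ (κ p)) ≡ TP.eD z) → Conn ((digon ++ K) ++ Eβ.pairs) (κ p) (κ (FPI.fun (βF P) p))
        terminal (d , s) (z , q) with trans (cong proj₁ (sym (ζκ (d , s)))) q
        terminal (.(TP.eD z) , true) (z , q) | refl = csym (across z)
        terminal (.(TP.eD z) , false) (z , q) | refl = across z

  halves : List (Flag A × Flag A) → List (Flag B × Flag B) → List (Φ × Φ)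
  halves LA LB = map (both inj₁) LA ++ map (both inj₂) LB

  flat-halves : ∀ LA LB → flat (halves LA LB) ≡ map inj₁ (flat LA) ++ map inj₂ (flat LB)
  flat-halves LA LB = trans (flat-++ (map (both inj₁) LA) _) (cong₂ _++_ (flat-map inj₁ LA) (flat-map inj₂ LB))

  split-sides : ∀ L → AllP (λ u v → side u ≡ side v) L → ∃ λ LA → ∃ λ LB → L ↭ halves LA LB
  split-sides [] [] = [] , [] , ↭-refl
  split-sides ((inj₁ a , inj₁ a') ∷ L) (_ ∷ qs) = let LA , LB , p = split-sides L qs in (a , a') ∷ LA , LB , prep _ p
  split-sides ((inj₂ b , inj₂ b') ∷ L) (_ ∷ qs) = let LA , LB , p = split-sides L qs in
    LA , (b , b') ∷ LB , ↭-trans (prep _ p) (↭-sym (shift _ (map (both inj₁) LA) _))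

  module Halves (f : FPI (Flag A)) (g : FPI (Flag B)) (LA : List (Flag A × Flag A)) (LB : List (Flag B × Flag B)) where
    module Ef = Ends (fF A) f
    module Eg = Ends (fF B) g
    module Efg = Ends fΦ (sum-FPI f g)
    R : Φ → Φ → Set
    R = Sum (Conn (LA ++ Ef.pairs)) (Conn (LB ++ Eg.pairs))
    apart : ∀ {a b} → Conn (halves LA LB ++ Efg.pairs) a b → R a b
    apart = Efg.conn-base (halves LA LB) (sum-equiv (conn-equiv _) (conn-equiv _))
      (λ m → case ∈-++⁻ (map (both inj₁) LA) m of λ
        { (inj₁ k) → case ∈-map⁻ _ k of λ { (_ , j , refl) → edge (∈-++⁺ˡ j) }
        ; (inj₂ k) → case ∈-map⁻ _ k of λ { (_ , j , refl) → edge (∈-++⁺ˡ j) } })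
      (λ { (inj₁ a) → Ef.pair-conn LA a ; (inj₂ b) → Eg.pair-conn LB b })
    inA : ∀ {a b} → Conn (LA ++ Ef.pairs) a b → Conn (halves LA LB ++ Efg.pairs) (inj₁ a) (inj₁ b)
    inA = Ef.conn-base LA (pull-equiv inj₁ (conn-equiv _))
      (λ m → edge (∈-++⁺ˡ (∈-++⁺ˡ (∈-map⁺ (both inj₁) m)))) (λ a → Efg.pair-conn (halves LA LB) (inj₁ a))
    inB : ∀ {a b} → Conn (LB ++ Eg.pairs) a b → Conn (halves LA LB ++ Efg.pairs) (inj₂ a) (inj₂ b)
    inB = Eg.conn-base LB (pull-equiv inj₂ (conn-equiv _))
      (λ m → edge (∈-++⁺ˡ (∈-++⁺ʳ (map (both inj₁) LA) (∈-map⁺ (both inj₂) m)))) (λ a → Efg.pair-conn (halves LA LB) (inj₂ a))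
    together : ∀ a b → R a b → Conn (halves LA LB ++ Efg.pairs) a b
    together (inj₁ a) (inj₁ b) = inA
    together (inj₂ a) (inj₂ b) = inB
    number : Efg.A[ halves LA LB ] ≡ Ef.A[ LA ] + Eg.A[ LB ]
    number = nc-unique {S = R} id (λ b → b , erefl (sum-equiv {R = Conn (LA ++ Ef.pairs)} {S = Conn (LB ++ Eg.pairs)} (conn-equiv _) (conn-equiv _)) {b})
      together (λ _ _ → apart) (nc-cls _) (nc-sum (CA.nc-cls _) (CB.nc-cls _))

  halves-perfect : ∀ LA LB → CA.Perfect LA → CB.Perfect LB → Perfect (halves LA LB)
  halves-perfect LA LB (ua , ca) (ub , cb) = subst Unique (sym (flat-halves LA LB))
      (Unique-++ (unique-map inj₁ (flat LA) (λ _ _ → inj₁-injective) ua) (unique-map inj₂ (flat LB) (λ _ _ → inj₂-injective) ub)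
        (λ (p , q) → case ∈-map⁻ _ p , ∈-map⁻ _ q of λ { ((_ , _ , refl) , (_ , _ , ())) })) ,
    λ a → subst (a ∈_) (sym (flat-halves LA LB)) (every a)
    where
    every : ∀ a → a ∈ map inj₁ (flat LA) ++ map inj₂ (flat LB)
    every (inj₁ a) = ∈-++⁺ˡ (∈-map⁺ inj₁ (ca a))
    every (inj₂ b) = ∈-++⁺ʳ _ (∈-map⁺ inj₂ (cb b))

  unmap : ∀ {X Y : Set} (f : X → Y) xs → Unique (map f xs) → Unique xs
  unmap f [] _ = []
  unmap f (x ∷ xs) uq = unique-∷ (λ m → unique-∉ uq (∈-map⁺ f m)) (unmap f xs (unique-tail uq))

  halves-perfect⁻ : ∀ LA LB → Perfect (halves LA LB) → CA.Perfect LA × CB.Perfect LB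
  halves-perfect⁻ LA LB (uq , co) =
    (unmap inj₁ _ (unique-++ˡ _ uq') , λ a → case ∈-++⁻ (map inj₁ (flat LA)) (co' (inj₁ a)) of λ
      { (inj₁ k) → case ∈-map⁻ _ k of λ { (_ , j , refl) → j } ; (inj₂ k) → case ∈-map⁻ _ k of λ { (_ , _ , ()) } }) ,
    (unmap inj₂ _ (unique-++ʳ (map inj₁ (flat LA)) uq') , λ b → case ∈-++⁻ (map inj₁ (flat LA)) (co' (inj₂ b)) of λ
      { (inj₁ k) → case ∈-map⁻ _ k of λ { (_ , _ , ()) } ; (inj₂ k) → case ∈-map⁻ _ k of λ { (_ , j , refl) → j } })
    where
    uq' : Unique (map inj₁ (flat LA) ++ map inj₂ (flat LB))
    uq' = subst Unique (flat-halves LA LB) uq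
    co' : ∀ a → a ∈ map inj₁ (flat LA) ++ map inj₂ (flat LB)
    co' a = subst (a ∈_) (flat-halves LA LB) (co a)

  both-ζκ : ∀ L → map (both ζ) (map (both κ) L) ≡ L
  both-ζκ [] = refl
  both-ζκ ((u , v) ∷ L) = cong₂ _∷_ (cong₂ _,_ (ζκ u) (ζκ v)) (both-ζκ L)

  mixed-terminal : ∀ u v → side u ≢ side v → gvertex u ≡ gvertex v → gvertex u ≡ x P ⊎ gvertex u ≡ y P
  mixed-terminal (inj₁ a) (inj₁ b) n _ = contradiction refl n
  mixed-terminal (inj₂ a) (inj₂ b) n _ = contradiction refl n
  mixed-terminal (inj₁ a) (inj₂ b) _ e = shared _ _ e
  mixed-terminal (inj₂ a) (inj₁ b) _ e with shared _ _ (sym e)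
  ... | inj₁ q = inj₁ (trans e q)
  ... | inj₂ q = inj₂ (trans e q)

  SameVertex : Φ → Φ → Set
  SameVertex u v = side u ≡ side v × gvertex u ≡ gvertex v

  rotA : ∀ LA LB → Perfect (halves LA LB) → AllP SameVertex (halves LA LB) →
    (∀ a b → SameVertex a b → Conn (halves LA LB ++ Eβ.pairs) a b) → Rot A
  rotA LA LB pf lv tr = record { list = LA ; perfect = proj₁ (halves-perfect⁻ LA LB pf)
    ; level = All.tabulate λ m → φA-inj _ _ (proj₂ (All.lookup lv (∈-++⁺ˡ (∈-map⁺ (both inj₁) m))))
    ; transitive = λ a b e → Halves.apart (βF A) (βF B) LA LB {inj₁ a} {inj₁ b} (tr (inj₁ a) (inj₁ b) (refl , cong φA e)) }

  rotB : ∀ LA LB → Perfect (halves LA LB) → AllP SameVertex (halves LA LB) →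
    (∀ a b → SameVertex a b → Conn (halves LA LB ++ Eβ.pairs) a b) → Rot B
  rotB LA LB pf lv tr = record { list = LB ; perfect = proj₂ (halves-perfect⁻ LA LB pf)
    ; level = All.tabulate λ m → φB-inj _ _ (proj₂ (All.lookup lv (∈-++⁺ʳ (map (both inj₁) LA) (∈-map⁺ (both inj₂) m))))
    ; transitive = λ a b e → Halves.apart (βF A) (βF B) LA LB {inj₂ a} {inj₂ b} (tr (inj₂ a) (inj₂ b) (refl , cong φB e)) }

  record Parts (α# β# : ℕ) : Set where
    field
      RA : Rot A
      RB : Rot B
      ineq : α# + (CA.βc (Rot.list RA) + CB.βc (Rot.list RB)) ≤ (CA.αc (Rot.list RA) + CB.αc (Rot.list RB)) + β# + 2

  parts-of : ∀ N M LA LB → M ↭ halves LA LB → Perfect M → AllP SameVertex M → (∀ a b → SameVertex a b → Conn (M ++ Eβ.pairs) a b) →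
    Drop≤ 2 N M → Parts (αc N) (βc N)
  parts-of N M LA LB M↭ pf lv tr drop = record
    { RA = rotA LA LB pf' lv' tr' ; RB = rotB LA LB pf' lv' tr'
    ; ineq = subst₂ _≤_ (cong (αc N +_) (trans (Eβ.A-↭ M↭) (Halves.number (βF A) (βF B) LA LB)))
        (cong (λ z → z + βc N + 2) (trans (Eα.A-↭ M↭) (Halves.number (αF A) (αF B) LA LB))) drop }
    where
    pf' : Perfect (halves LA LB)
    pf' = perfect-↭ {M} {halves LA LB} (flat-↭ M↭) pf
    lv' : AllP SameVertex (halves LA LB)
    lv' = All-resp-↭ M↭ lv
    tr' : ∀ a b → SameVertex a b → Conn (halves LA LB ++ Eβ.pairs) a b
    tr' a b e = conn-↭ (↭-++ʳ Eβ.pairs M↭) (tr a b e)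

  parts : ∀ N → Perfect N → AllP (λ u v → gvertex u ≡ gvertex v) N → Parts (αc N) (βc N)
  parts N pf lv = go (Separation.separate fΦ αΦ βΦ F._≟_ gvertex side α-side β-side β-gvertex (x P) (y P) (x≢y P) mixed-terminal N pf lv)
    where
    go : Separation.Separated fΦ αΦ βΦ F._≟_ gvertex side α-side β-side β-gvertex (x P) (y P) (x≢y P) mixed-terminal N → Parts (αc N) (βc N)
    go S = go₂ (split-sides M (All.map proj₁ (Separation.Separated.level S)))
      where
      M : List (Φ × Φ)
      M = Separation.Separated.list S
      go₂ : (∃ λ LA → ∃ λ LB → M ↭ halves LA LB) → Parts (αc N) (βc N)
      go₂ (LA , LB , p) = parts-of N M LA LB p (Separation.Separated.perfect S) (Separation.Separated.level S)
        (Separation.Separated.transitive S) (Separation.Separated.drop S)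

  module Double (L : List (Flag P × Flag P)) where
    K : List (Φ × Φ)
    K = map (both κ) L
    flatK : flat K ≡ map κ (flat L)
    flatK = flat-map κ L
    K-nb : ∀ {φ} → φ ∈ flat K → NonBig φ
    K-nb {φ} m = lem (∈-map⁻ κ (subst (φ ∈_) flatK m))
      where
      lem : (∃ λ p → p ∈ flat L × φ ≡ κ p) → NonBig φ
      lem (p , _ , e) = subst NonBig (sym e) (κ-nb p)
    perfect : CP.Perfect L → Perfect (digon ++ K)
    perfect (uq , co) = Unique-++ digon-unique (subst Unique (sym flatK) (unique-map κ (flat L) (λ {a} {b} _ _ e → trans (sym (ζκ a)) (trans (cong ζ e) (ζκ b))) uq))
        (λ {v} (p , q) → digon-big {v} p (K-nb {v} q)) ,
      λ φ → every φ (nonbig? φ)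
      where
      every : ∀ φ → NonBig φ ⊎ (∃ λ b → ∃ λ z → φ ≡ bigon b z) → φ ∈ flat digon ++ flat K
      every φ (inj₁ nb) = ∈-++⁺ʳ (flat digon) (subst (φ ∈_) (sym flatK) (subst (_∈ map κ (flat L)) (κζ φ nb) (∈-map⁺ κ (co (ζ φ)))))
      every φ (inj₂ (b , z , e)) = ∈-++⁺ˡ (subst (_∈ flat digon) (sym e) (bigon-∈ b z))
    level : AllP (λ p q → vertex P p ≡ vertex P q) L → AllP (λ u v → gvertex u ≡ gvertex v) (digon ++ K)
    level lv = trans φA-x (sym φB-x) ∷ trans φA-y (sym φB-y) ∷ mapped L lv
      where
      mapped : ∀ L → AllP (λ p q → vertex P p ≡ vertex P q) L → AllP (λ u v → gvertex u ≡ gvertex v) (map (both κ) L)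
      mapped [] [] = []
      mapped ((a , b) ∷ L) (e ∷ es) = trans (κ-vertex a) (trans e (sym (κ-vertex b))) ∷ mapped L es
    LP≡ : Faces.LP K K-nb ≡ L
    LP≡ = both-ζκ L
    faces : αc (digon ++ K) ≡ CP.αc L + 1
    faces = trans (Faces.faces K K-nb) (cong (λ L → CP.αc L + 1) LP≡)
    vertices : βc (digon ++ K) ≤ CP.βc L
    vertices = nc-≤ ζ back (nc-cls ((digon ++ K) ++ Eβ.pairs)) (CP.nc-cls (L ++ CP.Eβ.pairs))
      where
      back : ∀ a b → Conn (L ++ CP.Eβ.pairs) (ζ a) (ζ b) → Conn ((digon ++ K) ++ Eβ.pairs) a b
      back a b c = ctrans (csym (Faces.home K K-nb a)) (ctrans (Faces.κ-conn-β K K-nb (subst (λ L → Conn (L ++ CP.Eβ.pairs) (ζ a) (ζ b)) (sym LP≡) c)) (Faces.home K K-nb b))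

  abstract
    split-rot : (RP : Rot P) → Parts (CP.αc (Rot.list RP) + 1) (CP.βc (Rot.list RP))
    split-rot RP = record { RA = Parts.RA p ; RB = Parts.RB p
        ; ineq = ≤-trans (≤-reflexive (cong (_+ (CA.βc (Rot.list (Parts.RA p)) + CB.βc (Rot.list (Parts.RB p)))) (sym (Double.faces L)))) (≤-trans (Parts.ineq p) (ℕₚ.+-monoˡ-≤ 2 (ℕₚ.+-monoʳ-≤ (CA.αc (Rot.list (Parts.RA p)) + CB.αc (Rot.list (Parts.RB p))) (Double.vertices L)))) }
      where
      L : List (Flag P × Flag P)
      L = Rot.list RP
      p : Parts (αc (digon ++ Double.K L)) (βc (digon ++ Double.K L))
      p = parts (digon ++ Double.K L) (Double.perfect L (Rot.perfect RP)) (Double.level L (Rot.level RP))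

  -- The digon flags of `A` and `B` at x, followed by those at y.
  u₀ w₀ s₀ t₀ : Φ
  u₀ = bigon true true
  w₀ = bigon false true
  s₀ = bigon true false
  t₀ = bigon false false

  gu : gvertex u₀ ≡ x P
  gu = φA-x
  gw : gvertex w₀ ≡ x P
  gw = φB-x
  gs : gvertex s₀ ≡ y P
  gs = φA-y
  gt : gvertex t₀ ≡ y P
  gt = φB-y

  same-sym : ∀ {u v} → SameVertex u v → SameVertex v u
  same-sym (a , b) = sym a , sym b

  at-x≢s : ∀ {a} → gvertex a ≡ x P → s₀ ≢ a
  at-x≢s e q = x≢y P (trans (sym e) (trans (cong gvertex (sym q)) gs))
  at-x≢t : ∀ {a} → gvertex a ≡ x P → t₀ ≢ a
  at-x≢t e q = x≢y P (trans (sym e) (trans (cong gvertex (sym q)) gt))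

  -- Cut the rotations of A and B open at the terminal edge and splice them at x and at y.
  module Splice (N₀ : List (Φ × Φ)) (pf₀ : Perfect N₀) (pure₀ : AllP SameVertex N₀)
    (u' w' s' t' : Φ) (R₁ : List (Φ × Φ))
    (flat01 : flat N₀ ↭ flat ((u₀ , u') ∷ (w₀ , w') ∷ (s₀ , s') ∷ (t₀ , t') ∷ R₁))
    (conn01 : ∀ {R a b} → Conn (N₀ ++ R) a b → Conn ((u₀ , u') ∷ (w₀ , w') ∷ (s₀ , s') ∷ (t₀ , t') ∷ R₁ ++ R) a b)
    (conn10 : ∀ {R a b} → Conn ((u₀ , u') ∷ (w₀ , w') ∷ (s₀ , s') ∷ (t₀ , t') ∷ R₁ ++ R) a b → Conn (N₀ ++ R) a b)
    (pure₁ : AllP SameVertex ((u₀ , u') ∷ (w₀ , w') ∷ (s₀ , s') ∷ (t₀ , t') ∷ R₁))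
    (climb₀ : ∀ a b → SameVertex a b → Conn (N₀ ++ Eβ.pairs) a b) where
    N₁ N₁' N₂ N₃ K : List (Φ × Φ)
    N₁ = (u₀ , u') ∷ (w₀ , w') ∷ (s₀ , s') ∷ (t₀ , t') ∷ R₁
    N₁' = (u₀ , w₀) ∷ (u' , w') ∷ (s₀ , s') ∷ (t₀ , t') ∷ R₁
    N₂ = (s₀ , s') ∷ (t₀ , t') ∷ (u' , w') ∷ R₁ ++ (u₀ , w₀) ∷ []
    N₃ = (s₀ , t₀) ∷ (s' , t') ∷ (u' , w') ∷ R₁ ++ (u₀ , w₀) ∷ []
    K = (s' , t') ∷ (u' , w') ∷ R₁
    gu' : gvertex u' ≡ x P
    gu' = trans (sym (proj₂ (All.head pure₁))) gu
    gw' : gvertex w' ≡ x P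
    gw' = trans (sym (proj₂ (All.head (All.tail pure₁)))) gw
    pure₂ : AllP SameVertex ((s₀ , s') ∷ (t₀ , t') ∷ R₁)
    pure₂ = All.tail (All.tail pure₁)
    pf₁ : Perfect N₁
    pf₁ = perfect-↭ {N₀} {N₁} flat01 pf₀
    order₂ : N₁' ↭ N₂
    order₂ = ↭-trans (prep _ (shifts ((u' , w') ∷ []) ((s₀ , s') ∷ (t₀ , t') ∷ [])))
      (↭-++-comm ((u₀ , w₀) ∷ []) ((s₀ , s') ∷ (t₀ , t') ∷ (u' , w') ∷ R₁))
    order₃ : N₃ ↭ digon ++ K
    order₃ = ↭-trans (prep _ (↭-++-comm ((s' , t') ∷ (u' , w') ∷ R₁) ((u₀ , w₀) ∷ []))) (swap _ _ ↭-refl)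
    pf₂ : Perfect N₂
    pf₂ = perfect-↭ {N₁} {N₂} (↭-trans (prep u₀ (swap u' w₀ ↭-refl)) (flat-↭ order₂)) pf₁
    pf₃ : Perfect (digon ++ K)
    pf₃ = perfect-↭ {N₂} {digon ++ K} (↭-trans (prep s₀ (swap s' t₀ ↭-refl)) (flat-↭ order₃)) pf₂
    -- Once `u₀` and `w₀` are paired, the path from `s₀` runs along both copies of the terminal edge
    -- and ends at `t₀`.
    opposite : Eα.ends ((u₀ , w₀) ∷ []) s₀ ≡ t₀
    opposite = trans (Eα.splice-l (FPI.fun αΦ) {u₀} {w₀} {s₀} (cong (λ d → inj₁ (d , true)) (TA.rev-eD false))) (cong (λ d → inj₂ (d , true)) (TB.rev-eD true))
    -- The switch at x costs at most one face, and the switch at y closes the digon and gives one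
    -- back.
    face-bound : αc N₀ ≤ αc (digon ++ K)
    face-bound = ≤-trans (≤-reflexive (cls-cong (N₀ ++ Eα.pairs) (N₁ ++ Eα.pairs) (conn01 {Eα.pairs}) (conn10 {Eα.pairs})))
      (≤-trans (cls-switch {u₀} {u'} {w₀} {w'} (((s₀ , s') ∷ (t₀ , t') ∷ R₁) ++ Eα.pairs))
      (≤-trans (s≤s (≤-reflexive (Eα.A-↭ order₂)))
      (≤-trans (Eα.switch-close ((u' , w') ∷ R₁) ((u₀ , w₀) ∷ []) (proj₁ pf₂) opposite) (≤-reflexive (Eα.A-↭ order₃)))))
    side-apart : ¬ Conn (N₁ ++ Eβ.pairs) u₀ w₀
    side-apart c = case Eβ.conn-base N₀ (≡-equiv side) (λ m → proj₁ (All.lookup pure₀ m)) (λ a → sym (β-side a)) (conn10 {Eβ.pairs} c) of λ ()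
    -- After the switch at x the side is no longer an invariant there. Forgetting it at x alone
    -- still separates the two copies of y.
    label : Φ → Fin (n P) × Bool
    label φ with gvertex φ F.≟ x P
    ... | yes _ = x P , true
    ... | no _ = gvertex φ , side φ
    label-pure : ∀ {a b} → SameVertex a b → label a ≡ label b
    label-pure {a} {b} (p , q) with gvertex a F.≟ x P | gvertex b F.≟ x P
    ... | yes _ | yes _ = refl
    ... | no _ | no _ = cong₂ _,_ q p
    ... | yes e | no n = contradiction (trans (sym q) e) n
    ... | no n | yes e = contradiction (trans q e) n
    label-x : ∀ {a} → gvertex a ≡ x P → label a ≡ (x P , true)
    label-x {a} e with gvertex a F.≟ x P
    ... | yes _ = refl
    ... | no n = contradiction e n
    label-y : ∀ {a} → gvertex a ≡ y P → label a ≡ (gvertex a , side a)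
    label-y {a} e with gvertex a F.≟ x P
    ... | yes e' = contradiction (trans (sym e') e) (x≢y P)
    ... | no n = refl
    label-apart : ¬ Conn (N₂ ++ Eβ.pairs) s₀ t₀
    label-apart c = case trans (sym (cong proj₂ (label-y {s₀} gs))) (trans (cong proj₂ k) (cong proj₂ (label-y {t₀} gt))) of λ ()
      where
      k : label s₀ ≡ label t₀
      k = Eβ.conn-base N₁' (≡-equiv label) (λ
        { (here refl) → trans (label-x {u₀} gu) (sym (label-x {w₀} gw))
        ; (there (here refl)) → trans (label-x {u'} gu') (sym (label-x {w'} gw'))
        ; (there (there m)) → label-pure (All.lookup pure₂ m) })
        (λ a → label-pure {a} (sym (β-side a) , sym (β-gvertex a)))
        (conn-↭ (↭-++ʳ Eβ.pairs (↭-sym order₂)) c)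
    climb : ∀ {a b} → Conn (N₀ ++ Eβ.pairs) a b → Conn ((digon ++ K) ++ Eβ.pairs) a b
    climb c = conn-↭ (↭-++ʳ Eβ.pairs order₃) (Eβ.switch-conn ((u' , w') ∷ R₁ ++ (u₀ , w₀) ∷ []) pf₂ label-apart
      (conn-↭ (↭-++ʳ Eβ.pairs order₂) (Eβ.switch-conn ((s₀ , s') ∷ (t₀ , t') ∷ R₁) pf₁ side-apart (conn01 {Eβ.pairs} c))))
    same : ∀ a b → SameVertex a b → Conn ((digon ++ K) ++ Eβ.pairs) a b
    same a b e = climb (climb₀ a b e)
    across : ∀ a b → φA (vertex A a) ≡ φB (vertex B b) → Conn ((digon ++ K) ++ Eβ.pairs) (inj₁ a) (inj₂ b)
    across a b e with common e
    ... | inj₁ (p , q) = ctrans (same (inj₁ a) u₀ (refl , cong φA p)) (ctrans (edge (here refl)) (same w₀ (inj₂ b) (refl , cong φB (sym q))))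
    ... | inj₂ (p , q) = ctrans (same (inj₁ a) s₀ (refl , cong φA p)) (ctrans (edge (there (here refl))) (same t₀ (inj₂ b) (refl , cong φB (sym q))))
    glued : ∀ a b → gvertex a ≡ gvertex b → Conn ((digon ++ K) ++ Eβ.pairs) a b
    glued (inj₁ a) (inj₁ b) e = same (inj₁ a) (inj₁ b) (refl , e)
    glued (inj₂ a) (inj₂ b) e = same (inj₂ a) (inj₂ b) (refl , e)
    glued (inj₁ a) (inj₂ b) e = across a b e
    glued (inj₂ a) (inj₁ b) e = csym (across b a (sym e))
    K-nb : ∀ {φ} → φ ∈ flat K → NonBig φ
    K-nb {φ} m with nonbig? φ
    ... | inj₁ p = p
    ... | inj₂ (b , z , e) = contradiction m (unique-disjoint (flat digon) (proj₁ pf₃) (subst (_∈ flat digon) (sym e) (bigon-∈ b z)))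
    K-level : AllP (λ a b → gvertex a ≡ gvertex b) K
    K-level = trans (sym (proj₂ (All.head pure₂))) (trans gs (trans (sym gt) (proj₂ (All.head (All.tail pure₂))))) ∷ trans gu' (sym gw') ∷ All.map proj₂ (All.tail (All.tail pure₂))

  -- Undoes the doubling: the two copies of the terminal edge become one, and each copy contributes
  -- one of its sides.
  collapse : ∀ K → Perfect (digon ++ K) → (∀ {φ} → φ ∈ flat K → NonBig φ) → AllP (λ a b → gvertex a ≡ gvertex b) K →
    (∀ a b → gvertex a ≡ gvertex b → Conn ((digon ++ K) ++ Eβ.pairs) a b) → Rot P
  collapse K pf nb lv glued = record
      { list = map (both ζ) K
      ; perfect = subst Unique (sym flatLP) (unique-map ζ (flat K) (λ {a} {b} p q → ζ-inj {a} {b} (nb p) (nb q)) (unique-++ʳ (flat digon) (proj₁ pf))) , every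
      ; level = mapped K lv
      ; transitive = λ p q e → subst₂ (Conn _) (ζκ p) (ζκ q) (Faces.ζ-conn K nb (glued (κ p) (κ q) (trans (κ-vertex p) (trans e (sym (κ-vertex q)))))) }
    where
    flatLP : flat (map (both ζ) K) ≡ map ζ (flat K)
    flatLP = flat-map ζ K
    inK : ∀ p → κ p ∈ flat digon ⊎ κ p ∈ flat K → κ p ∈ flat K
    inK p (inj₁ k) = contradiction (κ-nb p) (digon-big k)
    inK p (inj₂ k) = k
    every : ∀ p → p ∈ flat (map (both ζ) K)
    every p = subst (p ∈_) (sym flatLP) (subst (_∈ map ζ (flat K)) (ζκ p) (∈-map⁺ ζ (inK p (∈-++⁻ (flat digon) (proj₂ pf (κ p))))))
    mapped : ∀ K → AllP (λ a b → gvertex a ≡ gvertex b) K → AllP (λ p q → vertex P p ≡ vertex P q) (map (both ζ) K)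
    mapped [] [] = []
    mapped ((a , b) ∷ K) (e ∷ es) = trans (ζ-vertex a) (trans e (sym (ζ-vertex b))) ∷ mapped K es

  -- The four digon flags lie in four different pairs, because pairs keep side and vertex: `u₀` and
  -- `w₀` differ in side, as do `s₀` and `t₀`, and x differs from y.
  splice-rot : ∀ N₀ → Perfect N₀ → AllP SameVertex N₀ → (∀ a b → SameVertex a b → Conn (N₀ ++ Eβ.pairs) a b) →
    Σ (Rot P) λ R → αc N₀ ≤ CP.αc (Rot.list R) + 1
  splice-rot N₀ pf₀ pure₀ climb₀ = first (pick N₀ (proj₂ pf₀ u₀))
    where
    Goal : Set
    Goal = Σ (Rot P) λ R → αc N₀ ≤ CP.αc (Rot.list R) + 1
    last : (puw : Pick₂ u₀ w₀ N₀) → Pick₂ s₀ t₀ (Pick₂.rest puw) → Goal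
    last puw pst = collapse K pf₃ K-nb K-level glued , ≤-trans face-bound (≤-reflexive (Faces.faces K K-nb))
      where
      module U = Pick₂ puw
      module W = Pick₂ pst
      conn01 : ∀ {R a b} → Conn (N₀ ++ R) a b → Conn ((u₀ , U.mate₁) ∷ (w₀ , U.mate₂) ∷ (s₀ , W.mate₁) ∷ (t₀ , W.mate₂) ∷ W.rest ++ R) a b
      conn01 {R} c = conn-fold (conn-equiv _) (λ
        { (here refl) → edge (here refl) ; (there (here refl)) → edge (there (here refl))
        ; (there (there m)) → conn-wk (conn-wk (W.conn {R} (edge m))) }) (U.conn {R} c)
      conn10 : ∀ {R a b} → Conn ((u₀ , U.mate₁) ∷ (w₀ , U.mate₂) ∷ (s₀ , W.mate₁) ∷ (t₀ , W.mate₂) ∷ W.rest ++ R) a b → Conn (N₀ ++ R) a b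
      conn10 {R} c = U.conn⁻ {R} (conn-fold (conn-equiv _) (λ
        { (here refl) → edge (here refl) ; (there (here refl)) → edge (there (here refl))
        ; (there (there m)) → conn-wk (conn-wk (W.conn⁻ {R} (edge m))) }) c)
      pure₁ : AllP SameVertex ((u₀ , U.mate₁) ∷ (w₀ , U.mate₂) ∷ (s₀ , W.mate₁) ∷ (t₀ , W.mate₂) ∷ W.rest)
      pure₁ with U.all same-sym pure₀
      ... | p ∷ q ∷ r = p ∷ q ∷ W.all same-sym r
      open Splice N₀ pf₀ pure₀ U.mate₁ U.mate₂ W.mate₁ W.mate₂ W.rest
        (↭-trans U.flat↭ (prep u₀ (prep U.mate₁ (prep w₀ (prep U.mate₂ W.flat↭))))) conn01 conn10 pure₁ climb₀
    second : (puw : Pick₂ u₀ w₀ N₀) → Goal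
    second puw = last puw (pick₂ ps t∈)
      where
      open Pick₂ puw
      pure₁ : AllP SameVertex ((u₀ , mate₁) ∷ (w₀ , mate₂) ∷ rest)
      pure₁ = all same-sym pure₀
      g₁ : gvertex mate₁ ≡ x P
      g₁ = trans (sym (proj₂ (All.head pure₁))) gu
      g₂ : gvertex mate₂ ≡ x P
      g₂ = trans (sym (proj₂ (All.head (All.tail pure₁)))) gw
      beyond : ∀ {a} → (∀ {c} → gvertex c ≡ x P → a ≢ c) → a ∈ flat rest
      beyond {a} ne with ∈-resp-↭ flat↭ (proj₂ pf₀ a)
      ... | here e = contradiction e (ne gu)
      ... | there (here e) = contradiction e (ne g₁)
      ... | there (there (here e)) = contradiction e (ne gw)
      ... | there (there (there (here e))) = contradiction e (ne g₂)
      ... | there (there (there (there m))) = m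
      ps : Pick s₀ rest
      ps = pick rest (beyond at-x≢s)
      t∈ : t₀ ∈ flat (Pick.rest ps)
      t∈ with ∈-resp-↭ (Pick.flat↭ ps) (beyond at-x≢t)
      ... | here ()
      ... | there (here e) = contradiction (trans (proj₁ (All.head (Pick.all ps same-sym (All.tail (All.tail pure₁))))) (cong side (sym e))) (λ ())
      ... | there (there k) = k
    first : Pick u₀ N₀ → Goal
    first pu = second (pick₂ pu w∈)
      where
      w∈ : w₀ ∈ flat (Pick.rest pu)
      w∈ with ∈-resp-↭ (Pick.flat↭ pu) (proj₂ pf₀ w₀)
      ... | here ()
      ... | there (here e) = contradiction (trans (proj₁ (All.head (Pick.all pu same-sym pure₀))) (cong side (sym e))) (λ ())
      ... | there (there m) = m

  abstract
    join-rot : (RA : Rot A) (RB : Rot B) → Σ (Rot P) λ R → CA.αc (Rot.list RA) + CB.αc (Rot.list RB) ≤ CP.αc (Rot.list R) + 1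
    join-rot RA RB = proj₁ S , ≤-trans (≤-reflexive (sym (Halves.number (αF A) (αF B) (Rot.list RA) (Rot.list RB)))) (proj₂ S)
      where
      N₀ : List (Φ × Φ)
      N₀ = halves (Rot.list RA) (Rot.list RB)
      levA : ∀ L → AllP (λ a b → vertex A a ≡ vertex A b) L → AllP SameVertex (map (both inj₁) L)
      levA [] [] = []
      levA (p ∷ L) (e ∷ es) = (refl , cong φA e) ∷ levA L es
      levB : ∀ L → AllP (λ a b → vertex B a ≡ vertex B b) L → AllP SameVertex (map (both inj₂) L)
      levB [] [] = []
      levB (p ∷ L) (e ∷ es) = (refl , cong φB e) ∷ levB L es
      climb₀ : ∀ a b → SameVertex a b → Conn (N₀ ++ Eβ.pairs) a b
      climb₀ (inj₁ a) (inj₁ b) (_ , e) = Halves.inA (βF A) (βF B) (Rot.list RA) (Rot.list RB) (Rot.transitive RA a b (φA-inj _ _ e))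
      climb₀ (inj₂ a) (inj₂ b) (_ , e) = Halves.inB (βF A) (βF B) (Rot.list RA) (Rot.list RB) (Rot.transitive RB a b (φB-inj _ _ e))
      S : Σ (Rot P) λ R → αc N₀ ≤ CP.αc (Rot.list R) + 1
      S = splice-rot N₀ (halves-perfect (Rot.list RA) (Rot.list RB) (Rot.perfect RA) (Rot.perfect RB))
        (All-++ (levA (Rot.list RA) (Rot.level RA)) (levB (Rot.list RB) (Rot.level RB))) climb₀

  -- Counts in an amalgamation and additivity of the Euler genus

  vertices-sum : n A + n B ≡ n P + 2
  vertices-sum = nc-unique {R = _≡_} {S = _≡_} h onto inj (λ _ _ → cong h) (fin-sum (fin-Fin (n A)) (fin-Fin (n B))) (fin-sum (fin-Fin (n P)) (fin-Fin 2))
    where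
    hb : ∀ b → Dec (b ≡ x B) → Dec (b ≡ y B) → Fin (n P) ⊎ Fin 2
    hb b (yes _) _ = inj₂ F.zero
    hb b (no _) (yes _) = inj₂ (F.suc F.zero)
    hb b (no _) (no _) = inj₁ (φB b)
    h : Fin (n A) ⊎ Fin (n B) → Fin (n P) ⊎ Fin 2
    h (inj₁ a) = inj₁ (φA a)
    h (inj₂ b) = hb b (b F.≟ x B) (b F.≟ y B)
    onto : ∀ c → ∃ λ a → h a ≡ c
    onto (inj₂ F.zero) = inj₂ (x B) , lem (x B F.≟ x B) (x B F.≟ y B)
      where
      lem : ∀ p q → hb (x B) p q ≡ inj₂ F.zero
      lem (yes _) _ = refl
      lem (no n) _ = contradiction refl n
    onto (inj₂ (F.suc F.zero)) = inj₂ (y B) , lem (y B F.≟ x B) (y B F.≟ y B)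
      where
      lem : ∀ p q → hb (y B) p q ≡ inj₂ (F.suc F.zero)
      lem (yes e) _ = contradiction (sym e) (x≢y B)
      lem (no _) (yes _) = refl
      lem (no _) (no n) = contradiction refl n
    onto (inj₁ v) with cover v
    ... | inj₁ (a , refl) = inj₁ a , refl
    ... | inj₂ (b , refl) = lem (b F.≟ x B) (b F.≟ y B) refl
      where
      lem : ∀ p q → h (inj₂ b) ≡ hb b p q → ∃ λ c → h c ≡ inj₁ (φB b)
      lem (yes refl) _ _ = inj₁ (x A) , cong inj₁ (trans φA-x (sym φB-x))
      lem (no _) (yes refl) _ = inj₁ (y A) , cong inj₁ (trans φA-y (sym φB-y))
      lem (no _) (no _) e = inj₂ b , e
    inj : ∀ a b → h a ≡ h b → a ≡ b
    inj (inj₁ a) (inj₁ b) e = cong inj₁ (φA-inj _ _ (inj₁-injective e))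
    inj (inj₂ a) (inj₂ b) e = lem (a F.≟ x B) (a F.≟ y B) (b F.≟ x B) (b F.≟ y B) e
      where
      lem : ∀ p q r s → hb a p q ≡ hb b r s → inj₂ a ≡ inj₂ b
      lem (yes refl) _ (yes refl) _ _ = refl
      lem (no _) (yes refl) (no _) (yes refl) _ = refl
      lem (no _) (no _) (no _) (no _) e = cong inj₂ (φB-inj _ _ (inj₁-injective e))
      lem (yes _) _ (no _) (yes _) ()
      lem (yes _) _ (no _) (no _) ()
      lem (no _) (yes _) (yes _) _ ()
      lem (no _) (yes _) (no _) (no _) ()
    inj (inj₁ a) (inj₂ b) e = lem (b F.≟ x B) (b F.≟ y B) e
      where
      lem : ∀ p q → inj₁ (φA a) ≡ hb b p q → inj₁ a ≡ inj₂ b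
      lem (no n) (no n') e with common (inj₁-injective e)
      ... | inj₁ (_ , q) = contradiction q n
      ... | inj₂ (_ , q) = contradiction q n'
    inj (inj₂ b) (inj₁ a) e = lem (b F.≟ x B) (b F.≟ y B) e
      where
      lem : ∀ p q → hb b p q ≡ inj₁ (φA a) → inj₂ b ≡ inj₁ a
      lem (no n) (no n') e with common (sym (inj₁-injective e))
      ... | inj₁ (_ , q) = contradiction q n
      ... | inj₂ (_ , q) = contradiction q n'

  edges-sum : numEdges A + numEdges B ≡ numEdges P + 1
  edges-sum = nc-unique {R = Sum (Undirected A) (Undirected B)} {S = Sum (Undirected P) (_≡_ {A = ⊤})} h onto reflects preserves
      (nc-sum (nc-edges A) (nc-edges B)) (nc-sum (nc-edges P) fin-⊤)
    where
    S : Dart P ⊎ ⊤ → Dart P ⊎ ⊤ → Set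
    S = Sum (Undirected P) (_≡_ {A = ⊤})
    hb : ∀ d → Dec (TB.Spec d) → Dart P ⊎ ⊤
    hb d (yes _) = inj₂ tt
    hb d (no _) = inj₁ (gB d)
    h : Dart A ⊎ Dart B → Dart P ⊎ ⊤
    h (inj₁ d) = inj₁ (gA d)
    h (inj₂ d) = hb d (TB.spec? d)
    h-spec : ∀ d → TB.Spec d → h (inj₂ d) ≡ inj₂ tt
    h-spec d c with TB.spec? d
    ... | yes _ = refl
    ... | no n = contradiction c n
    h-not : ∀ d → ¬ TB.Spec d → h (inj₂ d) ≡ inj₁ (gB d)
    h-not d n with TB.spec? d
    ... | yes c = contradiction c n
    ... | no _ = refl
    undir : ∀ {d d'} → d ≡ d' → Undirected P d d'
    undir e = inj₁ (sym e)
    onto : ∀ b → ∃ λ a → S (h a) b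
    onto (inj₂ tt) = inj₂ (TB.eD true) , subst (λ z → S z (inj₂ tt)) (sym (h-spec _ (true , refl))) refl
    onto (inj₁ (p , q , e)) with edges e
    ... | inj₁ (a , b , refl , refl , ea) = inj₁ (a , b , ea) , undir (dart-≡ P refl refl)
    ... | inj₂ (a , b , refl , refl , eb) = lem (TB.spec? (a , b , eb))
      where
      lem : Dec (TB.Spec (a , b , eb)) → ∃ λ c → S (h c) (inj₁ (φB a , φB b , e))
      lem (no n) = inj₂ (a , b , eb) , subst (λ z → S z (inj₁ (φB a , φB b , e))) (sym (h-not _ n)) (undir (dart-≡ P refl refl))
      lem (yes (z , r)) = inj₁ (TA.eD z) , undir (trans (gA-eD z) (trans (sym (gB-eD z)) (trans (cong gB (sym r)) (dart-≡ P refl refl))))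
    liftA : ∀ {d d'} → Undirected A d d' → Undirected P (gA d) (gA d')
    liftA (inj₁ refl) = inj₁ refl
    liftA {d} (inj₂ refl) = inj₂ (gA-rev d)
    liftB : ∀ {d d'} → Undirected B d d' → Undirected P (gB d) (gB d')
    liftB (inj₁ refl) = inj₁ refl
    liftB {d} (inj₂ refl) = inj₂ (gB-rev d)
    lowA : ∀ {d d'} → Undirected P (gA d) (gA d') → Undirected A d d'
    lowA (inj₁ e) = inj₁ (gA-inj e)
    lowA {d} (inj₂ e) = inj₂ (gA-inj (trans e (sym (gA-rev d))))
    lowB : ∀ {d d'} → Undirected P (gB d) (gB d') → Undirected B d d'
    lowB (inj₁ e) = inj₁ (gB-inj e)
    lowB {d} (inj₂ e) = inj₂ (gB-inj (trans e (sym (gB-rev d))))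
    spec-eq : ∀ z z' → Undirected B (TB.eD z) (TB.eD z')
    spec-eq true true = inj₁ refl
    spec-eq false false = inj₁ refl
    spec-eq true false = inj₂ (sym (TB.rev-eD true))
    spec-eq false true = inj₂ (sym (TB.rev-eD false))
    not-both : ∀ {d d'} → ¬ TB.Spec d' → ¬ Undirected P (gA d) (gB d')
    not-both n (inj₁ e) = let z , _ , r = cross (sym e) in n (z , r)
    not-both {d} n (inj₂ e) = let z , _ , r = cross (trans (gA-rev d) (sym e)) in n (z , r)
    reflects : ∀ a b → S (h a) (h b) → Sum (Undirected A) (Undirected B) a b
    reflects (inj₁ d) (inj₁ d') s = lowA s
    reflects (inj₂ d) (inj₂ d') s with TB.spec? d | TB.spec? d'
    ... | yes (z , refl) | yes (z' , refl) = spec-eq z z'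
    ... | no _ | no _ = lowB s
    reflects (inj₁ d) (inj₂ d') s with TB.spec? d'
    ... | no n = contradiction s (not-both n)
    reflects (inj₂ d) (inj₁ d') s with TB.spec? d
    ... | no n = contradiction (esym (undirected-equiv P) s) (not-both n)
    preserves : ∀ a b → Sum (Undirected A) (Undirected B) a b → S (h a) (h b)
    preserves (inj₁ d) (inj₁ d') s = liftA s
    preserves (inj₂ d) (inj₂ d') s with TB.spec? d | TB.spec? d'
    ... | yes _ | yes _ = refl
    ... | no _ | no _ = liftB s
    ... | yes c | no n = contradiction (move c s) n
      where
      move : TB.Spec d → Undirected B d d' → TB.Spec d'
      move c (inj₁ e) = subst TB.Spec (sym e) c
      move c (inj₂ e) = subst TB.Spec (sym e) (TB.spec-rev c)
    ... | no n | yes c = contradiction (move c (esym (undirected-equiv B) s)) n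
      where
      move : TB.Spec d' → Undirected B d' d → TB.Spec d
      move c (inj₁ e) = subst TB.Spec (sym e) c
      move c (inj₂ e) = subst TB.Spec (sym e) (TB.spec-rev c)

  noEdge : ∀ (G : Graph) {a b} → ¬ Edge G a b → adj G a b ≡ false
  noEdge G {a} {b} n with adj G a b
  ... | true = contradiction tt n
  ... | false = refl

  -- The terminals are ends of the edge xy, so an isolated vertex lies in one part only and is not
  -- counted twice.
  isolates-sum : isolates A + isolates B ≡ isolates P
  isolates-sum = nc-unique {R = Sum (SameIsolated A) (SameIsolated B)} {S = SameIsolated P} h onto reflects preserves
      (nc-sum (nc-isolates A) (nc-isolates B)) (nc-isolates P)
    where
    not-common-A : ∀ {a b} → Isolated A a → φA a ≢ φB b
    not-common-A i e with common e
    ... | inj₁ (refl , _) = subst T (i (y A)) xyA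
    ... | inj₂ (refl , _) = subst T (i (x A)) (edge-sym A xyA)
    not-common-B : ∀ {a b} → Isolated B b → φA a ≢ φB b
    not-common-B i e with common e
    ... | inj₁ (_ , refl) = subst T (i (y B)) xyB
    ... | inj₂ (_ , refl) = subst T (i (x B)) (edge-sym B xyB)
    upA : ∀ {a} → Isolated A a → Isolated P (φA a)
    upA {a} i w = noEdge P λ e → case edges e of λ
      { (inj₁ (a' , b' , p , q , ea)) → subst T (trans (cong (λ z → adj A z b') (φA-inj _ _ p)) (i b')) ea
      ; (inj₂ (a' , b' , p , q , eb)) → not-common-A i (sym p) }
    upB : ∀ {b} → Isolated B b → Isolated P (φB b)
    upB {b} i w = noEdge P λ e → case edges e of λ
      { (inj₂ (a' , b' , p , q , eb)) → subst T (trans (cong (λ z → adj B z b') (φB-inj _ _ p)) (i b')) eb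
      ; (inj₁ (a' , b' , p , q , ea)) → not-common-B i p }
    h : Σ (Fin (n A)) (Isolated A) ⊎ Σ (Fin (n B)) (Isolated B) → Σ (Fin (n P)) (Isolated P)
    h (inj₁ (a , i)) = φA a , upA i
    h (inj₂ (b , i)) = φB b , upB i
    onto : ∀ b → ∃ λ a → SameIsolated P (h a) b
    onto (v , i) with cover v
    ... | inj₁ (a , refl) = inj₁ (a , λ b → noEdge A λ e → subst T (i (φA b)) (edgeA e)) , refl
    ... | inj₂ (b , refl) = inj₂ (b , λ c → noEdge B λ e → subst T (i (φB c)) (edgeB e)) , refl
    reflects : ∀ a b → SameIsolated P (h a) (h b) → Sum (SameIsolated A) (SameIsolated B) a b
    reflects (inj₁ a) (inj₁ b) e = φA-inj _ _ e
    reflects (inj₂ a) (inj₂ b) e = φB-inj _ _ e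
    reflects (inj₁ a) (inj₂ b) e = not-common-A (proj₂ a) e
    reflects (inj₂ a) (inj₁ b) e = not-common-A (proj₂ b) (sym e)
    preserves : ∀ a b → Sum (SameIsolated A) (SameIsolated B) a b → SameIsolated P (h a) (h b)
    preserves (inj₁ a) (inj₁ b) e = cong φA e
    preserves (inj₂ a) (inj₂ b) e = cong φB e

  -- Only the two copies of x are identified explicitly. The copies of y then agree through the edge
  -- xy, so exactly one class is lost.
  components-sum : components A + components B ≡ components P + 1
  components-sum = trans (nc-unique {R = Sum (Star (Edge A)) (Star (Edge B))} {S = Conn L} id (λ b → b , crefl) split gather
      (nc-sum (nc-components A) (nc-components B)) (W.nc-cls L))
    (trans (W.cls-merge L (λ c → split _ _ c)) (trans (+-comm 1 _) (cong (_+ 1)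
      (nc-unique {R = Conn L⁺} {S = Star (Edge P)} φ onto reflects (λ _ _ → down) (W.nc-cls L⁺) (nc-components P)))))
    where
    X : Set
    X = Fin (n A) ⊎ Fin (n B)
    module W = Classes (fin-sum (fin-Fin (n A)) (fin-Fin (n B)))
    L L⁺ : List (X × X)
    L = map (both inj₁) (edgeList A) ++ map (both inj₂) (edgeList B)
    L⁺ = (inj₁ (x A) , inj₂ (x B)) ∷ L
    φ : X → Fin (n P)
    φ (inj₁ a) = φA a
    φ (inj₂ b) = φB b
    split : ∀ a b → Conn L a b → Sum (Star (Edge A)) (Star (Edge B)) a b
    split _ _ = conn-fold (sum-equiv (star-equiv A) (star-equiv B)) λ m → case ∈-++⁻ (map (both inj₁) (edgeList A)) m of λ
      { (inj₁ k) → case ∈-map⁻ _ k of λ { (_ , j , refl) → conn⇒star A (edge j) }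
      ; (inj₂ k) → case ∈-map⁻ _ k of λ { (_ , j , refl) → conn⇒star B (edge j) } }
    gather : ∀ a b → Sum (Star (Edge A)) (Star (Edge B)) a b → Conn L a b
    gather (inj₁ a) (inj₁ b) s = conn-fold (pull-equiv inj₁ (conn-equiv L)) (λ m → edge (∈-++⁺ˡ (∈-map⁺ (both inj₁) m))) (star⇒conn A s)
    gather (inj₂ a) (inj₂ b) s = conn-fold (pull-equiv inj₂ (conn-equiv L)) (λ m → edge (∈-++⁺ʳ (map (both inj₁) (edgeList A)) (∈-map⁺ (both inj₂) m))) (star⇒conn B s)
    step : ∀ a b → Sum (Star (Edge A)) (Star (Edge B)) a b → Star (Edge P) (φ a) (φ b)
    step (inj₁ a) (inj₁ b) = gmap φA edgeA
    step (inj₂ a) (inj₂ b) = gmap φB edgeB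
    down : ∀ {a b} → Conn L⁺ a b → Star (Edge P) (φ a) (φ b)
    down = conn-fold (pull-equiv φ (star-equiv P)) λ
      { (here refl) → subst (Star (Edge P) (φA (x A))) (trans φA-x (sym φB-x)) ε
      ; {a} {b} (there m) → step a b (split a b (edge m)) }
    pA : ∀ {a b} → Edge A a b → Conn L⁺ (inj₁ a) (inj₁ b)
    pA e = conn-wk (gather (inj₁ _) (inj₁ _) (e ◅ ε))
    pB : ∀ {a b} → Edge B a b → Conn L⁺ (inj₂ a) (inj₂ b)
    pB e = conn-wk (gather (inj₂ _) (inj₂ _) (e ◅ ε))
    same-A-B : ∀ {a b} → φA a ≡ φB b → Conn L⁺ (inj₁ a) (inj₂ b)
    same-A-B e with common e
    ... | inj₁ (refl , refl) = edge (here refl)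
    ... | inj₂ (refl , refl) = ctrans (csym (pA xyA)) (ctrans (edge (here refl)) (pB xyB))
    same : ∀ a b → φ a ≡ φ b → Conn L⁺ a b
    same (inj₁ a) (inj₁ b) e = ≡⇒conn (cong inj₁ (φA-inj _ _ e))
    same (inj₂ a) (inj₂ b) e = ≡⇒conn (cong inj₂ (φB-inj _ _ e))
    same (inj₁ a) (inj₂ b) e = same-A-B e
    same (inj₂ a) (inj₁ b) e = csym (same-A-B (sym e))
    walk : ∀ {p q} → Star (Edge P) p q → ∀ a b → φ a ≡ p → φ b ≡ q → Conn L⁺ a b
    walk ε a b e e' = same a b (trans e (sym e'))
    walk (e ◅ s) a b p q with edges e
    ... | inj₁ (c , d , r , r' , ea) = ctrans (same a (inj₁ c) (trans p (sym r))) (ctrans (pA ea) (walk s (inj₁ d) b r' q))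
    ... | inj₂ (c , d , r , r' , eb) = ctrans (same a (inj₂ c) (trans p (sym r))) (ctrans (pB eb) (walk s (inj₂ d) b r' q))
    reflects : ∀ a b → Star (Edge P) (φ a) (φ b) → Conn L⁺ a b
    reflects a b s = walk s a b refl refl
    onto : ∀ v → ∃ λ a → Star (Edge P) (φ a) v
    onto v with cover v
    ... | inj₁ (a , refl) = inj₁ a , ε
    ... | inj₂ (b , refl) = inj₂ b , ε

  -- From the parts to `P`, twice the components plus the edges falls by `2 + 1`, and vertices plus
  -- faces falls by at most `2 + 1`. This is the 3 that is cancelled.
  embeds-join : ∀ {a b} → EmbedsIn A a → EmbedsIn B b → EmbedsIn P (a + b)
  embeds-join {a} {b} eA eB = rot⇒embeds P (a + b) (proj₁ J) (ℕₚ.+-cancelʳ-≤ 3 _ _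
      (≤-trans (≤-reflexive (trans (solve 2 (λ c e → con 2 :* c :+ e :+ con 3 := con 2 :* (c :+ con 1) :+ (e :+ con 1)) refl (components P) (numEdges P))
        (trans (cong₂ (λ c e → 2 * c + e) (sym components-sum) (sym edges-sum))
          (solve 4 (λ c d e f → con 2 :* (c :+ d) :+ (e :+ f) := (con 2 :* c :+ e) :+ (con 2 :* d :+ f)) refl (components A) (components B) (numEdges A) (numEdges B)))))
      (≤-trans (ℕₚ.+-mono-≤ (proj₂ rA) (proj₂ rB))
      (≤-trans (≤-reflexive (trans
          (solve 8 (λ n m k l i j a b → (n :+ (k :+ i) :+ a) :+ (m :+ (l :+ j) :+ b) := ((n :+ m) :+ (i :+ j)) :+ (a :+ b) :+ (k :+ l)) refl
            (n A) (n B) (CA.αc (Rot.list (proj₁ rA))) (CB.αc (Rot.list (proj₁ rB))) (isolates A) (isolates B) a b)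
          (cong₂ (λ v i → (v + i) + (a + b) + (CA.αc (Rot.list (proj₁ rA)) + CB.αc (Rot.list (proj₁ rB)))) vertices-sum isolates-sum)))
      (≤-trans (ℕₚ.+-monoʳ-≤ ((n P + 2 + isolates P) + (a + b)) (proj₂ J))
        (≤-reflexive (solve 4 (λ n i k g → (n :+ con 2 :+ i) :+ g :+ (k :+ con 1) := n :+ (k :+ i) :+ g :+ con 3) refl
          (n P) (isolates P) (CP.αc (Rot.list (proj₁ J))) (a + b))))))))
    where
    open +-*-Solver
    rA = embeds⇒rot A a eA
    rB = embeds⇒rot B b eB
    J : Σ (Rot P) λ R → CA.αc (Rot.list (proj₁ rA)) + CB.αc (Rot.list (proj₁ rB)) ≤ CP.αc (Rot.list R) + 1
    J = join-rot (proj₁ rA) (proj₁ rB)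

  embeds-split : ∀ {g} → EmbedsIn P g → ∃ λ a → ∃ λ b → EmbedsIn A a × EmbedsIn B b × a + b ≤ g
  embeds-split {g} e = a , b , rot⇒embeds A a RA (≤-reflexive (sym a≡)) , rot⇒embeds B b RB (≤-reflexive (sym b≡)) , total
    where
    open +-*-Solver
    rP = embeds⇒rot P g e
    S : Parts (CP.αc (Rot.list (proj₁ rP)) + 1) (CP.βc (Rot.list (proj₁ rP)))
    S = split-rot (proj₁ rP)
    RA : Rot A
    RA = Parts.RA S
    RB : Rot B
    RB = Parts.RB S
    kP = CP.αc (Rot.list (proj₁ rP))
    kA = CA.αc (Rot.list RA)
    kB = CB.αc (Rot.list RB)
    vP = CP.βc (Rot.list (proj₁ rP))
    vA = CA.βc (Rot.list RA)
    vB = CB.βc (Rot.list RB)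
    XA = n A + (kA + isolates A)
    XB = n B + (kB + isolates B)
    -- The genera of the two rotations themselves; their sum is compared with `g` only afterwards.
    a = (2 * components A + numEdges A) ∸ XA
    b = (2 * components B + numEdges B) ∸ XB
    a≡ : XA + a ≡ 2 * components A + numEdges A
    a≡ = ℕₚ.m+[n∸m]≡n (euler-genus-nonneg A RA)
    b≡ : XB + b ≡ 2 * components B + numEdges B
    b≡ = ℕₚ.m+[n∸m]≡n (euler-genus-nonneg B RB)
    verts : vA + vB ≡ vP + 2
    verts = ℕₚ.+-cancelʳ-≡ (isolates P) _ _ (trans (cong (vA + vB +_) (sym isolates-sum))
      (trans (solve 4 (λ p q i j → (p :+ q) :+ (i :+ j) := (p :+ i) :+ (q :+ j)) refl vA vB (isolates A) (isolates B))
        (trans (cong₂ _+_ (vertices-count A RA) (vertices-count B RB)) (trans vertices-sum (trans (cong (_+ 2) (sym (vertices-count P (proj₁ rP))))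
          (solve 2 (λ p i → (p :+ i) :+ con 2 := (p :+ con 2) :+ i) refl vP (isolates P)))))))
    -- The loss of 2 permitted by `Parts.ineq` is cancelled by the two vertices that the parts have
    -- in excess. The 1 on the left is the digon.
    faces : kP + 1 ≤ kA + kB
    faces = ℕₚ.+-cancelʳ-≤ (vP + 2) _ _ (subst₂ _≤_ (cong (kP + 1 +_) verts) (+-assoc (kA + kB) vP 2) (Parts.ineq S))
    total : a + b ≤ g
    total = ℕₚ.+-cancelʳ-≤ (XA + XB) _ _ (≤-trans
      (≤-reflexive (trans (solve 4 (λ a b p q → (a :+ b) :+ (p :+ q) := (p :+ a) :+ (q :+ b)) refl a b XA XB) (trans (cong₂ _+_ a≡ b≡)
        (trans (solve 4 (λ c d e f → (con 2 :* c :+ e) :+ (con 2 :* d :+ f) := con 2 :* (c :+ d) :+ (e :+ f)) refl (components A) (components B) (numEdges A) (numEdges B))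
          (trans (cong₂ (λ c e → 2 * c + e) components-sum edges-sum)
            (solve 2 (λ c e → con 2 :* (c :+ con 1) :+ (e :+ con 1) := con 2 :* c :+ e :+ con 3) refl (components P) (numEdges P)))))))
      (≤-trans (ℕₚ.+-monoˡ-≤ 3 (proj₂ rP)) (≤-trans
        (≤-reflexive (solve 4 (λ n k i g → n :+ (k :+ i) :+ g :+ con 3 := g :+ ((n :+ con 2) :+ i) :+ (k :+ con 1)) refl (n P) kP (isolates P) g))
        (≤-trans (ℕₚ.+-monoʳ-≤ (g + ((n P + 2) + isolates P)) faces) (≤-reflexive (trans (cong₂ (λ v i → g + (v + i) + (kA + kB)) (sym vertices-sum) (sym isolates-sum))
          (solve 7 (λ g n m i j k l → g :+ ((n :+ m) :+ (i :+ j)) :+ (k :+ l) := g :+ ((n :+ (k :+ i)) :+ (m :+ (l :+ j)))) refl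
            g (n A) (n B) (isolates A) (isolates B) kA kB)))))))

-- Minors and decompositions of xy-sums

T-∨ : ∀ {a b} → T (a ∨ b) → T a ⊎ T b
T-∨ {true} _ = inj₁ tt
T-∨ {false} t = inj₂ t

T-∨ˡ : ∀ {a b} → T a → T (a ∨ b)
T-∨ˡ {true} _ = tt

T-∨ʳ : ∀ {a b} → T b → T (a ∨ b)
T-∨ʳ {true} _ = tt
T-∨ʳ {false} t = t

same? : ∀ {m} (a b u v : Fin m) → Dec (SamePair a b u v)
same? a b u v = ((a F.≟ u) ×-dec (b F.≟ v)) ⊎-dec ((a F.≟ v) ×-dec (b F.≟ u))

same-swap : ∀ {A : Set} {a b u v : A} → SamePair a b u v → SamePair b a u v
same-swap (inj₁ (p , q)) = inj₂ (q , p)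
same-swap (inj₂ (p , q)) = inj₁ (q , p)

same-flip : ∀ {A : Set} {a b u v : A} → SamePair a b u v → SamePair u v a b
same-flip (inj₁ (p , q)) = inj₁ (sym p , sym q)
same-flip (inj₂ (p , q)) = inj₂ (sym q , sym p)

same-map : ∀ {A B : Set} (f : A → B) {a b u v : A} → SamePair a b u v → SamePair (f a) (f b) (f u) (f v)
same-map f (inj₁ (p , q)) = inj₁ (cong f p , cong f q)
same-map f (inj₂ (p , q)) = inj₂ (cong f p , cong f q)

same-map⁻ : ∀ {A B : Set} {f : A → B} → (∀ a b → f a ≡ f b → a ≡ b) → ∀ {a b u v : A} →
  SamePair (f a) (f b) (f u) (f v) → SamePair a b u v
same-map⁻ inj (inj₁ (p , q)) = inj₁ (inj _ _ p , inj _ _ q)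
same-map⁻ inj (inj₂ (p , q)) = inj₂ (inj _ _ p , inj _ _ q)

edge-≢ : ∀ (G : Graph) {a b} → Edge G a b → a ≢ b
edge-≢ G e refl = subst T (adj-irr G _) e

module _ (G : Graph) where
  plus-edge : ∀ {p q} → Edge G p q → Edge (plus G) p q
  plus-edge = T-∨ˡ

  xyPair⁺ : ∀ {p q} → SamePair p q (x G) (y G) → T (isXYPair G p q)
  xyPair⁺ (inj₁ (refl , refl)) with x G F.≟ x G | y G F.≟ y G
  ... | yes _ | yes _ = tt
  ... | no n | _ = contradiction refl n
  ... | yes _ | no n = contradiction refl n
  xyPair⁺ (inj₂ (refl , refl)) with x G F.≟ x G | y G F.≟ y G
  ... | yes _ | yes _ = T-∨ʳ {⌊ y G F.≟ x G ⌋ ∧ ⌊ x G F.≟ y G ⌋} tt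
  ... | no n | _ = contradiction refl n
  ... | yes _ | no n = contradiction refl n

  xyPair⁻ : ∀ {p q} → T (isXYPair G p q) → SamePair p q (x G) (y G)
  xyPair⁻ {p} {q} t with p F.≟ x G | q F.≟ y G | p F.≟ y G | q F.≟ x G
  ... | yes a | yes b | _ | _ = inj₁ (a , b)
  ... | yes _ | no _ | yes c | yes d = inj₂ (c , d)
  ... | no _ | _ | yes c | yes d = inj₂ (c , d)

  plus-pair : ∀ {p q} → SamePair p q (x G) (y G) → Edge (plus G) p q
  plus-pair {p} {q} s = T-∨ʳ {adj G p q} (xyPair⁺ s)

  plus-cases : ∀ {p q} → Edge (plus G) p q → Edge G p q ⊎ SamePair p q (x G) (y G)
  plus-cases {p} {q} e with T-∨ {adj G p q} e
  ... | inj₁ t = inj₁ t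
  ... | inj₂ t = inj₂ (xyPair⁻ t)

sum-sym : ∀ {G G₁ G₂} → XYSum G G₁ G₂ → XYSum G G₂ G₁
sum-sym {G} S = record
  { φ₁ = φ₂ ; φ₂ = φ₁ ; φ₁-inj = φ₂-inj ; φ₂-inj = φ₁-inj ; φ₁-x = φ₂-x ; φ₁-y = φ₂-y ; φ₂-x = φ₁-x ; φ₂-y = φ₁-y
  ; cover = λ w → swap′ (cover w)
  ; shared = λ a b e → subst (λ w → w ≡ x G ⊎ w ≡ y G) (sym e) (shared b a (sym e))
  ; edges = λ p q → swap′ ∘ proj₁ (edges p q) , proj₂ (edges p q) ∘ swap′ }
  where
  open XYSum S
  swap′ : ∀ {A B : Set} → A ⊎ B → B ⊎ A
  swap′ = [ inj₂ , inj₁ ]′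

sum⇒amalg : ∀ {G G₁ G₂} → XYSum G G₁ G₂ → Amalg (plus G) (plus G₁) (plus G₂)
sum⇒amalg {G} {G₁} {G₂} S = record
  { φA = φ₁ ; φB = φ₂ ; φA-inj = φ₁-inj ; φB-inj = φ₂-inj ; φA-x = φ₁-x ; φA-y = φ₁-y ; φB-x = φ₂-x ; φB-y = φ₂-y
  ; cover = cover ; shared = shared
  ; edgeA = λ e → [ (λ e → plus-edge G (proj₂ (edges _ _) (inj₁ (_ , _ , refl , refl , e))))
                  , (λ s → plus-pair G (subst₂ (SamePair _ _) φ₁-x φ₁-y (same-map φ₁ s))) ]′ (plus-cases G₁ e)
  ; edgeB = λ e → [ (λ e → plus-edge G (proj₂ (edges _ _) (inj₂ (_ , _ , refl , refl , e))))
                  , (λ s → plus-pair G (subst₂ (SamePair _ _) φ₂-x φ₂-y (same-map φ₂ s))) ]′ (plus-cases G₂ e)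
  ; edges = λ e → [ (λ e → [ (λ (a , b , p , q , e) → inj₁ (a , b , p , q , plus-edge G₁ e))
                           , (λ (a , b , p , q , e) → inj₂ (a , b , p , q , plus-edge G₂ e)) ]′ (proj₁ (edges _ _) e))
                  , terminal ]′ (plus-cases G e)
  ; xyA = plus-pair G₁ (inj₁ (refl , refl)) ; xyB = plus-pair G₂ (inj₁ (refl , refl)) }
  where
  open XYSum S
  terminal : ∀ {p q} → SamePair p q (x G) (y G) →
    (∃ λ a → ∃ λ b → φ₁ a ≡ p × φ₁ b ≡ q × Edge (plus G₁) a b) ⊎ (∃ λ a → ∃ λ b → φ₂ a ≡ p × φ₂ b ≡ q × Edge (plus G₂) a b)
  terminal (inj₁ (refl , refl)) = inj₁ (x G₁ , y G₁ , φ₁-x , φ₁-y , plus-pair G₁ (inj₁ (refl , refl)))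
  terminal (inj₂ (refl , refl)) = inj₁ (y G₁ , x G₁ , φ₁-y , φ₁-x , plus-pair G₁ (inj₂ (refl , refl)))

abstract
  join⁺ : ∀ {G G₁ G₂} → XYSum G G₁ G₂ → ∀ {a b} → EmbedsIn (plus G₁) a → EmbedsIn (plus G₂) b → EmbedsIn (plus G) (a + b)
  join⁺ S = Glue.embeds-join (sum⇒amalg S)

  split⁺ : ∀ {G G₁ G₂} → XYSum G G₁ G₂ → ∀ {g} → EmbedsIn (plus G) g →
    ∃ λ a → ∃ λ b → EmbedsIn (plus G₁) a × EmbedsIn (plus G₂) b × a + b ≤ g
  split⁺ S = Glue.embeds-split (sum⇒amalg S)

  embeds-somewhere : ∀ G → ∃ λ g → EmbedsIn G g
  embeds-somewhere G = 2 * components G + numEdges G , rot⇒embeds G (2 * components G + numEdges G) (rot-exists G)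
    (ℕₚ.m≤n+m (2 * components G + numEdges G) (n G + (C.αc G (Rot.list (rot-exists G)) + isolates G)))

-- Joining optimal embeddings gives the upper bound, and splitting an arbitrary embedding gives the
-- lower one.
genus-sum : ∀ {G G₁ G₂} → XYSum G G₁ G₂ → ∀ {a b} → IsEulerGenus⁺ G₁ a → IsEulerGenus⁺ G₂ b → IsEulerGenus⁺ G (a + b)
genus-sum S (ea , ma) (eb , mb) = join⁺ S ea eb , λ g e → let c , d , ec , ed , le = split⁺ S e in
  ≤-trans (ℕₚ.+-mono-≤ (ma c ec) (mb d ed)) le

genus-unique : ∀ {G a b} → IsEulerGenus G a → IsEulerGenus G b → a ≡ b
genus-unique (ea , ma) (eb , mb) = ≤-antisym (ma _ eb) (mb _ ea)

-- `EmbedsIn` is not decided, so the least number principle holds up to double negation: without a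
-- least genus the graph would embed nowhere, by descent.
genus-exists : ∀ G → ¬ ¬ (∃ λ g → IsEulerGenus G g)
genus-exists G none = never _ (proj₁ (embeds-somewhere G)) ≤-refl (proj₂ (embeds-somewhere G))
  where
  never : ∀ n g → g ≤ n → ¬ EmbedsIn G g
  never n g le e = none (g , e , λ g' e' → case g ℕₚ.≤? g' of λ
    { (yes p) → p ; (no np) → ⊥-elim (smaller n g le g' (ℕₚ.≰⇒> np) e') })
    where
    smaller : ∀ n g → g ≤ n → ∀ g' → g' < g → ¬ EmbedsIn G g'
    smaller zero g le g' lt = contradiction (≤-trans lt le) (λ ())
    smaller (suc n) g le g' lt = never n g' (ℕₚ.≤-pred (≤-trans lt le))

relation-graph : ∀ {m} (R : Fin m → Fin m → Set) (R? : ∀ a b → Dec (R a b)) → (∀ {a b} → R a b → R b a) → (∀ {a} → ¬ R a a) →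
  (s t : Fin m) → s ≢ t → Graph
relation-graph {m} R R? R-sym R-irr s t s≢t = record
  { n = m ; adj = λ a b → ⌊ R? a b ⌋ ; adj-sym = λ a b → same (R? a b) (R? b a) ; adj-irr = λ a → irr (R? a a) ; x = s ; y = t ; x≢y = s≢t }
  where
  same : ∀ {a b} (p : Dec (R a b)) (q : Dec (R b a)) → ⌊ p ⌋ ≡ ⌊ q ⌋
  same (yes _) (yes _) = refl
  same (no _) (no _) = refl
  same (yes p) (no n) = contradiction (R-sym p) n
  same (no n) (yes p) = contradiction (R-sym p) n
  irr : ∀ {a} (p : Dec (R a a)) → ⌊ p ⌋ ≡ false
  irr (yes p) = contradiction p R-irr
  irr (no _) = refl

deletion : ∀ G {u v} → Edge G u v → Σ Graph λ H → DeleteEdge G H u v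
deletion G {u} {v} e = relation-graph R R? (λ (e , n) → edge-sym G e , n ∘ same-swap) (λ (e , _) → edge-≢ G e refl) (x G) (y G) (x≢y G) ,
  record { isEdge = e ; π = id ; π-inj = λ _ _ → id ; π-surj = λ p → p , refl ; π-x = refl ; π-y = refl
         ; π-adj = λ a b → toWitness , fromWitness }
  where
  R : Fin (n G) → Fin (n G) → Set
  R a b = Edge G a b × ¬ SamePair a b u v
  R? : ∀ a b → Dec (R a b)
  R? a b = T? (adj G a b) ×-dec ¬? (same? a b u v)

record Identification {m} (u v : Fin m) : Set where
  field
    size : ℕ
    π : Fin m → Fin size
    π-uv : π u ≡ π v
    π-inj : ∀ a b → π a ≡ π b → a ≡ b ⊎ SamePair a b u v
    π-surj : ∀ p → ∃ λ a → π a ≡ p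

-- `v` is punched out of the vertex set and sent to the image of `u`.
identify : ∀ {m} (u v : Fin m) → u ≢ v → Identification u v
identify {suc m} u v u≢v = record { size = m ; π = π ; π-uv = π-uv ; π-inj = λ a b → π-inj a b (v F.≟ a) (v F.≟ b) ; π-surj = π-surj }
  where
  v≢u : v ≢ u
  v≢u = ≢-sym u≢v
  go : ∀ a → Dec (v ≡ a) → Fin m
  go a (yes _) = punchOut v≢u
  go a (no n) = punchOut n
  π : Fin (suc m) → Fin m
  π a = go a (v F.≟ a)
  go-≢ : ∀ {a} (n : v ≢ a) (d : Dec (v ≡ a)) → go a d ≡ punchOut n
  go-≢ n (yes e) = contradiction e n
  go-≢ n (no n') = Fₚ.punchOut-cong v refl
  go-v : ∀ (d : Dec (v ≡ v)) → go v d ≡ punchOut v≢u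
  go-v (yes _) = refl
  go-v (no n) = contradiction refl n
  π-uv : π u ≡ π v
  π-uv = trans (go-≢ v≢u (v F.≟ u)) (sym (go-v (v F.≟ v)))
  π-inj : ∀ a b (d : Dec (v ≡ a)) (e : Dec (v ≡ b)) → go a d ≡ go b e → a ≡ b ⊎ SamePair a b u v
  π-inj a b (yes d) (yes e) _ = inj₁ (trans (sym d) e)
  π-inj a b (no d) (no e) q = inj₁ (Fₚ.punchOut-injective d e q)
  π-inj a b (yes d) (no e) q = inj₂ (inj₂ (sym d , sym (Fₚ.punchOut-injective v≢u e q)))
  π-inj a b (no d) (yes e) q = inj₂ (inj₁ (Fₚ.punchOut-injective d v≢u q , sym e))
  π-surj : ∀ p → ∃ λ a → π a ≡ p
  π-surj p = punchIn v p , trans (go-≢ (λ e → Fₚ.punchInᵢ≢i v p (sym e)) (v F.≟ punchIn v p)) (Fₚ.punchOut-punchIn v)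

contraction : ∀ G {u v} → Edge G u v → ¬ SamePair u v (x G) (y G) → Σ Graph λ H → ContractEdge G H u v
contraction G {u} {v} e nxy = H , record { isEdge = e ; notXY = nxy ; π = π ; π-uv = π-uv ; π-inj = π-inj ; π-surj = π-surj ; π-x = refl ; π-y = refl
    ; π-adj = λ p q → toWitness , fromWitness }
  where
  open Identification (identify u v (edge-≢ G e))
  R : Fin size → Fin size → Set
  R p q = p ≢ q × ∃ λ a → ∃ λ b → π a ≡ p × π b ≡ q × Edge G a b
  R? : ∀ p q → Dec (R p q)
  R? p q = ¬? (p F.≟ q) ×-dec Fₚ.any? (λ a → Fₚ.any? (λ b → (π a F.≟ p) ×-dec ((π b F.≟ q) ×-dec T? (adj G a b))))
  H : Graph
  H = relation-graph R R? (λ (n , a , b , p , q , e) → ≢-sym n , b , a , q , p , edge-sym G e) (λ (n , _) → n refl) (π (x G)) (π (y G))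
    (λ q → [ x≢y G , (λ s → nxy (same-flip s)) ]′ (π-inj _ _ q))

noxy-edge : ∀ G → NoXY G → ∀ {a b} → Edge G a b → ¬ SamePair a b (x G) (y G)
noxy-edge G nx e (inj₁ (refl , refl)) = subst T nx e
noxy-edge G nx e (inj₂ (refl , refl)) = subst T nx (edge-sym G e)

-- Minors of an xy-sum and minors of its parts

module SumMinor {G G₁ G₂ : Graph} (S : XYSum G G₁ G₂) where
  open XYSum S

  edge₁ : ∀ {a b} → Edge G₁ a b → Edge G (φ₁ a) (φ₁ b)
  edge₁ e = proj₂ (edges _ _) (inj₁ (_ , _ , refl , refl , e))
  edge₂ : ∀ {a b} → Edge G₂ a b → Edge G (φ₂ a) (φ₂ b)
  edge₂ e = proj₂ (edges _ _) (inj₂ (_ , _ , refl , refl , e))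

  common₁ : ∀ {a b} → φ₁ a ≡ φ₂ b → a ≡ x G₁ ⊎ a ≡ y G₁
  common₁ {a} {b} e with shared a b e
  ... | inj₁ q = inj₁ (φ₁-inj _ _ (trans q (sym φ₁-x)))
  ... | inj₂ q = inj₂ (φ₁-inj _ _ (trans q (sym φ₁-y)))

  -- Excludes that the edge operated on in `G₁` also joins two vertices of `G₂`: its ends would be
  -- the two terminals.
  both-common : ∀ {a b c d} → a ≢ b → φ₁ a ≡ φ₂ c → φ₁ b ≡ φ₂ d → SamePair a b (x G₁) (y G₁)
  both-common n e e' with common₁ e | common₁ e'
  ... | inj₁ p | inj₂ q = inj₁ (p , q)
  ... | inj₂ p | inj₁ q = inj₂ (p , q)
  ... | inj₁ p | inj₁ q = contradiction (trans p (sym q)) n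
  ... | inj₂ p | inj₂ q = contradiction (trans p (sym q)) n

  pair₁ : ∀ {a b} → SamePair a b (x G₁) (y G₁) → SamePair (φ₁ a) (φ₁ b) (x G) (y G)
  pair₁ s = subst₂ (SamePair _ _) φ₁-x φ₁-y (same-map φ₁ s)

  pair₁⁻ : ∀ {a b} → SamePair (φ₁ a) (φ₁ b) (x G) (y G) → SamePair a b (x G₁) (y G₁)
  pair₁⁻ s = same-map⁻ φ₁-inj (subst₂ (SamePair _ _) (sym φ₁-x) (sym φ₁-y) s)

  module _ {H H₁ : Graph} {a b : Fin (n G₁)} (nx : NoXY G₁) (D₁ : DeleteEdge G₁ H₁ a b) (D : DeleteEdge G H (φ₁ a) (φ₁ b)) where
    private
      module D₁ = DeleteEdge D₁
      module D = DeleteEdge D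
      σ : Fin (n H₁) → Fin (n G₁)
      σ p = proj₁ (D₁.π-surj p)
      πσ : ∀ p → D₁.π (σ p) ≡ p
      πσ p = proj₂ (D₁.π-surj p)
      σπ : ∀ c → σ (D₁.π c) ≡ c
      σπ c = D₁.π-inj _ _ (πσ _)
      not₂ : ∀ {c d} → Edge G₂ c d → ¬ SamePair (φ₂ c) (φ₂ d) (φ₁ a) (φ₁ b)
      not₂ e (inj₁ (p , q)) = noxy-edge G₁ nx D₁.isEdge (both-common (edge-≢ G₁ D₁.isEdge) (sym p) (sym q))
      not₂ e (inj₂ (p , q)) = noxy-edge G₁ nx D₁.isEdge (both-common (edge-≢ G₁ D₁.isEdge) (sym q) (sym p))

    -- Minors are given only up to isomorphism, so `H₁` is mapped into `H` through a section `σ` of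
    -- its vertex map. `G₂` keeps all its edges, because the deleted edge is not xy.
    delete-sum : XYSum H H₁ G₂
    delete-sum = record
      { φ₁ = λ p → D.π (φ₁ (σ p)) ; φ₂ = λ c → D.π (φ₂ c)
      ; φ₁-inj = λ p q e → trans (sym (πσ p)) (trans (cong D₁.π (φ₁-inj _ _ (D.π-inj _ _ e))) (πσ q))
      ; φ₂-inj = λ p q e → φ₂-inj _ _ (D.π-inj _ _ e)
      ; φ₁-x = trans (cong (D.π ∘ φ₁) (trans (cong σ (sym D₁.π-x)) (σπ _))) (trans (cong D.π φ₁-x) D.π-x)
      ; φ₁-y = trans (cong (D.π ∘ φ₁) (trans (cong σ (sym D₁.π-y)) (σπ _))) (trans (cong D.π φ₁-y) D.π-y)
      ; φ₂-x = trans (cong D.π φ₂-x) D.π-x ; φ₂-y = trans (cong D.π φ₂-y) D.π-y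
      ; cover = λ w → let v , e = D.π-surj w in [ (λ (c , q) → inj₁ (D₁.π c , trans (cong (D.π ∘ φ₁) (σπ c)) (trans (cong D.π q) e)))
                                               , (λ (c , q) → inj₂ (c , trans (cong D.π q) e)) ]′ (cover v)
      ; shared = λ p c e → [ (λ q → inj₁ (trans (cong D.π q) D.π-x)) , (λ q → inj₂ (trans (cong D.π q) D.π-y)) ]′ (shared _ _ (D.π-inj _ _ e))
      ; edges = λ p q → down p q , [ up₁ , up₂ ]′ }
      where
      down : ∀ p q → Edge H p q → _ ⊎ _
      down p q e with D.π-surj p | D.π-surj q
      ... | v , refl | w , refl with proj₁ (D.π-adj v w) e
      ...   | e' , ns with proj₁ (edges v w) e'
      ...     | inj₂ (c , d , r , s , e₂) = inj₂ (c , d , cong D.π r , cong D.π s , e₂)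
      ...     | inj₁ (c , d , refl , refl , e₁) = inj₁ (D₁.π c , D₁.π d , cong (D.π ∘ φ₁) (σπ c) , cong (D.π ∘ φ₁) (σπ d) ,
                  proj₂ (D₁.π-adj c d) (e₁ , ns ∘ same-map φ₁))
      up₁ : ∀ {p q} → (∃ λ c → ∃ λ d → D.π (φ₁ (σ c)) ≡ p × D.π (φ₁ (σ d)) ≡ q × Edge H₁ c d) → Edge H p q
      up₁ (c , d , refl , refl , e) with proj₁ (D₁.π-adj (σ c) (σ d)) (subst₂ (Edge H₁) (sym (πσ c)) (sym (πσ d)) e)
      ... | e' , ns = proj₂ (D.π-adj _ _) (edge₁ e' , ns ∘ same-map⁻ φ₁-inj)
      up₂ : ∀ {p q} → (∃ λ c → ∃ λ d → D.π (φ₂ c) ≡ p × D.π (φ₂ d) ≡ q × Edge G₂ c d) → Edge H p q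
      up₂ (c , d , refl , refl , e) = proj₂ (D.π-adj _ _) (edge₂ e , not₂ e)

  module _ {H H₁ : Graph} {a b : Fin (n G₁)} (D₁ : ContractEdge G₁ H₁ a b) (D : ContractEdge G H (φ₁ a) (φ₁ b)) where
    private
      module D₁ = ContractEdge D₁
      module D = ContractEdge D
      σ : Fin (n H₁) → Fin (n G₁)
      σ p = proj₁ (D₁.π-surj p)
      πσ : ∀ p → D₁.π (σ p) ≡ p
      πσ p = proj₂ (D₁.π-surj p)
      merged : ∀ {c d} → SamePair c d a b → D.π (φ₁ c) ≡ D.π (φ₁ d)
      merged (inj₁ (refl , refl)) = D.π-uv
      merged (inj₂ (refl , refl)) = sym D.π-uv
      merged₁ : ∀ {c d} → SamePair c d a b → D₁.π c ≡ D₁.π d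
      merged₁ (inj₁ (refl , refl)) = D₁.π-uv
      merged₁ (inj₂ (refl , refl)) = sym D₁.π-uv
      follow : ∀ c → D.π (φ₁ (σ (D₁.π c))) ≡ D.π (φ₁ c)
      follow c = [ cong (D.π ∘ φ₁) , merged ]′ (D₁.π-inj _ _ (πσ (D₁.π c)))
      inj₁′ : ∀ c d → D.π (φ₁ c) ≡ D.π (φ₁ d) → D₁.π c ≡ D₁.π d
      inj₁′ c d e = [ (λ q → cong D₁.π (φ₁-inj _ _ q)) , (λ s → merged₁ (same-map⁻ φ₁-inj s)) ]′ (D.π-inj _ _ e)
      inj₂′ : ∀ c d → D.π (φ₂ c) ≡ D.π (φ₂ d) → c ≡ d
      inj₂′ c d e with D.π-inj _ _ e
      ... | inj₁ q = φ₂-inj _ _ q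
      ... | inj₂ (inj₁ (p , q)) = contradiction (both-common (edge-≢ G₁ D₁.isEdge) (sym p) (sym q)) D₁.notXY
      ... | inj₂ (inj₂ (p , q)) = contradiction (both-common (edge-≢ G₁ D₁.isEdge) (sym q) (sym p)) D₁.notXY
      at-terminal : ∀ {c d} → φ₁ c ≡ φ₂ d → D.π (φ₂ d) ≡ x H ⊎ D.π (φ₂ d) ≡ y H
      at-terminal {c} {d} e with shared c d e
      ... | inj₁ q = inj₁ (trans (cong D.π (trans (sym e) q)) D.π-x)
      ... | inj₂ q = inj₂ (trans (cong D.π (trans (sym e) q)) D.π-y)

    -- Contracting an edge other than xy identifies no two vertices of `G₂`. An end that lies in
    -- `G₂` is a terminal, and the merged vertex is then that terminal of `H`, so the parts still
    -- meet in terminals only.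
    contract-sum : XYSum H H₁ G₂
    contract-sum = record
      { φ₁ = λ p → D.π (φ₁ (σ p)) ; φ₂ = λ c → D.π (φ₂ c)
      ; φ₁-inj = λ p q e → trans (sym (πσ p)) (trans (inj₁′ _ _ e) (πσ q))
      ; φ₂-inj = inj₂′
      ; φ₁-x = trans (cong (D.π ∘ φ₁ ∘ σ) (sym D₁.π-x)) (trans (follow _) (trans (cong D.π φ₁-x) D.π-x))
      ; φ₁-y = trans (cong (D.π ∘ φ₁ ∘ σ) (sym D₁.π-y)) (trans (follow _) (trans (cong D.π φ₁-y) D.π-y))
      ; φ₂-x = trans (cong D.π φ₂-x) D.π-x ; φ₂-y = trans (cong D.π φ₂-y) D.π-y
      ; cover = λ w → let v , e = D.π-surj w in [ (λ (c , q) → inj₁ (D₁.π c , trans (follow c) (trans (cong D.π q) e)))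
                                               , (λ (c , q) → inj₂ (c , trans (cong D.π q) e)) ]′ (cover v)
      ; shared = λ p c e → subst (λ w → w ≡ x H ⊎ w ≡ y H) (sym e) (meet p c (D.π-inj _ _ e))
      ; edges = λ p q → down p q , [ up₁ , up₂ ]′ }
      where
      meet : ∀ p c → φ₁ (σ p) ≡ φ₂ c ⊎ SamePair (φ₁ (σ p)) (φ₂ c) (φ₁ a) (φ₁ b) → D.π (φ₂ c) ≡ x H ⊎ D.π (φ₂ c) ≡ y H
      meet p c (inj₁ e) = at-terminal e
      meet p c (inj₂ (inj₁ (_ , q))) = at-terminal (sym q)
      meet p c (inj₂ (inj₂ (_ , q))) = at-terminal (sym q)
      down : ∀ p q → Edge H p q → _ ⊎ _
      down p q e with proj₁ (D.π-adj p q) e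
      ... | p≢q , v , w , refl , refl , e' with proj₁ (edges v w) e'
      ...   | inj₂ (c , d , r , s , e₂) = inj₂ (c , d , cong D.π r , cong D.π s , e₂)
      ...   | inj₁ (c , d , refl , refl , e₁) = inj₁ (D₁.π c , D₁.π d , follow c , follow d ,
                proj₂ (D₁.π-adj _ _) ((λ q → p≢q (trans (sym (follow c)) (trans (cong (D.π ∘ φ₁ ∘ σ) q) (follow d)))) , c , d , refl , refl , e₁))
      up₁ : ∀ {p q} → (∃ λ c → ∃ λ d → D.π (φ₁ (σ c)) ≡ p × D.π (φ₁ (σ d)) ≡ q × Edge H₁ c d) → Edge H p q
      up₁ (c , d , refl , refl , e) with proj₁ (D₁.π-adj c d) e
      ... | c≢d , c' , d' , refl , refl , e' = proj₂ (D.π-adj _ _)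
            ((λ q → c≢d (trans (sym (πσ _)) (trans (inj₁′ _ _ q) (πσ _)))) , φ₁ c' , φ₁ d' , sym (follow c') , sym (follow d') , edge₁ e')
      up₂ : ∀ {p q} → (∃ λ c → ∃ λ d → D.π (φ₂ c) ≡ p × D.π (φ₂ d) ≡ q × Edge G₂ c d) → Edge H p q
      up₂ (c , d , refl , refl , e) = proj₂ (D.π-adj _ _) ((λ q → edge-≢ G₂ e (inj₂′ _ _ q)) , φ₂ c , φ₂ d , refl , refl , edge₂ e)

  -- Transfers criticality from a sum to its parts; `restrict-minor` is the opposite direction, from
  -- the parts to the sum.
  extend-minor : NoXY G₁ → ∀ {H₁} → MinorOp G₁ H₁ → Σ Graph λ H → MinorOp G H × XYSum H H₁ G₂
  extend-minor nx (a , b , inj₁ D₁) = let H , D = deletion G (edge₁ (DeleteEdge.isEdge D₁)) in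
    H , (_ , _ , inj₁ D) , delete-sum nx D₁ D
  extend-minor nx (a , b , inj₂ D₁) = let H , D = contraction G (edge₁ (ContractEdge.isEdge D₁)) (λ s → ContractEdge.notXY D₁ (pair₁⁻ s)) in
    H , (_ , _ , inj₂ D) , contract-sum D₁ D

  restrict-delete : NoXY G₁ → ∀ {H a b} → Edge G₁ a b → DeleteEdge G H (φ₁ a) (φ₁ b) → Σ Graph λ H₁ → MinorOp G₁ H₁ × XYSum H H₁ G₂
  restrict-delete nx e D = let H₁ , D₁ = deletion G₁ e in H₁ , (_ , _ , inj₁ D₁) , delete-sum nx D₁ D

  restrict-contract : ∀ {H a b} → Edge G₁ a b → ContractEdge G H (φ₁ a) (φ₁ b) → Σ Graph λ H₁ → MinorOp G₁ H₁ × XYSum H H₁ G₂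
  restrict-contract e D = let H₁ , D₁ = contraction G₁ e (λ s → ContractEdge.notXY D (pair₁ s)) in H₁ , (_ , _ , inj₂ D₁) , contract-sum D₁ D

restrict-minor : ∀ {G G₁ G₂} → XYSum G G₁ G₂ → NoXY G₁ → NoXY G₂ → ∀ {H} → MinorOp G H →
  (Σ Graph λ H₁ → MinorOp G₁ H₁ × XYSum H H₁ G₂) ⊎ (Σ Graph λ H₂ → MinorOp G₂ H₂ × XYSum H H₂ G₁)
restrict-minor S n₁ n₂ (u , v , inj₁ D) with proj₁ (XYSum.edges S u v) (DeleteEdge.isEdge D)
... | inj₁ (a , b , refl , refl , e) = inj₁ (SumMinor.restrict-delete S n₁ e D)
... | inj₂ (a , b , refl , refl , e) = inj₂ (SumMinor.restrict-delete (sum-sym S) n₂ e D)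
restrict-minor S n₁ n₂ (u , v , inj₂ D) with proj₁ (XYSum.edges S u v) (ContractEdge.isEdge D)
... | inj₁ (a , b , refl , refl , e) = inj₁ (SumMinor.restrict-contract S e D)
... | inj₂ (a , b , refl , refl , e) = inj₂ (SumMinor.restrict-contract (sum-sym S) e D)

sum-noxy : ∀ {G G₁ G₂} → XYSum G G₁ G₂ → NoXY G₁ → NoXY G₂ → NoXY G
sum-noxy {G} {G₁} {G₂} S n₁ n₂ = Boolₚ.¬-not λ e → lem (proj₁ (edges _ _) (subst T (sym e) tt))
  where
  open XYSum S
  lem : _ ⊎ _ → ⊥
  lem (inj₁ (a , b , p , q , e)) = noxy-edge G₁ n₁ e (inj₁ (φ₁-inj _ _ (trans p (sym φ₁-x)) , φ₁-inj _ _ (trans q (sym φ₁-y))))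
  lem (inj₂ (a , b , p , q , e)) = noxy-edge G₂ n₂ e (inj₁ (φ₂-inj _ _ (trans p (sym φ₂-x)) , φ₂-inj _ _ (trans q (sym φ₂-y))))

-- The Euler genus of H₁⁺ is only known to exist classically, but the conclusion h < a + b is decidable.
minor-drops : ∀ {G₁ G₂ H H₁ a b h} → Critical⁺ G₁ → IsEulerGenus⁺ G₁ a → IsEulerGenus⁺ G₂ b →
  MinorOp G₁ H₁ → XYSum H H₁ G₂ → IsEulerGenus⁺ H h → h < a + b
minor-drops {H₁ = H₁} {a} {b} {h} crit ga gb op S gh = decidable-stable (h ℕₚ.<? a + b) λ ≮ →
  genus-exists (plus H₁) λ (h₁ , gh₁) →
    ≮ (subst (_< a + b) (genus-unique (genus-sum S gh₁ gb) gh) (ℕₚ.+-monoˡ-< b (crit H₁ op a h₁ ga gh₁)))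

sum-critical : ∀ {G G₁ G₂ a b} → XYSum G G₁ G₂ → NoXY G₁ → NoXY G₂ → Critical⁺ G₁ → Critical⁺ G₂ →
  IsEulerGenus⁺ G₁ a → IsEulerGenus⁺ G₂ b → Critical⁺ G
sum-critical {a = a} {b} S n₁ n₂ c₁ c₂ ga gb H op g h gg gh with genus-unique gg (genus-sum S ga gb) | restrict-minor S n₁ n₂ op
... | refl | inj₁ (H₁ , op₁ , S₁) = minor-drops c₁ ga gb op₁ S₁ gh
... | refl | inj₂ (H₂ , op₂ , S₂) = subst (h <_) (+-comm b a) (minor-drops c₂ gb ga op₂ S₂ gh)

-- The minor lifts to a minor of the sum of genus `h + b`, and `b` cancels.
part-critical : ∀ {G G₁ G₂ a b} → XYSum G G₁ G₂ → NoXY G₁ → Critical⁺ G → IsEulerGenus⁺ G₁ a → IsEulerGenus⁺ G₂ b → Critical⁺ G₁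
part-critical {a = a} {b} S n₁ crit ga gb H₁ op g h gg gh with genus-unique gg ga | SumMinor.extend-minor S n₁ op
... | refl | H , opH , SH = ℕₚ.+-cancelʳ-< b h a (crit H opH (a + b) (h + b) (genus-sum S ga gb) (genus-sum SH gh gb))

-- A better embedding of `plus G₁`, joined with the given one of `plus G₂`, would embed the sum
-- below its genus.
part-genus : ∀ {G G₁ G₂ a b g} → XYSum G G₁ G₂ → IsEulerGenus⁺ G g → EmbedsIn (plus G₁) a → EmbedsIn (plus G₂) b → a + b ≤ g → IsEulerGenus⁺ G₁ a
part-genus {a = a} {b} S (_ , min) ea eb le = ea , λ a' ea' → ℕₚ.+-cancelʳ-≤ b a a' (≤-trans le (min _ (join⁺ S ea' eb)))

first-edge : ∀ {G a b} → a ≢ b → Star (Edge G) a b → ∃ λ c → Edge G a c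
first-edge n ε = contradiction refl n
first-edge n (e ◅ _) = _ , e

-- If `plus G₁` has genus 0, then the sum has the genus of `plus G₂`. Deleting an edge of `G₁`
-- leaves `G₂` inside, so the genus does not fall, against criticality. Connectedness provides an
-- edge to delete.
positive-part : ∀ {G G₁ G₂ b} → XYSum G G₁ G₂ → NoXY G₁ → Connected G₁ → Critical⁺ G → IsEulerGenus⁺ G₁ 0 → ¬ IsEulerGenus⁺ G₂ b
positive-part {G₁ = G₁} S n₁ con crit g₁ g₂ with first-edge {G₁} (x≢y G₁) (con (x G₁) (y G₁))
... | c , e with SumMinor.extend-minor S n₁ (_ , _ , inj₁ (proj₂ (deletion G₁ e)))
...   | H , op , SH = genus-exists (plus H) λ (h , gh) → let a , b , _ , eb , le = split⁺ SH (proj₁ gh) in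
        ℕₚ.<⇒≱ (crit H op _ h (genus-sum S g₁ g₂) gh) (≤-trans (proj₂ g₂ b eb) (≤-trans (ℕₚ.m≤n+m b a) le))

-- Cutting a graph at its two terminals

module Induced (G : Graph) (q : Fin (n G) → Bool) (qx : T (q (x G))) (qy : T (q (y G))) where
  Sub : Set
  Sub = Σ (Fin (n G)) (T ∘ q)
  size : ℕ
  size = count q
  fS : Finite Sub size
  fS = fin-count q
  index : Sub → Fin size
  index = proj₁ fS
  at : Fin size → Sub
  at i = proj₁ (proj₁ (proj₂ fS) i)
  emb : Fin size → Fin (n G)
  emb i = proj₁ (at i)
  emb-index : ∀ s → emb (index s) ≡ proj₁ s
  emb-index s = cong proj₁ (proj₁ (proj₂ (proj₂ fS) _ _) (proj₂ (proj₁ (proj₂ fS) (index s))))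
  emb-inj : ∀ i j → emb i ≡ emb j → i ≡ j
  emb-inj i j e = trans (sym (proj₂ (proj₁ (proj₂ fS) i))) (trans (proj₂ (proj₂ (proj₂ fS) _ _) (lem (at i) (at j) e)) (proj₂ (proj₁ (proj₂ fS) j)))
    where
    lem : ∀ (s t : Sub) → proj₁ s ≡ proj₁ t → s ≡ t
    lem (v , p) (.v , p') refl = cong (v ,_) (T-irrelevant p p')
  graph : Graph
  graph = record { n = size ; adj = λ i j → adj G (emb i) (emb j) ; adj-sym = λ i j → adj-sym G _ _ ; adj-irr = λ i → adj-irr G _
    ; x = index (x G , qx) ; y = index (y G , qy)
    ; x≢y = λ e → x≢y G (trans (sym (emb-index (x G , qx))) (trans (cong emb e) (emb-index (y G , qy)))) }
  noxy : NoXY G → NoXY graph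
  noxy nx = trans (cong₂ (adj G) (emb-index (x G , qx)) (emb-index (y G , qy))) nx
  edge-up : ∀ {v w} (p : T (q v)) (p' : T (q w)) → Edge G v w → Edge graph (index (v , p)) (index (w , p'))
  edge-up p p' e = subst₂ (Edge G) (sym (emb-index (_ , p))) (sym (emb-index (_ , p'))) e

  -- A walk in `G - y` from an interior vertex to x stays in the interior until it meets x, and
  -- likewise with the terminals exchanged. The terminal y reaches x through the interior vertex
  -- `c`.
  module Linked (I : Fin (n G) → Set) (I⊆q : ∀ {w} → I w → T (q w)) (out : ∀ {w} → I w → w ≢ x G × w ≢ y G)
    (kind : ∀ {w} → T (q w) → I w ⊎ w ≡ x G ⊎ w ≡ y G)
    (closed : ∀ {v w} → I v → Edge G v w → w ≢ x G → w ≢ y G → I w)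
    (tc : ∀ v a b → a ≢ v → b ≢ v → Star (Avoid G (λ w → w ≡ v)) a b) (c : Fin (n G)) (Ic : I c) where
    to-x : ∀ {w z} (Iw : I w) → z ≡ x G → Star (Avoid G (λ w → w ≡ y G)) w z → Star (Edge graph) (index (w , I⊆q Iw)) (index (x G , qx))
    to-x Iw refl ε = contradiction refl (proj₁ (out Iw))
    to-x Iw e (_◅_ {j = j} (ed , _ , ny) s) with j F.≟ x G
    ... | yes refl = edge-up (I⊆q Iw) qx ed ◅ ε
    ... | no nx = edge-up (I⊆q Iw) (I⊆q (closed Iw ed nx ny)) ed ◅ to-x (closed Iw ed nx ny) e s
    to-y : ∀ {w z} (Iw : I w) → z ≡ y G → Star (Avoid G (λ w → w ≡ x G)) w z → Star (Edge graph) (index (w , I⊆q Iw)) (index (y G , qy))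
    to-y Iw refl ε = contradiction refl (proj₂ (out Iw))
    to-y Iw e (_◅_ {j = j} (ed , _ , nx) s) with j F.≟ y G
    ... | yes refl = edge-up (I⊆q Iw) qy ed ◅ ε
    ... | no ny = edge-up (I⊆q Iw) (I⊆q (closed Iw ed nx ny)) ed ◅ to-y (closed Iw ed nx ny) e s
    reach-x : ∀ {w} (Iw : I w) → Star (Edge graph) (index (w , I⊆q Iw)) (index (x G , qx))
    reach-x Iw = to-x Iw refl (tc _ _ _ (proj₂ (out Iw)) (x≢y G))
    reach-y : ∀ {w} (Iw : I w) → Star (Edge graph) (index (w , I⊆q Iw)) (index (y G , qy))
    reach-y Iw = to-y Iw refl (tc _ _ _ (proj₁ (out Iw)) (≢-sym (x≢y G)))
    at-index : ∀ i {w} (p : T (q w)) → emb i ≡ w → i ≡ index (w , p)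
    at-index i p e = emb-inj _ _ (trans e (sym (emb-index (_ , p))))
    all-x : ∀ i → Star (Edge graph) i (index (x G , qx))
    all-x i with kind (proj₂ (at i))
    ... | inj₁ Iw = subst (λ j → Star (Edge graph) j (index (x G , qx))) (sym (at-index i (I⊆q Iw) refl)) (reach-x Iw)
    ... | inj₂ (inj₁ e) = subst (λ j → Star (Edge graph) j (index (x G , qx))) (sym (at-index i qx e)) ε
    ... | inj₂ (inj₂ e) = subst (λ j → Star (Edge graph) j (index (x G , qx))) (sym (at-index i qy e))
            (esym (star-equiv graph) (reach-y Ic) ◅◅ reach-x Ic)
    connected : Connected graph
    connected i j = all-x i ◅◅ esym (star-equiv graph) (all-x j)

module Cut (G : Graph) (nx : NoXY G) (tc : TwoConnected G) (cut : XYCut G) where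
  a b : Fin (n G)
  a = proj₁ cut
  b = proj₁ (proj₂ cut)
  a≢x = proj₁ (proj₂ (proj₂ cut))
  a≢y = proj₁ (proj₂ (proj₂ (proj₂ cut)))
  b≢x = proj₁ (proj₂ (proj₂ (proj₂ (proj₂ cut))))
  b≢y = proj₁ (proj₂ (proj₂ (proj₂ (proj₂ (proj₂ cut)))))
  a≁b = proj₂ (proj₂ (proj₂ (proj₂ (proj₂ (proj₂ cut)))))

  AtXY : Fin (n G) → Set
  AtXY w = w ≡ x G ⊎ w ≡ y G
  terminal? : ∀ w → Dec (AtXY w)
  terminal? w = (w F.≟ x G) ⊎-dec (w F.≟ y G)
  A? : ∀ v w → Dec (Avoid G AtXY v w)
  A? v w = T? (adj G v w) ×-dec (¬? (terminal? v) ×-dec ¬? (terminal? w))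
  -- Avoid G AtXY made into a graph, in order to decide reachability in G - x - y.
  inner : Graph
  inner = relation-graph (Avoid G AtXY) A? (λ (e , p , q) → edge-sym G e , q , p) (λ (e , _) → edge-≢ G e refl) (x G) (y G) (x≢y G)
  InC : Fin (n G) → Set
  InC w = Star (Edge inner) a w
  abstract
    inC? : ∀ w → Dec (InC w)
    inC? w = nc-dec (nc-components inner) a w
  inner-edge : ∀ {v w} → Edge G v w → ¬ AtXY v → ¬ AtXY w → Edge inner v w
  inner-edge e p q = fromWitness (e , p , q)
  inner-avoid : ∀ {v w} → Star (Edge inner) v w → Star (Avoid G AtXY) v w
  inner-avoid = gmap id toWitness
  b∉C : ¬ InC b
  b∉C s = a≁b (inner-avoid s)
  avoids : ∀ {v w} → ¬ AtXY v → Star (Avoid G AtXY) v w → ¬ AtXY w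
  avoids n ε = n
  avoids n ((_ , _ , q) ◅ s) = avoids q s
  C-out : ∀ {w} → InC w → ¬ AtXY w
  C-out s = avoids [ a≢x , a≢y ]′ (inner-avoid s)
  C-step : ∀ {v w} → InC v → Edge G v w → ¬ AtXY w → InC w
  C-step s e n = s ◅◅ (inner-edge e (C-out s) n ◅ ε)

  -- The first part is the component of `a` in `G - x - y` together with the terminals. The second
  -- part is everything outside that component and may contain several further ones, each attached
  -- to both terminals.
  in₁? : ∀ w → Dec (InC w ⊎ AtXY w)
  in₁? w = inC? w ⊎-dec terminal? w
  in₂? : ∀ w → Dec (¬ InC w)
  in₂? w = ¬? (inC? w)

  module I₁ = Induced G (λ w → ⌊ in₁? w ⌋) (fromWitness (inj₂ (inj₁ refl))) (fromWitness (inj₂ (inj₂ refl)))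
  module I₂ = Induced G (λ w → ⌊ in₂? w ⌋) (fromWitness (λ s → C-out s (inj₁ refl))) (fromWitness (λ s → C-out s (inj₂ refl)))

  connected₁ : Connected I₁.graph
  connected₁ = I₁.Linked.connected InC (λ s → fromWitness (inj₁ s)) (λ s → (C-out s ∘ inj₁) , (C-out s ∘ inj₂)) toWitness
    (λ s e n n' → C-step s e [ n , n' ]′) (proj₂ (proj₂ tc)) a ε

  Outer : Fin (n G) → Set
  Outer w = ¬ InC w × ¬ AtXY w

  connected₂ : Connected I₂.graph
  connected₂ = I₂.Linked.connected Outer (λ s → fromWitness (proj₁ s)) (λ (_ , s) → (s ∘ inj₁) , (s ∘ inj₂)) kind
    (λ (p , q) e n n' → (λ s → p (C-step s (edge-sym G e) q)) , [ n , n' ]′) (proj₂ (proj₂ tc)) b (b∉C , [ b≢x , b≢y ]′)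
    where
    kind : ∀ {w} → T ⌊ in₂? w ⌋ → Outer w ⊎ w ≡ x G ⊎ w ≡ y G
    kind {w} t with terminal? w
    ... | yes k = inj₂ k
    ... | no nk = inj₁ (toWitness t , nk)

  sum : XYSum G I₁.graph I₂.graph
  sum = record
    { φ₁ = I₁.emb ; φ₂ = I₂.emb ; φ₁-inj = I₁.emb-inj ; φ₂-inj = I₂.emb-inj
    ; φ₁-x = I₁.emb-index _ ; φ₁-y = I₁.emb-index _ ; φ₂-x = I₂.emb-index _ ; φ₂-y = I₂.emb-index _
    ; cover = cover
    ; shared = λ i j e → [ (λ s → contradiction (subst InC e s) (toWitness (proj₂ (I₂.at j)))) , id ]′ (toWitness (proj₂ (I₁.at i)))
    ; edges = λ p q → down p q , up }
    where
    cover : ∀ w → (∃ λ i → I₁.emb i ≡ w) ⊎ (∃ λ j → I₂.emb j ≡ w)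
    cover w with inC? w
    ... | yes s = inj₁ (I₁.index (w , fromWitness (inj₁ s)) , I₁.emb-index _)
    ... | no ns = inj₂ (I₂.index (w , fromWitness ns) , I₂.emb-index _)
    first : ∀ {p q} → InC p ⊎ AtXY p → InC q ⊎ AtXY q → Edge G p q →
      ∃ λ i → ∃ λ j → I₁.emb i ≡ p × I₁.emb j ≡ q × Edge I₁.graph i j
    first s t e = I₁.index (_ , fromWitness s) , I₁.index (_ , fromWitness t) , I₁.emb-index _ , I₁.emb-index _ , I₁.edge-up _ _ e
    next : ∀ {p q} → InC p → Edge G p q → InC q ⊎ AtXY q
    next {q = q} s e with terminal? q
    ... | yes k = inj₂ k
    ... | no nk = inj₁ (C-step s e nk)
    -- An edge with an end in the component has its other end there or at a terminal. Every other
    -- edge lies outside the component.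
    down : ∀ p q → Edge G p q → (∃ λ i → ∃ λ j → I₁.emb i ≡ p × I₁.emb j ≡ q × Edge I₁.graph i j) ⊎
      (∃ λ i → ∃ λ j → I₂.emb i ≡ p × I₂.emb j ≡ q × Edge I₂.graph i j)
    down p q e with inC? p | inC? q
    ... | yes s | _ = inj₁ (first (inj₁ s) (next s e) e)
    ... | no _ | yes t = inj₁ (first (next t (edge-sym G e)) (inj₁ t) e)
    ... | no s | no t = inj₂ (I₂.index (p , fromWitness s) , I₂.index (q , fromWitness t) , I₂.emb-index _ , I₂.emb-index _ , I₂.edge-up _ _ e)
    up : ∀ {p q} → (∃ λ i → ∃ λ j → I₁.emb i ≡ p × I₁.emb j ≡ q × Edge I₁.graph i j) ⊎
      (∃ λ i → ∃ λ j → I₂.emb i ≡ p × I₂.emb j ≡ q × Edge I₂.graph i j) → Edge G p q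
    up (inj₁ (i , j , refl , refl , e)) = e
    up (inj₂ (i , j , refl , refl , e)) = e

theorem5p9 : ((G G₁ G₂ : Graph) →
    Connected G₁ → Connected G₂ → NoXY G₁ → NoXY G₂ →
    XYSum G G₁ G₂ → InC° 0 G₁ → InC° 1 G₂ → InC° 2 G)
    ×
    ((G : Graph) → TwoConnected G → InC° 2 G → XYCut G →
    Σ Graph λ G₁ → Σ Graph λ G₂ →
    Connected G₁ × Connected G₂ × NoXY G₁ × NoXY G₂ ×
    InC° 0 G₁ × InC° 1 G₂ × XYSum G G₁ G₂)
theorem5p9 =
  (λ G G₁ G₂ _ _ n₁ n₂ S (_ , c₁ , g₁) (_ , c₂ , g₂) → sum-noxy S n₁ n₂ , sum-critical S n₁ n₂ c₁ c₂ g₁ g₂ , genus-sum S g₁ g₂) ,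
  λ G tc (nx , crit , gG) cut → decompose G tc nx crit gG cut
  where
  Decomposition : Graph → Set
  Decomposition G = Σ Graph λ G₁ → Σ Graph λ G₂ → Connected G₁ × Connected G₂ × NoXY G₁ × NoXY G₂ × InC° 0 G₁ × InC° 1 G₂ × XYSum G G₁ G₂
  -- Genus 0 is excluded for either part, which leaves 1 and 2 in one of the two orders; in the
  -- second order the parts exchange their roles.
  genera : ∀ {G G₁ G₂} → Connected G₁ → Connected G₂ → NoXY G₁ → NoXY G₂ → XYSum G G₁ G₂ → Critical⁺ G → IsEulerGenus⁺ G 3 →
    ∀ a b → a + b ≡ 3 → IsEulerGenus⁺ G₁ a → IsEulerGenus⁺ G₂ b → Decomposition G
  genera k₁ k₂ n₁ n₂ S crit gG 0 b e ga gb = contradiction gb (positive-part S n₁ k₁ crit ga)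
  genera k₁ k₂ n₁ n₂ S crit gG 1 .2 refl ga gb =
    _ , _ , k₁ , k₂ , n₁ , n₂ , (n₁ , part-critical S n₁ crit ga gb , ga) , (n₂ , part-critical (sum-sym S) n₂ crit gb ga , gb) , S
  genera k₁ k₂ n₁ n₂ S crit gG 2 .1 refl ga gb =
    _ , _ , k₂ , k₁ , n₂ , n₁ , (n₂ , part-critical (sum-sym S) n₂ crit gb ga , gb) , (n₁ , part-critical S n₁ crit ga gb , ga) , sum-sym S
  genera k₁ k₂ n₁ n₂ S crit gG 3 .0 refl ga gb = contradiction ga (positive-part (sum-sym S) n₂ k₂ crit gb)
  genera k₁ k₂ n₁ n₂ S crit gG (suc (suc (suc (suc a)))) b () ga gb
  decompose : ∀ G → TwoConnected G → NoXY G → Critical⁺ G → IsEulerGenus⁺ G 3 → XYCut G → Decomposition G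
  decompose G tc nx crit gG cut = genera K.connected₁ K.connected₂ (K.I₁.noxy nx) (K.I₂.noxy nx) K.sum crit gG a b
      -- Splitting bounds the sum of the genera by 3, and a smaller sum would by joining embed
      -- `plus G` below its genus.
      (≤-antisym le (proj₂ gG _ (join⁺ K.sum ea eb)))
      (part-genus K.sum gG ea eb le) (part-genus (sum-sym K.sum) gG eb ea (subst (_≤ 3) (+-comm a b) le))
    where
    module K = Cut G nx tc cut
    sp = split⁺ K.sum (proj₁ gG)
    a = proj₁ sp
    b = proj₁ (proj₂ sp)
    ea = proj₁ (proj₂ (proj₂ sp))
    eb = proj₁ (proj₂ (proj₂ (proj₂ sp)))
    le = proj₂ (proj₂ (proj₂ (proj₂ sp)))
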